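{- For a permutation $\pi=\pi_1\cdots\pi_n$ of $[n]$, let $G_\pi$ be its grid graph (defined in the context). Let $\mathrm{Av}_n(213)$ be the set of permutations of $[n]$ avoiding the pattern $213$, and for $r\in\{1,2,3,4\}$ let \[ Q_r(n)=\sum_{\pi\in\mathrm{Av}_n(213)}\#\{v\in V(G_\pi):\deg(v)=r\}. \] Write $B_n=\binom{2n}{n}$. Then for all $n\ge 2$, \begin{align*} Q_1(n) &= \frac{n+2}{2(2n-1)}\,B_n,\\ Q_2(n) &= \frac{(12n^2+44n-112)\,B_n+(2n^2+n-1)\,4^n}{16(n+1)(2n-1)},\\ Q_3(n) &= \frac{(8n^2-96n+88)\,B_n+(6n^2+3n-3)\,4^n}{8(n+1)(2n-1)},\\ Q_4(n) &= \frac{(4n^3-7n^2+29n-20)\,B_n}{4(n+1)(2n-1)}-7\cdot 4^{\,n-2}. \end{align*}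
   Context: The grid graph $G_\pi$ of a permutation $\pi=\pi_1\cdots\pi_n$ of $[n]=\{1,\dots,n\}$ has vertex set $V(G_\pi)=\{(i,j):1\le i\le n,\ 1\le j\le \pi_i\}$; two vertices $(i,j),(i',j')$ are adjacent iff either $i=i'$ and $|j-j'|=1$ (vertical edge), or $|i-i'|=1$ and $j=j'$ (horizontal edge). A permutation avoids $213$ if there are no indices $p<q<r$ with $\pi_q<\pi_p<\pi_r$. -}

module Defs where

open import Data.Nat using (ℕ; zero; suc; _+_; _∸_; _≡ᵇ_; _<ᵇ_; _≤ᵇ_)
open import Data.Bool using (Bool; true; false; _∧_; not; if_then_else_)
open import Data.List using (List; []; _∷_; map; concatMap; filter; upTo)
open import Data.Bool.ListAction using (all; any)
open import Data.Nat.ListAction using (sum)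
open import Relation.Nullary.Decidable using (does)
open import Data.Bool.Properties using (T?)
open import Data.Bool using (T)

-- A permutation π = π₁ ⋯ πₙ of [n] is represented by the list [π₁, …, πₙ].

range1 : ℕ → List ℕ
range1 n = map suc (upTo n)

lists : ℕ → ℕ → List (List ℕ)
lists n zero    = [] ∷ []
lists n (suc k) = concatMap (λ x → map (x ∷_) (lists n k)) (range1 n)

-- a length-n list with entries in [n] is a permutation of [n] iff every k ∈ [n] occurs
isPerm : ℕ → List ℕ → Bool
isPerm n π = all (λ k → any (λ x → x ≡ᵇ k) π) (range1 n)

perms : ℕ → List (List ℕ)
perms n = filter (λ π → T? (isPerm n π)) (lists n n)

-- height π i = π_i for 1 ≤ i ≤ length π, and 0 otherwise (in particular at i = 0, n+1)
height : List ℕ → ℕ → ℕ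
height π        zero          = 0
height []       (suc i)       = 0
height (x ∷ π)  (suc zero)    = x
height (x ∷ π)  (suc (suc i)) = height π (suc i)

contains213 : ℕ → List ℕ → Bool
contains213 n π =
  any (λ p → any (λ q → any (λ r →
        (p <ᵇ q) ∧ (q <ᵇ r) ∧ (height π q <ᵇ height π p) ∧ (height π p <ᵇ height π r))
      (range1 n)) (range1 n)) (range1 n)

Av213 : ℕ → List (List ℕ)
Av213 n = filter (λ π → T? (not (contains213 n π))) (perms n)

b2n : Bool → ℕ
b2n true  = 1
b2n false = 0

-- degree of the vertex (i , j) of G_π, for 1 ≤ i ≤ n, 1 ≤ j ≤ π_i:
-- neighbours (i, j-1), (i, j+1), (i-1, j), (i+1, j) when they are vertices
deg : List ℕ → ℕ → ℕ → ℕ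
deg π i j =
    b2n (2 ≤ᵇ j)
  + b2n (suc j ≤ᵇ height π i)
  + b2n (j ≤ᵇ height π (i ∸ 1))
  + b2n (j ≤ᵇ height π (suc i))

-- #{ v ∈ V(G_π) : deg v = r },  V(G_π) = {(i,j) : 1 ≤ i ≤ n, 1 ≤ j ≤ π_i}
countDeg : ℕ → ℕ → List ℕ → ℕ
countDeg n r π =
  sum (map (λ i → sum (map (λ j → b2n (deg π i j ≡ᵇ r)) (range1 (height π i)))) (range1 n))

Q : ℕ → ℕ → ℕ
Q r n = sum (map (countDeg n r) (Av213 n))

{-# OPTIONS --safe #-}
module Submission where

-- A 213-avoiding permutation splits at its minimum as (L + |R| + 1) 1 (R + 1) with L and R again
-- 213-avoiding.  The vertices of degree 1 are the peaks together with a column of height 1 at the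
-- border, and all four degree counts reduce to this number, to n, and to the sums of min − 1 over
-- windows of two and of three consecutive entries.  Each of these statistics f satisfies
-- f(π) = f(L) + f(R) + w(|L|, |R|), so its generating function is F = x W / (1 − 2 x c) with
-- c = 1 + x c² the Catalan series.  For peaks W = 1, which gives x b with b = 1 / (1 − 2 x c);
-- the relations b² = 1 + 4 x b² and x b′ = 2 x b³ identify b as the central binomial series and
-- b² as Σ 4ⁿ xⁿ, and express the other two totals through Bₙ, Cₙ and 4ⁿ.

-- Four linear relations determine the four totals. Summing heights counts the vertices, the
-- handshake count expresses the sum of all degrees by minima of neighbouring columns, degree 1 is
-- computed directly, and an identity telescoping in the ascents of π gives Q₄ + Q₁ by minima of
-- three neighbouring columns. Leaves are not additive over the splitting, because a column of
-- height 1 is one only at the border; peaks are, except for two empty blocks, so they carry the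
-- recursion. The minimum over a window of L grows by m + 1 with m = |R|, so the weight contains (m
-- + 1)Cₘ; as this is Bₘ, the weight series is again built from b and c. Coefficients are natural
-- numbers: 1 / (1 - 2xc) is represented by a series b with b = 1 + 2xcb, and identities are
-- rearranged until no subtraction is left. Only the final linear algebra, with coefficients such as
-- 2n - 1, is done over the integers. The bound n ≥ 2 excludes the one vertex of degree 0, which
-- occurs for n = 1.

open import Defs

-- Formal power series with natural coefficients.

module FormalSeries where

  open import Algebra.Bundles using (CommutativeSemiring)
  open import Data.Nat
  open import Data.Nat.Properties
  open import Data.Nat.Tactic.RingSolver using (solve-∀)
  open import Data.Product using (_,_)
  open import Function using (_∘_)
  open import Level using (0ℓ)
  open import Relation.Binary.PropositionalEquality


  Series : Set
  Series = ℕ → ℕ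

  infix 4 _≈_
  _≈_ : Series → Series → Set
  f ≈ g = ∀ n → f n ≡ g n

  -- The kernel is arbitrary rather than a product, so that the weighted sums over all splittings k
  -- + m = n fall under the same lemmas as the Cauchy product.
  antidiagonal : (ℕ → ℕ → ℕ) → ℕ → ℕ
  antidiagonal h zero    = h 0 0
  antidiagonal h (suc n) = h 0 (suc n) + antidiagonal (h ∘ suc) n

  antidiagonal-cong : ∀ {h h′ : ℕ → ℕ → ℕ} → (∀ i j → h i j ≡ h′ i j) → antidiagonal h ≈ antidiagonal h′
  antidiagonal-cong e zero    = e 0 0
  antidiagonal-cong e (suc n) = cong₂ _+_ (e 0 (suc n)) (antidiagonal-cong (e ∘ suc) n)

  +-interchange : ∀ a b c d → (a + b) + (c + d) ≡ (a + c) + (b + d)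
  +-interchange = solve-∀

  antidiagonal-+ : ∀ (h h′ : ℕ → ℕ → ℕ) n →
    antidiagonal (λ i j → h i j + h′ i j) n ≡ antidiagonal h n + antidiagonal h′ n
  antidiagonal-+ h h′ zero    = refl
  antidiagonal-+ h h′ (suc n) = trans
    (cong (h 0 (suc n) + h′ 0 (suc n) +_) (antidiagonal-+ (h ∘ suc) (h′ ∘ suc) n))
    (+-interchange (h 0 (suc n)) _ _ _)

  antidiagonal-* : ∀ a (h : ℕ → ℕ → ℕ) n → antidiagonal (λ i j → a * h i j) n ≡ a * antidiagonal h n
  antidiagonal-* a h zero    = refl
  antidiagonal-* a h (suc n) = trans
    (cong (a * h 0 (suc n) +_) (antidiagonal-* a (h ∘ suc) n))
    (sym (*-distribˡ-+ a _ _))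

  infixl 6 _⊕_
  infixl 7 _⊛_

  _⊕_ _⊛_ : Series → Series → Series
  (f ⊕ g) n = f n + g n
  f ⊛ g = antidiagonal (λ i j → f i * g j)

  𝟘 𝟙 X : Series
  𝟘 _ = 0
  𝟙 zero    = 1
  𝟙 (suc _) = 0
  X zero    = 0
  X (suc n) = 𝟙 n

  -- The Euler operator x d/dx, a derivation that shifts no index.
  θ : Series → Series
  θ f n = n * f n

  ⊛-cong : ∀ {f f′ g g′} → f ≈ f′ → g ≈ g′ → f ⊛ g ≈ f′ ⊛ g′
  ⊛-cong p q = antidiagonal-cong (λ i j → cong₂ _*_ (p i) (q j))

  ⊛-distribʳ : ∀ h f g → (f ⊕ g) ⊛ h ≈ f ⊛ h ⊕ g ⊛ h
  ⊛-distribʳ h f g n = trans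
    (antidiagonal-cong (λ i j → *-distribʳ-+ (h j) (f i) (g i)) n)
    (antidiagonal-+ (λ i j → f i * h j) (λ i j → g i * h j) n)

  ⊛-scale : ∀ a f g → (λ i → a * f i) ⊛ g ≈ (λ n → a * (f ⊛ g) n)
  ⊛-scale a f g n = trans
    (antidiagonal-cong (λ i j → *-assoc a (f i) (g j)) n)
    (antidiagonal-* a (λ i j → f i * g j) n)

  -- `antidiagonal` recurses on the first factor; peeling off the second factor instead is what
  -- commutativity needs.
  ⊛-last : ∀ f g n → (f ⊛ g) (suc n) ≡ f (suc n) * g 0 + (f ⊛ (g ∘ suc)) n
  ⊛-last f g zero    = +-comm (f 0 * g 1) _
  ⊛-last f g (suc n) = trans
    (cong (f 0 * g (suc (suc n)) +_) (⊛-last (f ∘ suc) g n))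
    (lemma (f 0 * g (suc (suc n))) (f (suc (suc n)) * g 0) _)
    where
    lemma : ∀ a b c → a + (b + c) ≡ b + (a + c)
    lemma = solve-∀

  ⊛-comm : ∀ f g → f ⊛ g ≈ g ⊛ f
  ⊛-comm f g zero    = *-comm (f 0) (g 0)
  ⊛-comm f g (suc n) = trans
    (cong₂ _+_ (*-comm (f 0) (g (suc n))) (⊛-comm (f ∘ suc) g n))
    (sym (⊛-last g f n))

  ⊛-assoc : ∀ f g h → (f ⊛ g) ⊛ h ≈ f ⊛ (g ⊛ h)
  ⊛-assoc f g h zero    = *-assoc (f 0) (g 0) (h 0)
  ⊛-assoc f g h (suc n) = begin
    f 0 * g 0 * h (suc n) + (((f ⊛ g) ∘ suc) ⊛ h) n
      ≡⟨ cong (f 0 * g 0 * h (suc n) +_)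
           (trans (⊛-distribʳ h (λ i → f 0 * g (suc i)) ((f ∘ suc) ⊛ g) n)
                  (cong₂ _+_ (⊛-scale (f 0) (g ∘ suc) h n) (⊛-assoc (f ∘ suc) g h n))) ⟩
    f 0 * g 0 * h (suc n) + (f 0 * ((g ∘ suc) ⊛ h) n + ((f ∘ suc) ⊛ (g ⊛ h)) n)
      ≡⟨ lemma (f 0) (g 0) (h (suc n)) _ _ ⟩
    f 0 * (g 0 * h (suc n) + ((g ∘ suc) ⊛ h) n) + ((f ∘ suc) ⊛ (g ⊛ h)) n ∎
    where
    open ≡-Reasoning
    lemma : ∀ a b c d e → a * b * c + (a * d + e) ≡ a * (b * c + d) + e
    lemma = solve-∀

  ⊛-zeroˡ : ∀ f → 𝟘 ⊛ f ≈ 𝟘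
  ⊛-zeroˡ f zero    = refl
  ⊛-zeroˡ f (suc n) = ⊛-zeroˡ f n

  ⊛-identityˡ : ∀ f → 𝟙 ⊛ f ≈ f
  ⊛-identityˡ f zero    = *-identityˡ (f 0)
  ⊛-identityˡ f (suc n) = trans (cong₂ _+_ (*-identityˡ (f (suc n))) (⊛-zeroˡ f n)) (+-identityʳ _)

  X⊛-suc : ∀ f n → (X ⊛ f) (suc n) ≡ f n
  X⊛-suc = ⊛-identityˡ

  -- Packaged for the polynomial solver, which then verifies identities between whole series in c, b
  -- and x.
  seriesSemiring : CommutativeSemiring 0ℓ 0ℓ
  seriesSemiring = record
    { Carrier = Series ; _≈_ = _≈_ ; _+_ = _⊕_ ; _*_ = _⊛_ ; 0# = 𝟘 ; 1# = 𝟙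
    ; isCommutativeSemiring = record
      { isSemiring = record
        { isSemiringWithoutAnnihilatingZero = record
          { +-isCommutativeMonoid = record
            { isMonoid = record
              { isSemigroup = record
                { isMagma = record
                  { isEquivalence = record
                    { refl = λ _ → refl ; sym = λ p n → sym (p n) ; trans = λ p q n → trans (p n) (q n) }
                  ; ∙-cong = λ p q n → cong₂ _+_ (p n) (q n) }
                ; assoc = λ f g h n → +-assoc (f n) (g n) (h n) }
              ; identity = (λ _ _ → refl) , (λ f n → +-identityʳ (f n)) }
            ; comm = λ f g n → +-comm (f n) (g n) }
          ; *-cong = ⊛-cong
          ; *-assoc = ⊛-assoc
          ; *-identity = ⊛-identityˡ , λ f n → trans (⊛-comm f 𝟙 n) (⊛-identityˡ f n)
          ; distrib = (λ f g h n → trans (⊛-comm f (g ⊕ h) n) (trans (⊛-distribʳ f g h n)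
                         (cong₂ _+_ (⊛-comm g f n) (⊛-comm h f n))))
                    , ⊛-distribʳ }
        ; zero = ⊛-zeroˡ , λ f n → trans (⊛-comm f 𝟘 n) (⊛-zeroˡ f n) }
      ; *-comm = ⊛-comm } }

  θ-⊛ : ∀ f g → θ (f ⊛ g) ≈ θ f ⊛ g ⊕ f ⊛ θ g
  θ-⊛ f g zero    = sym (*-zeroʳ (f 0))
  θ-⊛ f g (suc n) = begin
    suc n * (f 0 * g (suc n) + (f′ ⊛ g) n)
      ≡⟨ lemma₁ n (f 0) (g (suc n)) _ ⟩
    f 0 * (suc n * g (suc n)) + ((f′ ⊛ g) n + n * (f′ ⊛ g) n)
      ≡⟨ cong (λ z → f 0 * (suc n * g (suc n)) + ((f′ ⊛ g) n + z)) (θ-⊛ f′ g n) ⟩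
    f 0 * (suc n * g (suc n)) + ((f′ ⊛ g) n + ((θ f′ ⊛ g) n + (f′ ⊛ θ g) n))
      ≡⟨ lemma₂ (f 0 * (suc n * g (suc n))) ((f′ ⊛ g) n) _ _ ⟩
    ((f′ ⊛ g) n + (θ f′ ⊛ g) n) + (f 0 * (suc n * g (suc n)) + (f′ ⊛ θ g) n)
      -- `θ f ∘ suc` unfolds to `f′ ⊕ θ f′`, because `suc n * f′ n` is `f′ n + n * f′ n`.
      ≡⟨ cong (_+ (f 0 * (suc n * g (suc n)) + (f′ ⊛ θ g) n)) (sym (⊛-distribʳ g f′ (θ f′) n)) ⟩
    ((θ f ∘ suc) ⊛ g) n + (f 0 * (suc n * g (suc n)) + (f′ ⊛ θ g) n) ∎
    where
    open ≡-Reasoning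
    f′ = f ∘ suc
    lemma₁ : ∀ n a b c → suc n * (a * b + c) ≡ a * (suc n * b) + (c + n * c)
    lemma₁ = solve-∀
    lemma₂ : ∀ a b c d → a + (b + (c + d)) ≡ (b + c) + (a + d)
    lemma₂ = solve-∀

-- Algebra of the Catalan series c and of b = 1 / (1 - 2xc).

module CatalanGeneratingFunction where

  open FormalSeries
  open import Algebra.Bundles using (CommutativeSemiring)
  open import Data.Nat
  open import Data.Nat.Properties
  open import Data.Nat.Tactic.RingSolver using (solve-∀)
  open import Relation.Binary.PropositionalEquality
  open import Algebra.Solver.Ring.NaturalCoefficients.Default seriesSemiring

  open CommutativeSemiring seriesSemiring using ()
    renaming (refl to ≈-refl; sym to ≈-sym; trans to ≈-trans; +-cong to ⊕-cong)

  -- An identity f = g is a combination f − g = Σ p (l − r) of known relations l = r;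
  -- a negative multiplier p is realised by reversing its relation, so that no subtraction occurs.
  cancel-relation : ∀ {f g l r} → l ≈ r → f ⊕ r ≈ g ⊕ l → f ≈ g
  cancel-relation {f} {g} {l} {r} l≈r e n =
    +-cancelʳ-≡ (r n) (f n) (g n) (trans (e n) (cong (g n +_) (l≈r n)))

  infix 5 _⊙_
  _⊙_ : ∀ h {f g} → f ≈ g → h ⊛ f ≈ h ⊛ g
  h ⊙ p = ⊛-cong (≈-refl {h}) p

  halve : ∀ {f g} → f ⊕ f ≈ g ⊕ g → f ≈ g
  halve {f} {g} e n = *-cancelˡ-≡ (f n) (g n) 2 (trans (lemma (f n)) (trans (e n) (sym (lemma (g n)))))
    where
    lemma : ∀ a → 2 * a ≡ a + a
    lemma = solve-∀

  two four : Series → Series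
  two f  = f ⊕ f
  four f = two (two f)

  :two :four : ∀ {n} → Polynomial n → Polynomial n
  :two p  = p :+ p
  :four p = :two (:two p)

  module CatalanSeries (c b : Series)
    (c-eq : c ≈ 𝟙 ⊕ X ⊛ (c ⊛ c)) (b-eq : b ≈ 𝟙 ⊕ two (c ⊛ (X ⊛ b))) where

    -- This is c = 2b / (1 + b), the usual c = 2 / (1 + √(1 - 4x)) for b = 1 / √(1 - 4x). The
    -- variable x disappears because `c-eq` times 2b and `b-eq` times c share the term 2xc²b.
    b-c : two b ≈ c ⊕ c ⊛ b
    b-c = cancel-relation (⊕-cong (two 𝟙 ⊛ b ⊙ ≈-sym c-eq) (c ⊙ b-eq))
      (solve 3 (λ c b x →
        :two b :+ (:two (con 1) :* b :* c :+ c :* (con 1 :+ :two (c :* (x :* b))))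
        := c :+ c :* b :+ (:two (con 1) :* b :* (con 1 :+ x :* (c :* c)) :+ c :* b))
        ≈-refl c b X)

    -- By `b-eq`, (b + 1)(b - 1) = 2xb · c(b + 1), and `b-c` replaces c(b + 1) by 2b.
    b² : b ⊛ b ≈ 𝟙 ⊕ four (X ⊛ (b ⊛ b))
    b² = cancel-relation (⊕-cong (b ⊕ 𝟙 ⊙ b-eq) (two (X ⊛ b) ⊙ ≈-sym b-c))
      (solve 3 (λ c b x →
        b :* b :+ ((b :+ con 1) :* (con 1 :+ :two (c :* (x :* b))) :+ :two (x :* b) :* :two b)
        := con 1 :+ :four (x :* (b :* b)) :+ ((b :+ con 1) :* b :+ :two (x :* b) :* (c :+ c :* b)))
        ≈-refl c b X)

    -- The equation `b²` under `θ`, with θ(b²) written as 2b θb.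
    θb-linear : two (b ⊛ θ b) ≈ four (X ⊛ (b ⊛ b)) ⊕ four (X ⊛ two (b ⊛ θ b))
    θb-linear = ≈-trans (double b) (≈-trans θ-b²
      (⊕-cong {four (X ⊛ (b ⊛ b))} ≈-refl (λ n → cong (λ z → (z + z) + (z + z)) (⊛-cong {X} ≈-refl (≈-sym (double b)) n))))
      where
      double : ∀ f → two (f ⊛ θ f) ≈ θ (f ⊛ f)
      double f = ≈-trans (⊕-cong {f ⊛ θ f} (⊛-comm f (θ f)) ≈-refl) (≈-sym (θ-⊛ f f))
      θX : θ X ≈ X
      θX zero          = refl
      θX (suc zero)    = refl
      θX (suc (suc n)) = *-zeroʳ n
      θ-four : ∀ n y z w → n * y ≡ z + w → n * (0 + ((y + y) + (y + y))) ≡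
        ((z + z) + (z + z)) + ((w + w) + (w + w))
      θ-four n y z w e = trans (l₁ n y) (trans (cong (4 *_) e) (l₂ z w))
        where
        l₁ : ∀ n y → n * (0 + ((y + y) + (y + y))) ≡ 4 * (n * y)
        l₁ = solve-∀
        l₂ : ∀ z w → 4 * (z + w) ≡ ((z + z) + (z + z)) + ((w + w) + (w + w))
        l₂ = solve-∀
      θ-Xf : ∀ f → θ (X ⊛ f) ≈ X ⊛ f ⊕ X ⊛ θ f
      θ-Xf f = ≈-trans (θ-⊛ X f) (⊕-cong (⊛-cong {g = f} θX ≈-refl) ≈-refl)
      θ-b² : θ (b ⊛ b) ≈ four (X ⊛ (b ⊛ b)) ⊕ four (X ⊛ θ (b ⊛ b))
      θ-b² zero    = refl
      θ-b² (suc n) = trans (cong (suc n *_) (b² (suc n))) 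
        (θ-four (suc n) ((X ⊛ (b ⊛ b)) (suc n)) ((X ⊛ (b ⊛ b)) (suc n)) ((X ⊛ θ (b ⊛ b)) (suc n)) (θ-Xf (b ⊛ b) (suc n)))

    -- `θb-linear` says (1 - 4x) · 2b θb = 4xb². After multiplication by b, the factor (1 - 4x)b²
    -- becomes 1 by `b²`, which leaves twice the claim.
    θb : θ b ≈ two (X ⊛ (b ⊛ (b ⊛ b)))
    θb = halve (cancel-relation (⊕-cong (b ⊙ θb-linear) (two (θ b) ⊙ ≈-sym b²))
      (solve 3 (λ t b x →
        :two t :+ (b :* (:four (x :* (b :* b)) :+ :four (x :* :two (b :* t))) :+ :two t :* (b :* b))
        := :two (:two (x :* (b :* (b :* b))))
           :+ (b :* :two (b :* t) :+ :two t :* (con 1 :+ :four (x :* (b :* b)))))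
        ≈-refl (θ b) b X))

    -- Replacing b² in 2xb³ makes the equation linear in b, so that its coefficients give a two-term
    -- recurrence.
    θb-recurrence : θ b ≈ two (X ⊛ b) ⊕ four (X ⊛ θ b)
    θb-recurrence = cancel-relation (⊕-cong θb (⊕-cong (two (X ⊛ b) ⊙ b²) (four X ⊙ ≈-sym θb)))
      (solve 3 (λ t b x →
        t :+ (:two (x :* (b :* (b :* b))) :+ (:two (x :* b) :* (con 1 :+ :four (x :* (b :* b))) :+ :four x :* t))
        := :two (x :* b) :+ :four (x :* t)
           :+ (t :+ (:two (x :* b) :* (b :* b) :+ :four x :* :two (x :* (b :* (b :* b))))))
        ≈-refl (θ b) b X)

    -- A relation linear in b and c, from which coefficients can be read off: 4bₙ = 2cₙ + bₙ₊₁.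
    -- Together with the recurrence of b it yields (n + 1)cₙ = bₙ.
    Xb-Xc : four (X ⊛ b) ⊕ 𝟙 ≈ two (X ⊛ c) ⊕ b
    Xb-Xc = cancel-relation (⊕-cong (two X ⊙ b-c) (≈-sym b-eq))
      (solve 3 (λ c b x →
        :four (x :* b) :+ con 1 :+ (:two x :* (c :+ c :* b) :+ b)
        := :two (x :* c) :+ b :+ (:two x :* :two b :+ (con 1 :+ :two (c :* (x :* b)))))
        ≈-refl c b X)

    -- Multiplication by b acts as division by 1 - 2xc, since b(1 - 2xc) = 1 is `b-eq`.
    additive-solution : ∀ f w → f ≈ X ⊛ (two (c ⊛ f) ⊕ w) → f ≈ X ⊛ (b ⊛ w)
    additive-solution f w e = cancel-relation (⊕-cong (b ⊙ e) (f ⊙ ≈-sym b-eq))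
      (solve 5 (λ c b x f w →
        f :+ (b :* (x :* (:two (c :* f) :+ w)) :+ f :* b)
        := x :* (b :* w) :+ (b :* f :+ f :* (con 1 :+ :two (c :* (x :* b)))))
        ≈-refl c b X f w)

    -- Since 2xcb = b - 1, twice f is c₁(2xb² + b - 1). With c₁ = b + 1 - 2c and `b-c` for the
    -- product cb, only series with known coefficients remain: 2xb³ = θb, xb², b², b and c. Negative
    -- terms stand on the opposite side.
    pairs-solution : ∀ f c₁ → c₁ ⊕ two c ≈ b ⊕ 𝟙 → f ≈ X ⊛ (b ⊛ (c₁ ⊛ b ⊕ c ⊛ c₁)) →
      two f ⊕ (𝟙 ⊕ b ⊛ b ⊕ two b) ≈ θ b ⊕ two (X ⊛ (b ⊛ b)) ⊕ four c
    pairs-solution f c₁ e₁ ef = cancel-relation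
      (⊕-cong (two 𝟙 ⊙ ef) (⊕-cong (c₁ ⊙ ≈-sym b-eq) (⊕-cong (two (X ⊛ (b ⊛ b)) ⊕ b ⊙ e₁)
        (⊕-cong (≈-sym e₁) (⊕-cong (≈-sym θb) (⊕-cong (two b ⊙ b-eq) (two 𝟙 ⊙ b-c)))))))
      (solve 6 (λ c b x f c₁ t →
        :two f :+ (con 1 :+ b :* b :+ :two b) :+
          (:two (con 1) :* (x :* (b :* (c₁ :* b :+ c :* c₁))) :+ (c₁ :* b :+
          ((:two (x :* (b :* b)) :+ b) :* (b :+ con 1) :+ (c₁ :+ :two c :+
          (t :+ (:two b :* (con 1 :+ :two (c :* (x :* b))) :+ :two (con 1) :* (c :+ c :* b)))))))
        := t :+ :two (x :* (b :* b)) :+ :four c :+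
          (:two (con 1) :* f :+ (c₁ :* (con 1 :+ :two (c :* (x :* b))) :+
          ((:two (x :* (b :* b)) :+ b) :* (c₁ :+ :two c) :+ (b :+ con 1 :+
          (:two (x :* (b :* (b :* b))) :+ (:two b :* b :+ :two (con 1) :* :two b)))))))
        ≈-refl c b X f c₁ (θ b))

    -- The computation for pairs with c₂ = b + 2 + x - 3c; the summand x is the source of 2x²b², of
    -- xb and of the x on the left.
    triples-solution : ∀ f c₂ → c₂ ⊕ (two c ⊕ c) ≈ b ⊕ (two 𝟙 ⊕ X) → f ≈ X ⊛ (b ⊛ (c₂ ⊛ b ⊕ c ⊛ c₂)) →
      two f ⊕ (two (b ⊛ b) ⊕ two b ⊕ two 𝟙 ⊕ X)
        ≈ θ b ⊕ four (X ⊛ (b ⊛ b)) ⊕ two (X ⊛ (X ⊛ (b ⊛ b))) ⊕ X ⊛ b ⊕ (four c ⊕ two c)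
    triples-solution f c₂ e₂ ef = cancel-relation
      (⊕-cong (two 𝟙 ⊙ ef) (⊕-cong (c₂ ⊙ ≈-sym b-eq) (⊕-cong (two (X ⊛ (b ⊛ b)) ⊕ b ⊙ e₂)
        (⊕-cong (≈-sym e₂) (⊕-cong (≈-sym θb) (⊕-cong (two b ⊕ b ⊙ b-eq) (two 𝟙 ⊕ 𝟙 ⊙ b-c)))))))
      (solve 6 (λ c b x f c₂ t →
        :two f :+ (:two (b :* b) :+ :two b :+ :two (con 1) :+ x) :+
          (:two (con 1) :* (x :* (b :* (c₂ :* b :+ c :* c₂))) :+ (c₂ :* b :+
          ((:two (x :* (b :* b)) :+ b) :* (b :+ (:two (con 1) :+ x)) :+ (c₂ :+ (:two c :+ c) :+
          (t :+ ((:two b :+ b) :* (con 1 :+ :two (c :* (x :* b))) :+ (:two (con 1) :+ con 1) :* (c :+ c :* b)))))))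
        := t :+ :four (x :* (b :* b)) :+ :two (x :* (x :* (b :* b))) :+ x :* b :+ (:four c :+ :two c) :+
          (:two (con 1) :* f :+ (c₂ :* (con 1 :+ :two (c :* (x :* b))) :+
          ((:two (x :* (b :* b)) :+ b) :* (c₂ :+ (:two c :+ c)) :+ (b :+ (:two (con 1) :+ x) :+
          (:two (x :* (b :* (b :* b))) :+ ((:two b :+ b) :* b :+ (:two (con 1) :+ con 1) :* :two b)))))))
        ≈-refl c b X f c₂ (θ b))

    b-zero : b 0 ≡ 1
    b-zero = trans (b-eq 0) (cong (λ z → suc (z + z)) (*-zeroʳ (c 0)))

    b-suc : ∀ n → suc n * b (suc n) ≡ (4 * n + 2) * b n
    b-suc n = trans (θb-recurrence (suc n))
      (trans (cong₂ (λ u v → (u + u) + ((v + v) + (v + v))) (X⊛-suc b n) (X⊛-suc (θ b) n)) (lemma n (b n)))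
      where
      lemma : ∀ n x → (x + x) + ((n * x + n * x) + (n * x + n * x)) ≡ (4 * n + 2) * x
      lemma = solve-∀

    c-b : ∀ n → suc n * c n ≡ b n
    -- Doubling and adding (4n + 2)bₙ turns both sides into n + 1 times the coefficient identity of
    -- `Xb-Xc`, without a subtraction.
    c-b n = *-cancelˡ-≡ (suc n * c n) (b n) 2 (+-cancelˡ-≡ ((4 * n + 2) * b n) _ _ (begin
      (4 * n + 2) * b n + 2 * (suc n * c n)   ≡⟨ cong (_+ 2 * (suc n * c n)) (sym (b-suc n)) ⟩
      suc n * b (suc n) + 2 * (suc n * c n)       ≡⟨ l₁ n (b (suc n)) (c n) ⟩
      suc n * ((c n + c n) + b (suc n))             ≡⟨ cong (λ z → suc n * ((z + z) + b (suc n))) (sym (X⊛-suc c n)) ⟩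
      suc n * ((two (X ⊛ c) ⊕ b) (suc n))               ≡⟨ cong (suc n *_) (sym (Xb-Xc (suc n))) ⟩
      suc n * ((four (X ⊛ b) ⊕ 𝟙) (suc n))              ≡⟨ cong (λ z → suc n * ((z + z) + (z + z) + 0)) (X⊛-suc b n) ⟩
      suc n * ((b n + b n) + (b n + b n) + 0)   ≡⟨ l₂ n (b n) ⟩
      (4 * n + 2) * b n + 2 * b n ∎))
      where
      open ≡-Reasoning
      l₁ : ∀ n x y → suc n * x + 2 * (suc n * y) ≡ suc n * ((y + y) + x)
      l₁ = solve-∀
      l₂ : ∀ n x → suc n * ((x + x) + (x + x) + 0) ≡ (4 * n + 2) * x + 2 * x
      l₂ = solve-∀

    c-suc : ∀ n → (n + 2) * c (suc n) ≡ (4 * n + 2) * c n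
    c-suc n = *-cancelˡ-≡ _ _ (suc n) (begin
      suc n * ((n + 2) * c (suc n))    ≡⟨ cong (λ z → suc n * (z * c (suc n))) (+-comm n 2) ⟩
      suc n * (suc (suc n) * c (suc n))  ≡⟨ cong (suc n *_) (c-b (suc n)) ⟩
      suc n * b (suc n)                    ≡⟨ b-suc n ⟩
      (4 * n + 2) * b n                ≡⟨ cong ((4 * n + 2) *_) (sym (c-b n)) ⟩
      (4 * n + 2) * (suc n * c n)    ≡⟨ lemma (4 * n + 2) n (c n) ⟩
      suc n * ((4 * n + 2) * c n) ∎)
      where
      open ≡-Reasoning
      lemma : ∀ k n x → k * (suc n * x) ≡ suc n * (k * x)
      lemma = solve-∀

    b²-power : ∀ n → (b ⊛ b) n ≡ 4 ^ n
    b²-power zero    = cong₂ _*_ b-zero b-zero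
    b²-power (suc n) = trans (b² (suc n))
      (trans (cong (λ z → (z + z) + (z + z)) (trans (X⊛-suc (b ⊛ b) n) (b²-power n))) (lemma (4 ^ n)))
      where
      lemma : ∀ x → (x + x) + (x + x) ≡ 4 * x
      lemma = solve-∀

    c-zero : c 0 ≡ 1
    c-zero = trans (sym (*-identityˡ (c 0))) (trans (c-b 0) b-zero)

    c-one : c 1 ≡ 1
    c-one = *-cancelˡ-≡ (c 1) 1 2 (trans (c-suc 0) (cong (2 *_) c-zero))


    -- The subtractions are truncated; this is what the terms 𝟙 and X correct in c-pred-eq and c-pred₂-eq.
    c-pred c-pred₂ : Series
    c-pred n  = (n ∸ 1) * c n
    c-pred₂ n = (n ∸ 2) * c n

    c-pred-eq : c-pred ⊕ two c ≈ b ⊕ 𝟙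
    c-pred-eq zero = trans (cong (λ z → z + z) c-zero) (cong (_+ 1) (sym b-zero))
    c-pred-eq (suc n) = trans (lemma n (c (suc n))) (cong (_+ 0) (c-b (suc n)))
      where
      lemma : ∀ n x → n * x + (x + x) ≡ (suc (suc n) * x) + 0
      lemma = solve-∀

    c-pred₂-eq : c-pred₂ ⊕ (two c ⊕ c) ≈ b ⊕ (two 𝟙 ⊕ X)
    c-pred₂-eq zero = trans (cong (λ z → (z + z) + z) c-zero) (cong (_+ 2) (sym b-zero))
    c-pred₂-eq (suc zero) = trans (cong (λ z → (z + z) + z) c-one)
      (cong (_+ 1) (trans (cong (2 *_) (sym c-one)) (c-b 1)))
    c-pred₂-eq (suc (suc n)) = trans (lemma n (c (suc (suc n)))) (cong (_+ 0) (c-b (suc (suc n))))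
      where
      lemma : ∀ n x → n * x + ((x + x) + x) ≡ (suc (suc (suc n)) * x) + 0
      lemma = solve-∀

    pairs-coefficient : ∀ f → f ≈ X ⊛ (two (c ⊛ f) ⊕ (c-pred ⊛ b ⊕ c ⊛ c-pred)) → ∀ m →
      let n = suc (suc m) in
      2 * f n + 8 * 4 ^ m + 2 * (suc n * c n) ≡ n * (suc n * c n) + 4 * c n
    -- For n = m + 2, b² contributes 4ⁿ = 16·4ᵐ on the left and 2xb² contributes 8·4ᵐ on the right;
    -- the common 8·4ᵐ is cancelled.
    pairs-coefficient f e m = +-cancelʳ-≡ (8 * 4 ^ m) _ _ (begin
      2 * f n + 8 * 4 ^ m + 2 * (suc n * c n) + 8 * 4 ^ m
        ≡⟨ cong (λ z → 2 * f n + 8 * 4 ^ m + 2 * z + 8 * 4 ^ m) (c-b n) ⟩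
      2 * f n + 8 * 4 ^ m + 2 * b n + 8 * 4 ^ m
        ≡⟨ l₁ (f n) (4 ^ m) (b n) ⟩
      (f n + f n) + (4 ^ n + (b n + b n))
        ≡⟨ cong (λ z → (f n + f n) + (z + (b n + b n))) (sym (b²-power n)) ⟩
      (f n + f n) + ((b ⊛ b) n + (b n + b n))
        ≡⟨ pairs-solution f c-pred c-pred-eq (additive-solution f _ e) n ⟩
      n * b n + two (X ⊛ (b ⊛ b)) n + four c n
        ≡⟨ cong₂ (λ u v → n * u + (v + v) + four c n) (sym (c-b n)) (trans (X⊛-suc (b ⊛ b) (suc m)) (b²-power (suc m))) ⟩
      n * (suc n * c n) + (4 ^ suc m + 4 ^ suc m) + four c n
        ≡⟨ l₂ (n * (suc n * c n)) (4 ^ m) (c n) ⟩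
      n * (suc n * c n) + 4 * c n + 8 * 4 ^ m ∎)
      where
      open ≡-Reasoning
      n = suc (suc m)
      l₁ : ∀ f e b → 2 * f + 8 * e + 2 * b + 8 * e ≡ (f + f) + (4 * (4 * e) + (b + b))
      l₁ = solve-∀
      l₂ : ∀ t e c → t + (4 * e + 4 * e) + ((c + c) + (c + c)) ≡ t + 4 * c + 8 * e
      l₂ = solve-∀

    triples-coefficient : ∀ f → f ≈ X ⊛ (two (c ⊛ f) ⊕ (c-pred₂ ⊛ b ⊕ c ⊛ c-pred₂)) → ∀ m →
      let n = suc (suc m) in
      2 * f n + 14 * 4 ^ m + 2 * (suc n * c n)
        ≡ n * (suc n * c n) + n * c (suc m) + 6 * c n
    -- Here 2b² contributes 32·4ᵐ, against 16·4ᵐ from 4xb² and 2·4ᵐ from 2x²b². Cancelling 18·4ᵐ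
    -- leaves 14·4ᵐ, half of which is the 7·4ⁿ⁻² of Q₄.
    triples-coefficient f e m = +-cancelʳ-≡ (18 * 4 ^ m) _ _ (begin
      2 * f n + 14 * 4 ^ m + 2 * (suc n * c n) + 18 * 4 ^ m
        ≡⟨ cong (λ z → 2 * f n + 14 * 4 ^ m + 2 * z + 18 * 4 ^ m) (c-b n) ⟩
      2 * f n + 14 * 4 ^ m + 2 * b n + 18 * 4 ^ m
        ≡⟨ l₁ (f n) (4 ^ m) (b n) ⟩
      (f n + f n) + ((4 ^ n + 4 ^ n) + (b n + b n) + 0 + 0)
        ≡⟨ cong (λ z → (f n + f n) + ((z + z) + (b n + b n) + 0 + 0)) (sym (b²-power n)) ⟩
      (two f ⊕ (two (b ⊛ b) ⊕ two b ⊕ two 𝟙 ⊕ X)) n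
        ≡⟨ triples-solution f c-pred₂ c-pred₂-eq (additive-solution f _ e) n ⟩
      (θ b ⊕ four (X ⊛ (b ⊛ b)) ⊕ two (X ⊛ (X ⊛ (b ⊛ b))) ⊕ X ⊛ b ⊕ (four c ⊕ two c)) n
        ≡⟨ cong (λ z → z + (four c n + two c n))
           (cong₂ _+_ (cong₂ _+_ (cong₂ (λ u v → n * u + ((v + v) + (v + v)))
              (sym (c-b n)) (trans (X⊛-suc (b ⊛ b) (suc m)) (b²-power (suc m))))
              (cong (λ v → v + v) (trans (X⊛-suc (X ⊛ (b ⊛ b)) (suc m)) (trans (X⊛-suc (b ⊛ b) m) (b²-power m)))))
              (trans (X⊛-suc b (suc m)) (sym (c-b (suc m))))) ⟩
      n * (suc n * c n) + ((4 ^ suc m + 4 ^ suc m) + (4 ^ suc m + 4 ^ suc m)) + (4 ^ m + 4 ^ m) + n * c (suc m) + (four c n + two c n)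
        ≡⟨ l₂ (n * (suc n * c n)) (4 ^ m) (n * c (suc m)) (c n) ⟩
      n * (suc n * c n) + n * c (suc m) + 6 * c n + 18 * 4 ^ m ∎)
      where
      open ≡-Reasoning
      n = suc (suc m)
      l₁ : ∀ f e b → 2 * f + 14 * e + 2 * b + 18 * e
        ≡ (f + f) + ((4 * (4 * e) + 4 * (4 * e)) + (b + b) + 0 + 0)
      l₁ = solve-∀
      l₂ : ∀ t e z c → t + ((4 * e + 4 * e) + (4 * e + 4 * e)) + (e + e) + z + (((c + c) + (c + c)) + (c + c))
        ≡ t + z + 6 * c + 18 * e
      l₂ = solve-∀

-- The recurrence of the central binomial coefficients.

module CentralBinomial where

  open import Data.Nat
  open import Data.Nat.Properties
  open import Data.Nat.Combinatorics
  open import Data.Nat.DivMod using (m/n*n≡m)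
  open import Data.Nat.Tactic.RingSolver using (solve-∀)
  open import Relation.Binary.PropositionalEquality

  binomial-factorials : ∀ {n k} → k ≤ n → (n C k) * (k ! * (n ∸ k) !) ≡ n !
  binomial-factorials {n} {k} k≤n = trans
    (cong (_* (k ! * (n ∸ k) !)) (nCk≡n!/k![n-k]! k≤n))
    (m/n*n≡m {{k !* (n ∸ k) !≢0}} (k![n∸k]!∣n! k≤n))

  central-binomial-factorials : ∀ n → ((2 * n) C n) * (n ! * n !) ≡ (2 * n) !
  central-binomial-factorials n = trans
    (cong (λ k → ((2 * n) C n) * (n ! * k !)) (sym (trans (m+n∸m≡n n (n + 0)) (+-identityʳ n))))
    (binomial-factorials (m≤m+n n (n + 0)))

  central-binomial-suc : ∀ n → suc n * ((2 * suc n) C suc n) ≡ (4 * n + 2) * ((2 * n) C n)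
  -- The factor (n + 1)(n!)² together with the n + 1 already present completes ((n + 1)!)².
  central-binomial-suc n = *-cancelʳ-≡ _ _ (suc n * (n ! * n !)) {{nz}} (begin
    suc n * ((2 * suc n) C suc n) * (suc n * (n ! * n !))
      ≡⟨ l₁ n ((2 * suc n) C suc n) (n !) ⟩
    ((2 * suc n) C suc n) * (suc n ! * suc n !)
      ≡⟨ central-binomial-factorials (suc n) ⟩
    (2 * suc n) !
      ≡⟨ cong _! (*-suc 2 n) ⟩
    suc (suc (2 * n)) * (suc (2 * n) * (2 * n) !)
      ≡⟨ cong (λ z → suc (suc (2 * n)) * (suc (2 * n) * z)) (sym (central-binomial-factorials n)) ⟩
    suc (suc (2 * n)) * (suc (2 * n) * (((2 * n) C n) * (n ! * n !)))
      ≡⟨ l₂ n ((2 * n) C n) (n ! * n !) ⟩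
    (4 * n + 2) * ((2 * n) C n) * (suc n * (n ! * n !)) ∎)
    where
    open ≡-Reasoning
    nz : NonZero (suc n * (n ! * n !))
    nz = m*n≢0 (suc n) (n ! * n !) {{_}} {{n !* n !≢0}}
    l₁ : ∀ n x y → suc n * x * (suc n * (y * y)) ≡ x * ((suc n * y) * (suc n * y))
    l₁ = solve-∀
    l₂ : ∀ n x y → suc (suc (2 * n)) * (suc (2 * n) * (x * y)) ≡ (4 * n + 2) * x * (suc n * y)
    l₂ = solve-∀

  central-binomial-unique : ∀ (b : ℕ → ℕ) → b 0 ≡ 1 → (∀ n → suc n * b (suc n) ≡ (4 * n + 2) * b n) →
    ∀ n → b n ≡ (2 * n) C n
  central-binomial-unique b b0 bs zero    = b0
  central-binomial-unique b b0 bs (suc n) = *-cancelˡ-≡ _ _ (suc n) (trans (bs n)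
    (trans (cong ((4 * n + 2) *_) (central-binomial-unique b b0 bs n)) (sym (central-binomial-suc n))))

-- Solving for the four totals over the integers.

module LinearSystem where

  open import Data.Integer
  open import Data.Integer.Properties using (+-0-abelianGroup)
  open import Algebra.Properties.AbelianGroup +-0-abelianGroup using (∙-cancelʳ)
  open import Data.Integer.Tactic.RingSolver using (solve-∀)
  open import Relation.Binary.PropositionalEquality

  -- The difference a - b is exhibited as l - r, where `l ≡ r` is a combination of hypotheses with
  -- polynomial multipliers; what remains is an identity for the ring solver.
  combine : ∀ {a b l r : ℤ} → l ≡ r → a + r ≡ b + l → a ≡ b
  combine {a} {b} {l} refl e = ∙-cancelʳ l a b e

  _·_ : ∀ p {l r : ℤ} → l ≡ r → p * l ≡ p * r
  p · e = cong (p *_) e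

  infixr 5 _&_
  _&_ : ∀ {l r l′ r′ : ℤ} → l ≡ r → l′ ≡ r′ → l + l′ ≡ r + r′
  e & e′ = cong₂ _+_ e e′

  -- y = Cₙ, z = Cₙ₋₁, E = 4ⁿ⁻² and (N + 1) y = Bₙ; T and D are the totals of min − 1
  -- over windows of three and of two consecutive entries.
  module Solve (N y z E q₁ q₂ q₃ q₄ T D : ℤ)
    (hH : (N + + 1) * y ≡ + 2 * (+ 2 * N - + 1) * z)
    (h₁ : q₁ ≡ N * z + + 2 * z)
    (hT : + 2 * T + + 14 * E + + 2 * ((N + + 1) * y) ≡ N * ((N + + 1) * y) + N * z + + 6 * y)
    (hD : + 2 * D + + 8 * E + + 2 * ((N + + 1) * y) ≡ N * ((N + + 1) * y) + + 4 * y)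
    (h₄ : q₄ + q₁ ≡ T + + 2 * y)
    (hS : + 2 * (q₁ + q₂ + q₃ + q₄) ≡ N * ((N + + 1) * y))
    (hR : q₁ + + 2 * q₂ + + 3 * q₃ + + 4 * q₄ ≡ (N - + 1) * (N + + 2) * y + + 2 * D)
    where

    solve₁ : + 2 * (+ 2 * N - + 1) * q₁ ≡ (N + + 2) * ((N + + 1) * y)
    solve₁ = combine ((+ 2 * (+ 2 * N - + 1)) · h₁ & (N + + 2) · sym hH) (poly N y z q₁)
      where
      poly : ∀ N y z q₁ →
        + 2 * (+ 2 * N - + 1) * q₁ + (+ 2 * (+ 2 * N - + 1) * (N * z + + 2 * z) + (N + + 2) * ((N + + 1) * y))
        ≡ (N + + 2) * ((N + + 1) * y) + (+ 2 * (+ 2 * N - + 1) * q₁ + (N + + 2) * (+ 2 * (+ 2 * N - + 1) * z))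
      poly = solve-∀

    solve₄ : + 4 * (N + + 1) * (+ 2 * N - + 1) * q₄
      ≡ (+ 4 * N * N * N - + 7 * N * N + + 29 * N - + 20) * ((N + + 1) * y)
        - + 7 * E * (+ 4 * (N + + 1) * (+ 2 * N - + 1))
    -- Eliminating q₁ and T leaves z with coefficient -2k(N + 4), and 2kz = (N + 1)²y by `hH`; this
    -- is the origin of the multiplier (N + 1)(N + 4).
    solve₄ = combine ((+ 4 * k) · h₄ & (+ 4 * k) · sym h₁ & (+ 2 * k) · hT & ((N + + 1) * (N + + 4)) · hH)
      (poly N y z E q₁ q₄ T)
      where
      k = (N + + 1) * (+ 2 * N - + 1)
      poly : ∀ N y z E q₁ q₄ T → let k = (N + + 1) * (+ 2 * N - + 1) in
        + 4 * (N + + 1) * (+ 2 * N - + 1) * q₄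
          + (+ 4 * k * (T + + 2 * y) + (+ 4 * k * q₁ + (+ 2 * k * (N * ((N + + 1) * y) + N * z + + 6 * y)
             + (N + + 1) * (N + + 4) * (+ 2 * (+ 2 * N - + 1) * z))))
        ≡ ((+ 4 * N * N * N - + 7 * N * N + + 29 * N - + 20) * ((N + + 1) * y)
           - + 7 * E * (+ 4 * (N + + 1) * (+ 2 * N - + 1)))
          + (+ 4 * k * (q₄ + q₁) + (+ 4 * k * (N * z + + 2 * z) + (+ 2 * k * (+ 2 * T + + 14 * E + + 2 * ((N + + 1) * y))
             + (N + + 1) * (N + + 4) * ((N + + 1) * y))))
      poly = solve-∀

    solve₃ : + 8 * (N + + 1) * (+ 2 * N - + 1) * q₃
      ≡ (+ 8 * N * N - + 96 * N + + 88) * ((N + + 1) * y) + (+ 6 * N * N + + 3 * N - + 3) * (+ 16 * E)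
    -- `hR` minus `hS` reads q₃ + 2q₄ - q₁ on the left, free of q₂. By `h₄`, q₁ - 2q₄ becomes 3q₁ -
    -- 2T - 4y, and `hH` removes z at the end.
    solve₃ = combine ((+ 8 * k) · hR & (+ 8 * k) · sym hS & (+ 16 * k) · sym h₄ & (+ 24 * k) · h₁
        & (+ 8 * k) · sym hT & (+ 8 * k) · hD & (+ 8 * (N + + 1) * (N + + 3)) · sym hH)
      (poly N y z E q₁ q₂ q₃ q₄ T D)
      where
      k = (N + + 1) * (+ 2 * N - + 1)
      poly : ∀ N y z E q₁ q₂ q₃ q₄ T D → let k = (N + + 1) * (+ 2 * N - + 1) in
        + 8 * (N + + 1) * (+ 2 * N - + 1) * q₃
          + (+ 8 * k * ((N - + 1) * (N + + 2) * y + + 2 * D) + (+ 8 * k * (+ 2 * (q₁ + q₂ + q₃ + q₄))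
             + (+ 16 * k * (q₄ + q₁) + (+ 24 * k * (N * z + + 2 * z)
             + (+ 8 * k * (+ 2 * T + + 14 * E + + 2 * ((N + + 1) * y))
             + (+ 8 * k * (N * ((N + + 1) * y) + + 4 * y) + + 8 * (N + + 1) * (N + + 3) * ((N + + 1) * y)))))))
        ≡ (+ 8 * N * N - + 96 * N + + 88) * ((N + + 1) * y) + (+ 6 * N * N + + 3 * N - + 3) * (+ 16 * E)
          + (+ 8 * k * (q₁ + + 2 * q₂ + + 3 * q₃ + + 4 * q₄) + (+ 8 * k * (N * ((N + + 1) * y))
             + (+ 16 * k * (T + + 2 * y) + (+ 24 * k * q₁
             + (+ 8 * k * (N * ((N + + 1) * y) + N * z + + 6 * y)
             + (+ 8 * k * (+ 2 * D + + 8 * E + + 2 * ((N + + 1) * y)) + + 8 * (N + + 1) * (N + + 3) * (+ 2 * (+ 2 * N - + 1) * z)))))))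
      poly = solve-∀

    solve₂ : + 16 * (N + + 1) * (+ 2 * N - + 1) * q₂
      ≡ (+ 12 * N * N + + 44 * N - + 112) * ((N + + 1) * y) + (+ 2 * N * N + N - + 1) * (+ 16 * E)
    -- Three times the vertex count minus the degree sum is 2q₁ + q₂ - q₄, free of q₃; as `hS`
    -- carries a factor 2, its multiplier is 24k against 16k for `hR`.
    solve₂ = combine ((+ 24 * k) · hS & (+ 16 * k) · sym hR & (+ 16 * k) · h₄ & (+ 48 * k) · sym h₁
        & (+ 8 * k) · hT & (+ 16 * k) · sym hD & (+ 4 * (+ 5 * N + + 12) * (N + + 1)) · hH)
      (poly N y z E q₁ q₂ q₃ q₄ T D)
      where
      k = (N + + 1) * (+ 2 * N - + 1)
      poly : ∀ N y z E q₁ q₂ q₃ q₄ T D → let k = (N + + 1) * (+ 2 * N - + 1) in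
        + 16 * (N + + 1) * (+ 2 * N - + 1) * q₂
          + (+ 24 * k * (N * ((N + + 1) * y)) + (+ 16 * k * (q₁ + + 2 * q₂ + + 3 * q₃ + + 4 * q₄)
             + (+ 16 * k * (T + + 2 * y) + (+ 48 * k * q₁
             + (+ 8 * k * (N * ((N + + 1) * y) + N * z + + 6 * y)
             + (+ 16 * k * (+ 2 * D + + 8 * E + + 2 * ((N + + 1) * y)) + + 4 * (+ 5 * N + + 12) * (N + + 1) * (+ 2 * (+ 2 * N - + 1) * z)))))))
        ≡ (+ 12 * N * N + + 44 * N - + 112) * ((N + + 1) * y) + (+ 2 * N * N + N - + 1) * (+ 16 * E)
          + (+ 24 * k * (+ 2 * (q₁ + q₂ + q₃ + q₄)) + (+ 16 * k * ((N - + 1) * (N + + 2) * y + + 2 * D)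
             + (+ 16 * k * (q₄ + q₁) + (+ 48 * k * (N * z + + 2 * z)
             + (+ 8 * k * (+ 2 * T + + 14 * E + + 2 * ((N + + 1) * y))
             + (+ 16 * k * (N * ((N + + 1) * y) + + 4 * y) + + 4 * (+ 5 * N + + 12) * (N + + 1) * ((N + + 1) * y)))))))
      poly = solve-∀

-- Enumeration of permutations and the pattern 213.

module Permutations where

  open import Data.Bool using (true; false; T; not; _∧_)
  open import Data.Bool.Properties using (T?; T-∧)
  open import Data.Empty using (⊥; ⊥-elim)
  open import Data.List using (List; []; _∷_; _++_; [_]; length; map; concatMap; upTo; cartesianProduct; cartesianProductWith)
  open import Data.List.Membership.Propositional using (_∈_; lose; find)
  open import Data.List.Membership.Propositional.Properties
  open import Data.List.Properties using (length-map; length-upTo; length-++; map-applyUpTo; map-++; map-∘; ∷-injective; map-injective; map-id; ++-identityʳ)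
  open import Data.List.Relation.Binary.Disjoint.Propositional using (Disjoint)
  open import Data.List.Relation.Binary.Permutation.Propositional using (_↭_; ↭-refl; ↭-sym; ↭-trans; ↭-prep; ↭-reflexive; ↭⇒↭ₛ)
  open import Data.List.Relation.Binary.Permutation.Propositional.Properties using (∈-resp-↭; ↭-length; ↭-map-inv; drop-∷; shift) renaming (++⁺ to ↭-++⁺; ++-comm to ↭-++-comm; map⁺ to ↭-map⁺; ++⁺ʳ to ↭-++⁺ʳ)
  import Data.List.Relation.Binary.Permutation.Setoid.Properties as PermₛProperties
  open import Data.List.Relation.Binary.Sublist.Propositional using ([]; _∷ʳ_; _∷_; from∈; to∈) renaming (_⊆_ to _⊑_; ⊆-trans to ⊑-trans; ⊆-refl to ⊑-refl)
  import Data.List.Relation.Binary.Sublist.Propositional.Properties as Sublist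
  open import Data.List.Relation.Binary.Subset.Propositional using (_⊆_)
  open import Data.List.Relation.Unary.All as All using (All; []; _∷_)
  open import Data.List.Relation.Unary.All.Properties using (all⁺; all⁻; All¬⇒¬Any)
  import Data.List.Relation.Unary.All.Properties as AllP
  open import Data.List.Relation.Unary.AllPairs as AllPairs using (AllPairs; []; _∷_)
  import Data.List.Relation.Unary.AllPairs.Properties as AllPairsP
  open import Data.List.Relation.Unary.Any as Any using (Any; here; there)
  open import Data.List.Relation.Unary.Any.Properties using (any⁺; any⁻)
  open import Data.List.Relation.Unary.Unique.Propositional using (Unique)
  import Data.List.Relation.Unary.Unique.Propositional.Properties as Unique
  open import Data.Nat
  open import Data.Nat.Properties
  open import Data.Product using (∃; ∃₂; _×_; _,_; proj₁; proj₂; map₁; uncurry)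
  open import Data.Sum using (_⊎_; inj₁; inj₂)
  open import Function using (_∘_; id)
  open import Function.Bundles using (Equivalence)
  open import Relation.Binary.Definitions using (tri<; tri≈; tri>)
  open import Relation.Binary.PropositionalEquality using (_≡_; _≢_; refl; sym; trans; cong; cong₂; subst; setoid; module ≡-Reasoning)
  open import Relation.Nullary using (¬_)
  open import Data.List.Extrema.Nat using (max; ⊥≤max; xs≤max; argmax-sel)

  range1-suc : ∀ n → range1 (suc n) ≡ 1 ∷ map suc (range1 n)
  range1-suc n = cong (1 ∷_) (trans (map-applyUpTo suc suc n)
    (sym (trans (cong (map suc) (map-applyUpTo id suc n)) (map-applyUpTo suc suc n))))

  range1-+ : ∀ m n → range1 (m + n) ≡ range1 m ++ map (m +_) (range1 n)
  range1-+ zero    n = sym (map-id (range1 n))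
  range1-+ (suc m) n = begin
    range1 (suc m + n)                                     ≡⟨ range1-suc (m + n) ⟩
    1 ∷ map suc (range1 (m + n))                           ≡⟨ cong (λ z → 1 ∷ map suc z) (range1-+ m n) ⟩
    1 ∷ map suc (range1 m ++ map (m +_) (range1 n))        ≡⟨ cong (1 ∷_) (map-++ suc (range1 m) _) ⟩
    1 ∷ map suc (range1 m) ++ map suc (map (m +_) (range1 n)) ≡⟨ cong₂ _++_ (sym (range1-suc m)) (sym (map-∘ (range1 n))) ⟩
    range1 (suc m) ++ map (suc m +_) (range1 n) ∎
    where open ≡-Reasoning

  length-range1 : ∀ n → length (range1 n) ≡ n
  length-range1 n = trans (length-map suc (upTo n)) (length-upTo n)

  ∈-range1⁺ : ∀ {n x} → 1 ≤ x → x ≤ n → x ∈ range1 n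
  ∈-range1⁺ {x = suc x} _ x<n = ∈-map⁺ suc (∈-upTo⁺ x<n)

  ∈-range1⁻ : ∀ n {x} → x ∈ range1 n → 1 ≤ x × x ≤ n
  ∈-range1⁻ n x∈ with _ , y∈ , refl ← ∈-map⁻ suc x∈ = s≤s z≤n , ∈-upTo⁻ y∈

  range1-unique : ∀ n → Unique (range1 n)
  range1-unique n = Unique.map⁺ suc-injective (Unique.upTo⁺ n)

  module _ {a} {A : Set a} where

    Unique-resp-↭ : {xs ys : List A} → xs ↭ ys → Unique xs → Unique ys
    Unique-resp-↭ p = PermₛProperties.Unique-resp-↭ (setoid A) (↭⇒↭ₛ p)

    -- The pigeonhole principle for lists: each element of `xs` is deleted from `ys` at an
    -- occurrence, and uniqueness ensures that later elements are not the deleted one.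
    unique-complement : {xs ys : List A} → Unique xs → xs ⊆ ys → ∃ λ zs → ys ↭ xs ++ zs
    unique-complement {[]}     {ys} _          _     = ys , ↭-refl
    unique-complement {x ∷ xs} (x∉ ∷ u) xs⊆ with ∈-∃++ (xs⊆ (here refl))
    ... | as , bs , refl with unique-complement {xs} {as ++ bs} u rest
      where
      rest : xs ⊆ as ++ bs
      rest v∈ with ∈-++⁻ as (xs⊆ (there v∈))
      ... | inj₁ v∈as         = ∈-++⁺ˡ v∈as
      ... | inj₂ (here refl)  = ⊥-elim (All¬⇒¬Any x∉ v∈)
      ... | inj₂ (there v∈bs) = ∈-++⁺ʳ as v∈bs
    ... | zs , p = zs , ↭-trans (shift x as bs) (↭-prep x p)

    unique-⊆⇒↭ : {xs ys : List A} → Unique xs → xs ⊆ ys → length ys ≤ length xs → xs ↭ ys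
    unique-⊆⇒↭ {xs} {ys} u xs⊆ len with unique-complement u xs⊆
    ... | []     , p = ↭-sym (subst (ys ↭_) (++-identityʳ xs) p)
    ... | z ∷ zs , p = ⊥-elim (<⇒≱ (s≤s (m≤m+n (length xs) (length zs))) (begin
      suc (length xs + length zs)  ≡⟨ sym (+-suc (length xs) (length zs)) ⟩
      length xs + suc (length zs)  ≡⟨ sym (length-++ xs) ⟩
      length (xs ++ z ∷ zs)        ≡⟨ sym (↭-length p) ⟩
      length ys                    ≤⟨ len ⟩
      length xs                    ∎))
      where open ≤-Reasoning

    unique-⊆⇒≤ : {xs ys : List A} → Unique xs → xs ⊆ ys → length xs ≤ length ys
    unique-⊆⇒≤ {xs} u xs⊆ with unique-complement u xs⊆
    ... | zs , p = ≤-trans (m≤m+n (length xs) (length zs)) (≤-reflexive (sym (trans (↭-length p) (length-++ xs))))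

    unique-⊆-⊇⇒↭ : {xs ys : List A} → Unique xs → Unique ys → xs ⊆ ys → ys ⊆ xs → xs ↭ ys
    unique-⊆-⊇⇒↭ u v p q = unique-⊆⇒↭ u p (unique-⊆⇒≤ v q)

    ↭-++-cancelˡ : (as : List A) {xs ys : List A} → as ++ xs ↭ as ++ ys → xs ↭ ys
    ↭-++-cancelˡ []       p = p
    ↭-++-cancelˡ (a ∷ as) p = ↭-++-cancelˡ as (drop-∷ p)

  concatMap-cartesian : ∀ (xs : List ℕ) (yss : List (List ℕ)) → concatMap (λ x → map (x ∷_) yss) xs ≡ cartesianProductWith _∷_ xs yss
  concatMap-cartesian []       yss = refl
  concatMap-cartesian (x ∷ xs) yss = cong (map (x ∷_) yss ++_) (concatMap-cartesian xs yss)

  lists-unique : ∀ n k → Unique (lists n k)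
  lists-unique n zero    = [] ∷ []
  lists-unique n (suc k) = subst Unique (sym (concatMap-cartesian (range1 n) (lists n k)))
    (Unique.cartesianProductWith⁺ _∷_ ∷-injective (range1-unique n) (lists-unique n k))

  ∈-lists⁺ : ∀ {n π} → All (_∈ range1 n) π → π ∈ lists n (length π)
  ∈-lists⁺ []                = here refl
  ∈-lists⁺ {n} {x ∷ π} (x∈ ∷ π∈) = subst (x ∷ π ∈_) (sym (concatMap-cartesian (range1 n) _))
    (∈-cartesianProductWith⁺ _∷_ x∈ (∈-lists⁺ π∈))

  ∈-lists⁻ : ∀ n k {π} → π ∈ lists n k → length π ≡ k
  ∈-lists⁻ n zero    (here refl) = refl
  ∈-lists⁻ n (suc k) {π} π∈
    with _ , _ , _ , ρ∈ , refl ← ∈-cartesianProductWith⁻ _∷_ (range1 n) (lists n k)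
           (subst (π ∈_) (concatMap-cartesian (range1 n) (lists n k)) π∈)
    = cong suc (∈-lists⁻ n k ρ∈)

  -- `isPerm` tests only that every k in [n] occurs; among n entries this leaves no room for
  -- repetitions or for values outside [n].
  isPerm⇒↭ : ∀ {n π} → length π ≡ n → T (isPerm n π) → π ↭ range1 n
  isPerm⇒↭ {n} {π} len t = ↭-sym (unique-⊆⇒↭ (range1-unique n) covers
    (≤-reflexive (trans len (sym (length-range1 n)))))
    where
    covers : range1 n ⊆ π
    covers {k} k∈ = Any.map (λ {x} e → sym (≡ᵇ⇒≡ x k e)) (any⁻ _ π (All.lookup (all⁺ _ (range1 n) t) k∈))

  ↭⇒isPerm : ∀ {n π} → π ↭ range1 n → T (isPerm n π)
  ↭⇒isPerm {n} {π} p = all⁻ _ (All.tabulate λ {k} k∈ →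
    any⁺ _ (Any.map (λ {x} e → ≡⇒≡ᵇ x k (sym e)) (∈-resp-↭ (↭-sym p) k∈)))

  ∈-perms⁺ : ∀ {n π} → π ↭ range1 n → π ∈ perms n
  ∈-perms⁺ {n} {π} p = ∈-filter⁺ (λ π → T? (isPerm n π))
    (subst (λ k → π ∈ lists n k) (trans (↭-length p) (length-range1 n)) (∈-lists⁺ (All.tabulate (∈-resp-↭ p))))
    (↭⇒isPerm p)

  ∈-perms⁻ : ∀ {n π} → π ∈ perms n → π ↭ range1 n
  ∈-perms⁻ {n} π∈ with π∈lists , t ← ∈-filter⁻ (λ π → T? (isPerm n π)) π∈ =
    isPerm⇒↭ (∈-lists⁻ n n π∈lists) t

  -- Phrased with sublists instead of positions, since sublists pass easily through `_++_`, `map`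
  -- and restriction to a block.
  Avoids213 : List ℕ → Set
  Avoids213 π = ∀ {x y z} → x ∷ y ∷ z ∷ [] ⊑ π → y < x → x < z → ⊥

  Av213-unique : ∀ n → Unique (Av213 n)
  Av213-unique n = Unique.filter⁺ (λ π → T? (not (contains213 n π)))
    (Unique.filter⁺ (λ π → T? (isPerm n π)) (lists-unique n n))

  -- These lemmas translate the position triples of `contains213` into the sublists of `Avoids213`;
  -- the `⊑-height` lemmas go back and return the predecessors of the 1-based positions.
  height-⊑₁ : ∀ π {r} → 1 ≤ r → r ≤ length π → [ height π r ] ⊑ π
  height-⊑₁ (x ∷ π) {suc zero}    _ _         = refl ∷ Sublist.[]⊆-universal π
  height-⊑₁ (x ∷ π) {suc (suc r)} _ (s≤s r≤) = x ∷ʳ height-⊑₁ π (s≤s z≤n) r≤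

  height-⊑₂ : ∀ π {q r} → 1 ≤ q → q < r → r ≤ length π → height π q ∷ height π r ∷ [] ⊑ π
  height-⊑₂ (x ∷ π) {suc zero}    {suc (suc r)} _ _         (s≤s r≤) = refl ∷ height-⊑₁ π (s≤s z≤n) r≤
  height-⊑₂ (x ∷ π) {suc (suc q)} {suc (suc r)} _ (s≤s q<r) (s≤s r≤) = x ∷ʳ height-⊑₂ π (s≤s z≤n) q<r r≤
  height-⊑₂ (x ∷ π) {suc _}       {suc zero}    _ (s≤s ()) _

  height-⊑₃ : ∀ π {p q r} → 1 ≤ p → p < q → q < r → r ≤ length π → height π p ∷ height π q ∷ height π r ∷ [] ⊑ π
  height-⊑₃ (x ∷ π) {suc zero} {suc (suc q)} {suc (suc r)} _ _ (s≤s q<r) (s≤s r≤) = refl ∷ height-⊑₂ π (s≤s z≤n) q<r r≤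
  height-⊑₃ (x ∷ π) {suc (suc p)} {suc (suc q)} {suc (suc r)} _ (s≤s p<q) (s≤s q<r) (s≤s r≤) = x ∷ʳ height-⊑₃ π (s≤s z≤n) p<q q<r r≤
  height-⊑₃ (x ∷ π) {suc _} {suc zero} {_} _ (s≤s ()) _ _
  height-⊑₃ (x ∷ π) {suc _} {suc (suc _)} {suc zero} _ _ (s≤s ()) _

  ⊑-height₁ : ∀ {π z} → [ z ] ⊑ π → ∃ λ r → suc r ≤ length π × height π (suc r) ≡ z
  ⊑-height₁ (x ∷ʳ s) with r , r≤ , e ← ⊑-height₁ s = suc r , s≤s r≤ , e
  ⊑-height₁ (refl ∷ s) = 0 , s≤s z≤n , refl

  ⊑-height₂ : ∀ {π y z} → y ∷ z ∷ [] ⊑ π →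
    ∃₂ λ q r → q < r × suc r ≤ length π × height π (suc q) ≡ y × height π (suc r) ≡ z
  ⊑-height₂ (x ∷ʳ s) with q , r , q<r , r≤ , e ← ⊑-height₂ s = suc q , suc r , s≤s q<r , s≤s r≤ , e
  ⊑-height₂ (refl ∷ s) with r , r≤ , e ← ⊑-height₁ s = 0 , suc r , s≤s z≤n , s≤s r≤ , refl , e

  ⊑-height₃ : ∀ {π x y z} → x ∷ y ∷ z ∷ [] ⊑ π → ∃ λ p → ∃₂ λ q r → p < q × q < r × suc r ≤ length π
    × height π (suc p) ≡ x × height π (suc q) ≡ y × height π (suc r) ≡ z
  ⊑-height₃ (x ∷ʳ s) with p , q , r , p<q , q<r , r≤ , e ← ⊑-height₃ s = suc p , suc q , suc r , s≤s p<q , s≤s q<r , s≤s r≤ , e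
  ⊑-height₃ (refl ∷ s) with q , r , q<r , r≤ , e ← ⊑-height₂ s = 0 , suc q , suc r , s≤s z≤n , s≤s q<r , s≤s r≤ , refl , e

  contains213⁺ : ∀ {π x y z} → x ∷ y ∷ z ∷ [] ⊑ π → y < x → x < z → T (contains213 (length π) π)
  contains213⁺ {π} s y<x x<z with p , q , r , p<q , q<r , r≤ , refl , refl , refl ← ⊑-height₃ s =
    any⁺ _ (lose (∈-range1⁺ {x = suc p} (s≤s z≤n) (<⇒≤ (<-≤-trans (s≤s (<-trans p<q q<r)) r≤)))
    (any⁺ _ (lose (∈-range1⁺ {x = suc q} (s≤s z≤n) (<⇒≤ (<-≤-trans (s≤s q<r) r≤)))
    (any⁺ _ (lose (∈-range1⁺ {x = suc r} (s≤s z≤n) r≤)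
    (T-∧⁺ (<⇒<ᵇ (s≤s p<q)) (T-∧⁺ (<⇒<ᵇ (s≤s q<r)) (T-∧⁺ (<⇒<ᵇ y<x) (<⇒<ᵇ x<z)))))))))
    where
    T-∧⁺ : ∀ {a b} → T a → T b → T (a ∧ b)
    T-∧⁺ p q = Equivalence.from T-∧ (p , q)

  contains213⁻ : ∀ {π} → Avoids213 π → ¬ T (contains213 (length π) π)
  contains213⁻ {π} av t
    with p , p∈ , tp ← find (any⁻ _ (range1 (length π)) t)
    with q , q∈ , tq ← find (any⁻ _ (range1 (length π)) tp)
    with r , r∈ , tr ← find (any⁻ _ (range1 (length π)) tq)
    with p<q , tr₁ ← Equivalence.to (T-∧ {p <ᵇ q}) tr
    with q<r , tr₂ ← Equivalence.to (T-∧ {q <ᵇ r}) tr₁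
    with y<x , x<z ← Equivalence.to (T-∧ {height π q <ᵇ height π p}) tr₂
    = av (height-⊑₃ π (proj₁ (∈-range1⁻ (length π) p∈)) (<ᵇ⇒< p q p<q) (<ᵇ⇒< q r q<r) (proj₂ (∈-range1⁻ (length π) r∈)))
         (<ᵇ⇒< _ _ y<x) (<ᵇ⇒< _ _ x<z)

  T-not : ∀ {b} → ¬ T b → T (not b)
  T-not {true}  f = ⊥-elim (f _)
  T-not {false} f = _

  T-not⁻ : ∀ {b} → T (not b) → ¬ T b
  T-not⁻ {true} () _

  ↭-range1-length : ∀ n {π} → π ↭ range1 n → length π ≡ n
  ↭-range1-length n p = trans (↭-length p) (length-range1 n)

  ∈-Av213⁺ : ∀ n {π} → π ↭ range1 n → Avoids213 π → π ∈ Av213 n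
  ∈-Av213⁺ n {π} p av = ∈-filter⁺ (λ π → T? (not (contains213 n π))) (∈-perms⁺ {n} p)
    (subst (λ k → T (not (contains213 k π))) (↭-range1-length n p) (T-not (contains213⁻ av)))

  ∈-Av213⁻ : ∀ n {π} → π ∈ Av213 n → π ↭ range1 n × Avoids213 π
  ∈-Av213⁻ n {π} π∈ with π∈perms , t ← ∈-filter⁻ (λ π → T? (not (contains213 n π))) π∈ =
    p , λ s y<x x<z → T-not⁻ (subst (λ k → T (not (contains213 k π))) (sym (↭-range1-length n p)) t) (contains213⁺ s y<x x<z)
    where p = ∈-perms⁻ {n} π∈perms

  entry-bounds : ∀ n {π x} → π ↭ range1 n → x ∈ π → 1 ≤ x × x ≤ n
  entry-bounds n p x∈ = ∈-range1⁻ n (∈-resp-↭ p x∈)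

  -- Decomposition of a 213-avoiding permutation at its entry 1.

  splits : ℕ → List (ℕ × ℕ)
  splits zero    = (0 , 0) ∷ []
  splits (suc n) = (0 , suc n) ∷ map (map₁ suc) (splits n)

  ∈-splits⁺ : ∀ k m → (k , m) ∈ splits (k + m)
  ∈-splits⁺ zero    zero    = here refl
  ∈-splits⁺ zero    (suc m) = here refl
  ∈-splits⁺ (suc k) m       = there (∈-map⁺ (map₁ suc) (∈-splits⁺ k m))

  ∈-splits⁻ : ∀ n {k m} → (k , m) ∈ splits n → k + m ≡ n
  ∈-splits⁻ zero    (here refl) = refl
  ∈-splits⁻ (suc n) (here refl) = refl
  ∈-splits⁻ (suc n) (there s) with _ , s′ , refl ← ∈-map⁻ (map₁ suc) s = cong suc (∈-splits⁻ n s′)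

  splits-unique : ∀ n → Unique (splits n)
  splits-unique zero    = [] ∷ []
  splits-unique (suc n) = All.tabulate (λ s e → absurd s e) ∷ Unique.map⁺ (λ { refl → refl }) (splits-unique n)
    where
    absurd : ∀ {x} → x ∈ map (map₁ suc) (splits n) → (0 , suc n) ≢ x
    absurd s e with _ , _ , refl ← ∈-map⁻ (map₁ suc) s with () ← e

  -- An entry a before the 1 and a larger b after it would form the pattern a 1 b. Hence the left
  -- block takes the largest values, and the shift by `suc (length R)` makes room below it for 1 and
  -- the right block.
  join : List ℕ → List ℕ → List ℕ
  join L R = map (suc (length R) +_) L ++ 1 ∷ map suc R

  join-↭ : ∀ k m {L R} → L ↭ range1 k → R ↭ range1 m → join L R ↭ range1 (suc (k + m))
  join-↭ k m {L} {R} p q rewrite ↭-range1-length m q = ↭-trans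
    (↭-++-comm (map (suc m +_) L) (1 ∷ map suc R))
    (↭-trans (↭-++⁺ (↭-prep 1 (↭-map⁺ suc q)) (↭-map⁺ (suc m +_) p))
      (↭-reflexive (trans (cong (_++ map (suc m +_) (range1 k)) (sym (range1-suc m)))
        (trans (sym (range1-+ (suc m) k)) (cong (range1 ∘ suc) (+-comm m k))))))

  ⊑-++⁻ : ∀ {cs : List ℕ} as {bs} → cs ⊑ as ++ bs → ∃₂ λ cs₁ cs₂ → cs ≡ cs₁ ++ cs₂ × cs₁ ⊑ as × cs₂ ⊑ bs
  ⊑-++⁻ []       s = [] , _ , refl , [] , s
  ⊑-++⁻ (a ∷ as) (.a ∷ʳ s) with cs₁ , cs₂ , e , s₁ , s₂ ← ⊑-++⁻ as s = cs₁ , cs₂ , e , a ∷ʳ s₁ , s₂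
  ⊑-++⁻ (a ∷ as) (refl ∷ s) with cs₁ , cs₂ , refl , s₁ , s₂ ← ⊑-++⁻ as s = a ∷ cs₁ , cs₂ , refl , refl ∷ s₁ , s₂

  map-avoids⁺ : ∀ s {π} → Avoids213 π → Avoids213 (map (s +_) π)
  map-avoids⁺ s {π} av {x} {y} {z} t y<x x<z with preimage t
    where
    preimage : ∀ {cs π} → cs ⊑ map (s +_) π → ∃ λ ds → cs ≡ map (s +_) ds × ds ⊑ π
    preimage {π = []}    []         = [] , refl , []
    preimage {π = v ∷ π} (_ ∷ʳ t)   with ds , e , t′ ← preimage t = ds , e , v ∷ʳ t′
    preimage {π = v ∷ π} (refl ∷ t) with ds , refl , t′ ← preimage t = v ∷ ds , refl , refl ∷ t′
  ... | _ ∷ _ ∷ _ ∷ [] , refl , t′ = av t′ (+-cancelˡ-< s _ _ y<x) (+-cancelˡ-< s _ _ x<z)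

  map-avoids⁻ : ∀ s {π} → Avoids213 (map (s +_) π) → Avoids213 π
  map-avoids⁻ s av t y<x x<z = av (Sublist.map⁺ (s +_) t) (+-monoʳ-< s y<x) (+-monoʳ-< s x<z)

  -- An occurrence that starts in the left block must end there, since everything from the 1 onwards
  -- is smaller than x, and one that starts at the 1 would need a smaller y. Only occurrences inside
  -- a single block remain.
  blocks-avoid : ∀ {as bs} → Avoids213 as → Avoids213 bs → (∀ {a b} → a ∈ as → b ∈ bs → b < a) →
    All (1 <_) as → All (1 <_) bs → Avoids213 (as ++ 1 ∷ bs)
  blocks-avoid {as} {bs} avA avB big A B {x} {y} {z} s y<x x<z with ⊑-++⁻ as s
  ... | [] , _ , refl , _ , (_ ∷ʳ t) = avB t y<x x<z
  ... | [] , _ , refl , _ , (refl ∷ t) = <⇒≱ y<x (<⇒≤ (All.lookup B (to∈ t)))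
  ... | _ ∷ [] , _ , refl , t₁ , t₂ = <-asym x<z (z<x (to∈ t₁) (to∈ (Sublist.∷ˡ⁻ t₂)))
    where
    z<x : x ∈ as → z ∈ 1 ∷ bs → z < x
    z<x x∈ (here refl) = All.lookup A x∈
    z<x x∈ (there z∈)  = big x∈ z∈
  ... | _ ∷ _ ∷ [] , _ , refl , t₁ , t₂ = <-asym x<z (z<x (to∈ t₁) (to∈ t₂))
    where
    z<x : x ∈ as → z ∈ 1 ∷ bs → z < x
    z<x x∈ (here refl) = All.lookup A x∈
    z<x x∈ (there z∈)  = big x∈ z∈
  ... | _ ∷ _ ∷ _ ∷ [] , [] , refl , t₁ , _ = avA t₁ y<x x<z

  join-∈ : ∀ k m {L R} → L ∈ Av213 k → R ∈ Av213 m → join L R ∈ Av213 (suc (k + m))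
  join-∈ k m {L} {R} L∈ R∈ with p , avL ← ∈-Av213⁻ k L∈ with q , avR ← ∈-Av213⁻ m R∈ =
    ∈-Av213⁺ (suc (k + m)) (join-↭ k m p q)
      (blocks-avoid (map-avoids⁺ (suc (length R)) avL) (map-avoids⁺ 1 avR) big
        (AllP.map⁺ (All.tabulate λ {x} x∈ → s≤s (≤-trans (proj₁ (entry-bounds k p x∈)) (m≤n+m x (length R)))))
        (AllP.map⁺ (All.tabulate λ x∈ → s≤s (proj₁ (entry-bounds m q x∈)))))
    where
    big : ∀ {a b} → a ∈ map (suc (length R) +_) L → b ∈ map suc R → b < a
    big a∈ b∈ with u , u∈ , refl ← ∈-map⁻ (suc (length R) +_) a∈ with v , v∈ , refl ← ∈-map⁻ suc b∈ =
      s≤s (≤-<-trans (subst (v ≤_) (sym (↭-range1-length m q)) (proj₂ (entry-bounds m q v∈)))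
                     (m<m+n (length R) (proj₁ (entry-bounds k p u∈))))

  module _ {a} {A : Set a} where

    unique-++⁻ʳ : (xs : List A) {ys : List A} → Unique (xs ++ ys) → Unique ys
    unique-++⁻ʳ []       u       = u
    unique-++⁻ʳ (x ∷ xs) (_ ∷ u) = unique-++⁻ʳ xs u

    unique-++-disjoint : {xs ys : List A} → Unique (xs ++ ys) → Disjoint xs ys
    unique-++-disjoint {x ∷ xs} (x∉ ∷ _) (here refl , v∈) = All.lookup x∉ (∈-++⁺ʳ xs v∈) refl
    unique-++-disjoint {x ∷ xs} (_ ∷ u)  (there u∈ , v∈)  = unique-++-disjoint u (u∈ , v∈)

  -- The right block will turn out to hold the values 2, ..., M; the default 1 makes this range
  -- empty for an empty block.
  max-of-block : ∀ R → ∃ λ M → 1 ≤ M × (M ≡ 1 ⊎ M ∈ R) × (∀ {x} → x ∈ R → x ≤ M)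
  max-of-block R = max 1 R , All.lookup bounds (here refl) , argmax-sel id 1 R , λ x∈ → All.lookup bounds (there x∈)
    where
    bounds : All (_≤ max 1 R) (1 ∷ R)
    bounds = ⊥≤max 1 R ∷ xs≤max 1 R

  module _ (n : ℕ) (as bs : List ℕ) (π∈ : as ++ 1 ∷ bs ∈ Av213 (suc n)) where

    private
      perm : as ++ 1 ∷ bs ↭ range1 (suc n)
      perm = proj₁ (∈-Av213⁻ (suc n) π∈)

      avoids : Avoids213 (as ++ 1 ∷ bs)
      avoids = proj₂ (∈-Av213⁻ (suc n) π∈)

      1∷-unique : Unique (1 ∷ as ++ bs)
      1∷-unique = Unique-resp-↭ (↭-trans (↭-sym perm) (shift 1 as bs)) (range1-unique (suc n))

      above-1 : ∀ {x} → x ∈ as ++ bs → 1 < x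
      above-1 {x} x∈ = ≤∧≢⇒< (proj₁ (entry-bounds (suc n) (↭-trans (↭-sym (shift 1 as bs)) perm) (there x∈)))
        (All.lookup (AllPairs.head 1∷-unique) x∈)

      left-above-right : ∀ {a b} → a ∈ as → b ∈ bs → b < a
      left-above-right {a} {b} a∈ b∈ with <-cmp b a
      ... | tri< b<a _ _ = b<a
      ... | tri≈ _ refl _ = ⊥-elim (unique-++-disjoint (AllPairs.tail 1∷-unique) (a∈ , b∈))
      ... | tri> _ _ a<b = ⊥-elim (avoids (Sublist.++⁺ (from∈ a∈) (refl ∷ from∈ b∈)) (above-1 (∈-++⁺ˡ a∈)) a<b)

    -- Every entry before the 1 exceeds the largest entry m + 1 after it, so none of the values 2,
    -- ..., m + 1 can stand on the left.
    right-block : ∃ λ m → m ≤ n × bs ↭ map suc (range1 m)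
    right-block with max-of-block bs
    ... | suc m , _ , top , bound = m , m≤n top
      , unique-⊆-⊇⇒↭ (unique-++⁻ʳ as (AllPairs.tail 1∷-unique)) (Unique.map⁺ suc-injective (range1-unique m)) ⊆₁ ⊆₂
      where
      m≤n : suc m ≡ 1 ⊎ suc m ∈ bs → m ≤ n
      m≤n (inj₁ refl) = z≤n
      m≤n (inj₂ m∈)   = s≤s⁻¹ (proj₂ (entry-bounds (suc n) perm (∈-++⁺ʳ as (there m∈))))
      ⊆₁ : bs ⊆ map suc (range1 m)
      ⊆₁ {zero}  x∈ = ⊥-elim (n≮0 (above-1 (∈-++⁺ʳ as x∈)))
      ⊆₁ {suc x} x∈ = ∈-map⁺ suc (∈-range1⁺ (s≤s⁻¹ (above-1 (∈-++⁺ʳ as x∈))) (s≤s⁻¹ (bound x∈)))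
      top∈ : suc m ≡ 1 ⊎ suc m ∈ bs → 1 ≤ m → suc m ∈ bs
      top∈ (inj₁ refl) ()
      top∈ (inj₂ m∈)   _ = m∈
      ⊆₂ : map suc (range1 m) ⊆ bs
      ⊆₂ x∈ with y , y∈ , refl ← ∈-map⁻ suc x∈ with 1≤y , y≤m ← ∈-range1⁻ m y∈
        with ∈-++⁻ as (∈-resp-↭ (↭-sym perm) (∈-range1⁺ {suc n} {suc y} (s≤s z≤n) (s≤s (≤-trans y≤m (m≤n top)))))
      ... | inj₁ y∈as         = ⊥-elim (<⇒≱ (left-above-right y∈as (top∈ top (≤-trans 1≤y y≤m))) (s≤s y≤m))
      ... | inj₂ (here refl)  = ⊥-elim (n≮0 1≤y)
      ... | inj₂ (there y∈bs) = y∈bs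

    -- The 1 and `bs` use up exactly the values 1, ..., m + 1; cancelling these from the whole range
    -- leaves the values of `as`.
    left-block : ∀ k m → m + k ≡ n → bs ↭ map suc (range1 m) → as ↭ map (suc m +_) (range1 k)
    left-block k m refl p = ↭-++-cancelˡ (range1 (suc m)) (↭-trans
      (↭-++⁺ʳ as (↭-trans (↭-reflexive (range1-suc m)) (↭-prep 1 (↭-sym p))))
      (↭-trans (↭-++-comm (1 ∷ bs) as) (↭-trans perm (↭-reflexive (range1-+ (suc m) k)))))

    decompose : ∃₂ λ k m → ∃₂ λ L R → k + m ≡ n × L ∈ Av213 k × R ∈ Av213 m × as ++ 1 ∷ bs ≡ join L R
    decompose
      with m , m≤n , p ← right-block
      with L , eL , q ← ↭-map-inv (suc m +_) (↭-sym (left-block (n ∸ m) m (m+[n∸m]≡n m≤n) p))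
      with R , eR , r ← ↭-map-inv suc (↭-sym p)
      = n ∸ m , m , L , R , m∸n+n≡m m≤n
      , ∈-Av213⁺ (n ∸ m) (↭-sym q) (map-avoids⁻ (suc m) (subst Avoids213 eL avoids-as))
      , ∈-Av213⁺ m (↭-sym r) (map-avoids⁻ 1 (subst Avoids213 eR avoids-bs))
      , cong₂ (λ u v → u ++ 1 ∷ v)
          (trans eL (cong (λ l → map (suc l +_) L) (sym (↭-range1-length m (↭-sym r))))) eR
      where
      avoids-as : Avoids213 as
      avoids-as s = avoids (⊑-trans s (Sublist.++⁺ʳ (1 ∷ bs) ⊑-refl))
      avoids-bs : Avoids213 bs
      avoids-bs s = avoids (⊑-trans s (Sublist.++⁺ˡ as (1 ∷ʳ ⊑-refl)))

  decompose-Av213 : ∀ n {π} → π ∈ Av213 (suc n) →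
    ∃₂ λ k m → ∃₂ λ L R → k + m ≡ n × L ∈ Av213 k × R ∈ Av213 m × π ≡ join L R
  decompose-Av213 n {π} π∈
    with ∈-∃++ (∈-resp-↭ (↭-sym (proj₁ (∈-Av213⁻ (suc n) π∈))) (∈-range1⁺ {suc n} {1} (s≤s z≤n) (s≤s z≤n)))
  ... | as , bs , refl = decompose n as bs π∈

  joinPairs : ℕ → List (List ℕ × List ℕ)
  joinPairs n = concatMap (λ (k , m) → cartesianProduct (Av213 k) (Av213 m)) (splits n)

  ∈-joinPairs⁺ : ∀ k m {L R} → L ∈ Av213 k → R ∈ Av213 m → (L , R) ∈ joinPairs (k + m)
  ∈-joinPairs⁺ k m L∈ R∈ = ∈-concatMap⁺ _ (lose (∈-splits⁺ k m) (∈-cartesianProduct⁺ L∈ R∈))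

  ∈-joinPairs⁻ : ∀ n {L R} → (L , R) ∈ joinPairs n → ∃₂ λ k m → k + m ≡ n × L ∈ Av213 k × R ∈ Av213 m
  ∈-joinPairs⁻ n LR∈ with (k , m) , s , LR∈′ ← find (∈-concatMap⁻ (λ (k , m) → cartesianProduct (Av213 k) (Av213 m)) {splits n} LR∈) =
    k , m , ∈-splits⁻ n s , ∈-cartesianProduct⁻ (Av213 k) (Av213 m) LR∈′

  ∈-Av213-length : ∀ n {π} → π ∈ Av213 n → length π ≡ n
  ∈-Av213-length n π∈ = ↭-range1-length n (proj₁ (∈-Av213⁻ n π∈))

  joinPairs-unique : ∀ n → Unique (joinPairs n)
  joinPairs-unique n = Unique.concat⁺
    (AllP.map⁺ (All.tabulate λ { {k , m} _ → Unique.cartesianProduct⁺ (Av213-unique k) (Av213-unique m) }))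
    (AllPairsP.map⁺ (AllPairs.map disjoint (splits-unique n)))
    where
    disjoint : ∀ {s t : ℕ × ℕ} → s ≢ t →
      Disjoint (cartesianProduct (Av213 (proj₁ s)) (Av213 (proj₂ s))) (cartesianProduct (Av213 (proj₁ t)) (Av213 (proj₂ t)))
    disjoint {k , m} {k′ , m′} s≢t (v∈ , w∈)
      with L∈ , R∈ ← ∈-cartesianProduct⁻ (Av213 k) (Av213 m) v∈
      with L∈′ , R∈′ ← ∈-cartesianProduct⁻ (Av213 k′) (Av213 m′) w∈
      = s≢t (cong₂ _,_ (trans (sym (∈-Av213-length k L∈)) (∈-Av213-length k′ L∈′))
                       (trans (sym (∈-Av213-length m R∈)) (∈-Av213-length m′ R∈′)))

  first-1-unique : ∀ {as bs cs ds : List ℕ} → All (1 <_) as → All (1 <_) cs → as ++ 1 ∷ bs ≡ cs ++ 1 ∷ ds → as ≡ cs × bs ≡ ds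
  first-1-unique []      []      refl = refl , refl
  first-1-unique []      (q ∷ _) refl = ⊥-elim (<-irrefl refl q)
  first-1-unique (p ∷ _) []      refl = ⊥-elim (<-irrefl refl p)
  first-1-unique (_ ∷ p) (_ ∷ q) e with refl , e′ ← ∷-injective e with refl , refl ← first-1-unique p q e′ = refl , refl

  shifted-above-1 : ∀ m {π} → All (1 ≤_) π → All (1 <_) (map (suc m +_) π)
  shifted-above-1 m p = AllP.map⁺ (All.map (λ {x} 1≤x → s≤s (≤-trans 1≤x (m≤n+m x m))) p)

  -- Positive entries in the left blocks make the first 1 mark the cut. `R` is recovered before `L`,
  -- because the shift of `L` depends on the length of `R`.
  join-injective : ∀ {L R L′ R′} → All (1 ≤_) L → All (1 ≤_) L′ → join L R ≡ join L′ R′ → (L , R) ≡ (L′ , R′)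
  join-injective {L} {R} {L′} {R′} p p′ e
    with eL , eR ← first-1-unique (shifted-above-1 (length R) p) (shifted-above-1 (length R′) p′) e
    with refl ← map-injective suc-injective eR
    with refl ← map-injective (+-cancelˡ-≡ (suc (length R)) _ _) eL = refl

  unique-map⁺ : ∀ {a b} {A : Set a} {B : Set b} (f : A → B) {xs : List A} →
    (∀ {x y} → x ∈ xs → y ∈ xs → f x ≡ f y → x ≡ y) → Unique xs → Unique (map f xs)
  unique-map⁺ f inj []       = []
  unique-map⁺ f inj (x∉ ∷ u) =
    AllP.map⁺ (All.tabulate λ y∈ e → All.lookup x∉ y∈ (inj (here refl) (there y∈) e)) ∷
    unique-map⁺ f (λ x∈ y∈ → inj (there x∈) (there y∈)) u

  -- Both lists are duplicate-free with the same elements. Equality up to order is all that a sum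
  -- over them sees.
  Av213-suc : ∀ n → Av213 (suc n) ↭ map (uncurry join) (joinPairs n)
  Av213-suc n = unique-⊆-⊇⇒↭ (Av213-unique (suc n)) (unique-map⁺ (uncurry join) inj (joinPairs-unique n)) ⊆₁ ⊆₂
    where
    positive : ∀ {L R} → (L , R) ∈ joinPairs n → All (1 ≤_) L
    positive LR∈ with k , _ , _ , L∈ , _ ← ∈-joinPairs⁻ n LR∈ =
      All.tabulate λ x∈ → proj₁ (entry-bounds k (proj₁ (∈-Av213⁻ k L∈)) x∈)
    inj : ∀ {s t} → s ∈ joinPairs n → t ∈ joinPairs n → uncurry join s ≡ uncurry join t → s ≡ t
    inj s∈ t∈ = join-injective (positive s∈) (positive t∈)
    ⊆₁ : Av213 (suc n) ⊆ map (uncurry join) (joinPairs n)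
    ⊆₁ π∈ with k , m , L , R , refl , L∈ , R∈ , refl ← decompose-Av213 n π∈ =
      ∈-map⁺ (uncurry join) (∈-joinPairs⁺ k m L∈ R∈)
    ⊆₂ : map (uncurry join) (joinPairs n) ⊆ Av213 (suc n)
    ⊆₂ π∈ with (L , R) , LR∈ , refl ← ∈-map⁻ (uncurry join) π∈
      with k , m , refl , L∈ , R∈ ← ∈-joinPairs⁻ n LR∈ = join-∈ k m L∈ R∈

-- Totals of additive statistics over 213-avoiding permutations.

module Statistics where

  open FormalSeries
  open CatalanGeneratingFunction using (two; module CatalanSeries)
  open Permutations
  open import Data.List using (List; []; _∷_; _++_; length; map; concatMap; cartesianProduct)
  open import Data.List.Membership.Propositional using (_∈_)
  open import Data.List.Properties using (length-map; map-++; map-∘; map-cong-local)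
  open import Data.List.Relation.Binary.Permutation.Propositional.Properties using () renaming (map⁺ to ↭-map⁺)
  open import Data.List.Relation.Unary.All as All using (All; []; _∷_)
  open import Data.Nat
  open import Data.Nat.Properties
  open import Data.Product using (_×_; _,_; proj₁; map₁; uncurry)
  open import Function using (_∘_; id)
  open import Relation.Binary.PropositionalEquality using (_≡_; refl; sym; trans; cong; cong₂; subst₂; module ≡-Reasoning)
  open import Data.Nat.ListAction using (sum)
  open import Data.Nat.ListAction.Properties using (sum-++; sum-↭)
  open import Data.Nat.Tactic.RingSolver using (solve-∀)

  module _ {a} {A : Set a} where

    sum-map-cong : {f g : A → ℕ} (xs : List A) → (∀ {x} → x ∈ xs → f x ≡ g x) → sum (map f xs) ≡ sum (map g xs)
    sum-map-cong xs e = cong sum (map-cong-local (All.tabulate e))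

    sum-map-+ : (f g : A → ℕ) (xs : List A) → sum (map (λ x → f x + g x) xs) ≡ sum (map f xs) + sum (map g xs)
    sum-map-+ f g []       = refl
    sum-map-+ f g (x ∷ xs) = trans (cong (f x + g x +_) (sum-map-+ f g xs)) (+-interchange (f x) (g x) _ _)

    sum-map-* : ∀ c (f : A → ℕ) (xs : List A) → sum (map (λ x → c * f x) xs) ≡ c * sum (map f xs)
    sum-map-* c f []       = sym (*-zeroʳ c)
    sum-map-* c f (x ∷ xs) = trans (cong (c * f x +_) (sum-map-* c f xs)) (sym (*-distribˡ-+ c (f x) _))

    sum-map-const : ∀ c (xs : List A) → sum (map (λ _ → c) xs) ≡ length xs * c
    sum-map-const c []       = refl
    sum-map-const c (x ∷ xs) = cong (c +_) (sum-map-const c xs)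

    sum-map-concatMap : ∀ {b} {B : Set b} (f : B → ℕ) (g : A → List B) (xs : List A) →
      sum (map f (concatMap g xs)) ≡ sum (map (λ x → sum (map f (g x))) xs)
    sum-map-concatMap f g []       = refl
    sum-map-concatMap f g (x ∷ xs) = trans (cong sum (map-++ f (g x) (concatMap g xs)))
      (trans (sum-++ (map f (g x)) _) (cong (sum (map f (g x)) +_) (sum-map-concatMap f g xs)))

    sum-map-cartesianProduct : ∀ {b} {B : Set b} (f : A × B → ℕ) (xs : List A) (ys : List B) →
      sum (map f (cartesianProduct xs ys)) ≡ sum (map (λ x → sum (map (λ y → f (x , y)) ys)) xs)
    sum-map-cartesianProduct f []       ys = refl
    sum-map-cartesianProduct f (x ∷ xs) ys = trans (cong sum (map-++ f (map (x ,_) ys) _))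
      (trans (sum-++ (map f (map (x ,_) ys)) _)
        (cong₂ _+_ (cong sum (sym (map-∘ ys))) (sum-map-cartesianProduct f xs ys)))

  sum-map-splits : ∀ (f : ℕ × ℕ → ℕ) n → sum (map f (splits n)) ≡ antidiagonal (λ k m → f (k , m)) n
  sum-map-splits f zero    = +-identityʳ _
  sum-map-splits f (suc n) = cong (f (0 , suc n) +_)
    (trans (cong sum (sym (map-∘ (splits n)))) (sum-map-splits (f ∘ map₁ suc) n))

  antidiagonal-cong-on : ∀ {h h′ : ℕ → ℕ → ℕ} n → (∀ k m → k + m ≡ n → h k m ≡ h′ k m) → antidiagonal h n ≡ antidiagonal h′ n
  antidiagonal-cong-on zero    e = e 0 0 refl
  antidiagonal-cong-on (suc n) e = cong₂ _+_ (e 0 (suc n) refl) (antidiagonal-cong-on n (λ k m p → e (suc k) m (cong suc p)))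

  total : (List ℕ → ℕ) → Series
  total f n = sum (map f (Av213 n))

  catalan : Series
  catalan n = length (Av213 n)

  total-suc : ∀ f n → total f (suc n) ≡
    antidiagonal (λ k m → sum (map (λ L → sum (map (λ R → f (join L R)) (Av213 m))) (Av213 k))) n
  total-suc f n = begin
    sum (map f (Av213 (suc n)))                       ≡⟨ sum-↭ (↭-map⁺ f (Av213-suc n)) ⟩
    sum (map f (map (uncurry join) (joinPairs n)))    ≡⟨ cong sum (sym (map-∘ (joinPairs n))) ⟩
    sum (map (f ∘ uncurry join) (joinPairs n))        ≡⟨ sum-map-concatMap (f ∘ uncurry join) _ (splits n) ⟩
    sum (map (λ (k , m) → sum (map (f ∘ uncurry join) (cartesianProduct (Av213 k) (Av213 m)))) (splits n))
      ≡⟨ sum-map-cong (splits n) (λ { {k , m} _ → sum-map-cartesianProduct (f ∘ uncurry join) (Av213 k) (Av213 m) }) ⟩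
    sum (map (λ (k , m) → sum (map (λ L → sum (map (λ R → f (join L R)) (Av213 m))) (Av213 k))) (splits n))
      ≡⟨ sum-map-splits _ n ⟩
    antidiagonal (λ k m → sum (map (λ L → sum (map (λ R → f (join L R)) (Av213 m))) (Av213 k))) n ∎
    where open ≡-Reasoning

  -- The statistic of the whole and that of the parts may differ: vertices of degree 1 in a join are
  -- expressed by the peaks of its two parts.
  total-additive : ∀ f g (w : ℕ → ℕ → ℕ) n →
    (∀ k m → k + m ≡ n → ∀ {L R} → L ∈ Av213 k → R ∈ Av213 m → f (join L R) ≡ g L + g R + w k m) →
    total f (suc n) ≡ two (catalan ⊛ total g) n + antidiagonal (λ k m → catalan k * catalan m * w k m) n
  total-additive f g w n e = begin
    total f (suc n)
      ≡⟨ trans (total-suc f n) (antidiagonal-cong-on n inner) ⟩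
    antidiagonal (λ k m → total g k * catalan m + catalan k * total g m + catalan k * catalan m * w k m) n
      ≡⟨ trans (antidiagonal-+ _ (λ k m → catalan k * catalan m * w k m) n)
               (cong (_+ antidiagonal (λ k m → catalan k * catalan m * w k m) n)
                 (antidiagonal-+ (λ k m → total g k * catalan m) (λ k m → catalan k * total g m) n)) ⟩
    (total g ⊛ catalan) n + (catalan ⊛ total g) n + antidiagonal (λ k m → catalan k * catalan m * w k m) n
      ≡⟨ cong (λ z → z + (catalan ⊛ total g) n + antidiagonal (λ k m → catalan k * catalan m * w k m) n)
           (⊛-comm (total g) catalan n) ⟩
    two (catalan ⊛ total g) n + antidiagonal (λ k m → catalan k * catalan m * w k m) n ∎
    where
    open ≡-Reasoning
    rearrange : ∀ G M H K W → M * G + K * H + K * (M * W) ≡ G * M + K * H + K * M * W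
    rearrange = solve-∀
    inner : ∀ k m → k + m ≡ n → sum (map (λ L → sum (map (λ R → f (join L R)) (Av213 m))) (Av213 k))
      ≡ total g k * catalan m + catalan k * total g m + catalan k * catalan m * w k m
    inner k m k+m = begin
      sum (map (λ L → sum (map (λ R → f (join L R)) (Av213 m))) (Av213 k))
        ≡⟨ sum-map-cong (Av213 k) (λ {L} L∈ → trans (sum-map-cong (Av213 m) (e k m k+m L∈))
             (trans (sum-map-+ (λ R → g L + g R) (λ _ → w k m) (Av213 m))
               (cong₂ _+_ (trans (sum-map-+ (λ _ → g L) g (Av213 m)) (cong (_+ total g m) (sum-map-const (g L) (Av213 m))))
                          (sum-map-const (w k m) (Av213 m))))) ⟩
      sum (map (λ L → catalan m * g L + total g m + catalan m * w k m) (Av213 k))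
        ≡⟨ trans (sum-map-+ (λ L → catalan m * g L + total g m) (λ _ → catalan m * w k m) (Av213 k))
             (cong₂ _+_ (trans (sum-map-+ (λ L → catalan m * g L) (λ _ → total g m) (Av213 k))
                          (cong₂ _+_ (sum-map-* (catalan m) g (Av213 k)) (sum-map-const (total g m) (Av213 k))))
                        (sum-map-const (catalan m * w k m) (Av213 k))) ⟩
      catalan m * total g k + catalan k * total g m + catalan k * (catalan m * w k m)
        ≡⟨ rearrange (total g k) (catalan m) (total g m) (catalan k) (w k m) ⟩
      total g k * catalan m + catalan k * total g m + catalan k * catalan m * w k m ∎

  catalan-eq : catalan ≈ 𝟙 ⊕ X ⊛ (catalan ⊛ catalan)
  catalan-eq zero    = refl
  catalan-eq (suc n) = begin
    catalan (suc n)
      ≡⟨ sym (trans (sum-map-const 1 (Av213 (suc n))) (*-identityʳ _)) ⟩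
    total (λ _ → 1) (suc n)
      ≡⟨ trans (total-suc (λ _ → 1) n) (antidiagonal-cong inner n) ⟩
    (catalan ⊛ catalan) n
      ≡⟨ sym (X⊛-suc (catalan ⊛ catalan) n) ⟩
    (X ⊛ (catalan ⊛ catalan)) (suc n) ∎
    where
    open ≡-Reasoning
    inner : ∀ k m → sum (map (λ _ → sum (map (λ _ → 1) (Av213 m))) (Av213 k)) ≡ catalan k * catalan m
    inner k m = trans (sum-map-const (sum (map (λ _ → 1) (Av213 m))) (Av213 k))
      (cong (catalan k *_) (trans (sum-map-const 1 (Av213 m)) (*-identityʳ _)))

  -- Statistics over windows of two and three consecutive entries.

  windows₂ : (ℕ → ℕ → ℕ) → List ℕ → ℕ
  windows₂ g (x ∷ y ∷ r) = g x y + windows₂ g (y ∷ r)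
  windows₂ g _           = 0

  windows₃ : (ℕ → ℕ → ℕ → ℕ) → List ℕ → ℕ
  windows₃ g (x ∷ y ∷ z ∷ r) = g x y z + windows₃ g (y ∷ z ∷ r)
  windows₃ g _               = 0

  -- The truncated `length π ∸ 1` is the number of windows, also for the empty list; it is the
  -- origin of the series `c-pred`.
  windows₂-shift : ∀ g s t → (∀ {x y} → 1 ≤ x → 1 ≤ y → g (s + x) (s + y) ≡ g x y + t) →
    ∀ {π} → All (1 ≤_) π → windows₂ g (map (s +_) π) ≡ windows₂ g π + t * (length π ∸ 1)
  windows₂-shift g s t e []      = sym (*-zeroʳ t)
  windows₂-shift g s t e (_ ∷ []) = sym (*-zeroʳ t)
  windows₂-shift g s t e {x ∷ y ∷ r} (p ∷ q ∷ ps) = trans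
    (cong₂ _+_ (e p q) (windows₂-shift g s t e (q ∷ ps)))
    (rearrange (g x y) t (windows₂ g (y ∷ r)) (length r))
    where
    rearrange : ∀ a t b l → (a + t) + (b + t * l) ≡ (a + b) + t * suc l
    rearrange = solve-∀

  windows₃-shift : ∀ g s t → (∀ {x y z} → 1 ≤ x → 1 ≤ y → 1 ≤ z → g (s + x) (s + y) (s + z) ≡ g x y z + t) →
    ∀ {π} → All (1 ≤_) π → windows₃ g (map (s +_) π) ≡ windows₃ g π + t * (length π ∸ 2)
  windows₃-shift g s t e []           = sym (*-zeroʳ t)
  windows₃-shift g s t e (_ ∷ [])     = sym (*-zeroʳ t)
  windows₃-shift g s t e (_ ∷ _ ∷ []) = sym (*-zeroʳ t)
  windows₃-shift g s t e {x ∷ y ∷ z ∷ r} (p ∷ q ∷ o ∷ ps) = trans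
    (cong₂ _+_ (e p q o) (windows₃-shift g s t e (q ∷ o ∷ ps)))
    (rearrange (g x y z) t (windows₃ g (y ∷ z ∷ r)) (length r))
    where
    rearrange : ∀ a t b l → (a + t) + (b + t * l) ≡ (a + b) + t * suc l
    rearrange = solve-∀

  windows₂-++ : ∀ g → (∀ {x} → 1 < x → g x 1 ≡ 0) → (∀ {x} → 1 < x → g 1 x ≡ 0) →
    ∀ {as bs} → All (1 <_) as → All (1 <_) bs → windows₂ g (as ++ 1 ∷ bs) ≡ windows₂ g as + windows₂ g bs
  windows₂-++ g e e′ []       []       = refl
  windows₂-++ g e e′ {_} {y ∷ bs} [] (q ∷ qs) = cong (_+ windows₂ g (y ∷ bs)) (e′ q)
  windows₂-++ g e e′ (p ∷ []) qs       = cong₂ _+_ (e p) (windows₂-++ g e e′ [] qs)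
  windows₂-++ g e e′ {x ∷ y ∷ _} (_ ∷ p ∷ ps) qs = trans (cong (g x y +_) (windows₂-++ g e e′ (p ∷ ps) qs)) (sym (+-assoc (g x y) _ _))

  positive : ℕ → ℕ
  positive zero    = 0
  positive (suc _) = 1

  -- Of the windows that contain the 1, only x 1 y with the 1 in the middle can contribute, and it
  -- exists exactly when both blocks are nonempty.
  windows₃-++ : ∀ g w → (∀ {x y} → 1 < x → 1 < y → g x y 1 ≡ 0) → (∀ {x y} → 1 < x → 1 < y → g 1 x y ≡ 0) →
    (∀ {x y} → 1 < x → 1 < y → g x 1 y ≡ w) → ∀ {as bs} → All (1 <_) as → All (1 <_) bs →
    windows₃ g (as ++ 1 ∷ bs) ≡ windows₃ g as + windows₃ g bs + w * (positive (length as) * positive (length bs))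
  windows₃-++ g w e₁ e₂ e₃ []       []            = sym (*-zeroʳ w)
  windows₃-++ g w e₁ e₂ e₃ []       (_ ∷ [])      = sym (*-zeroʳ w)
  windows₃-++ g w e₁ e₂ e₃ {_} {y ∷ z ∷ bs} [] (q ∷ q′ ∷ qs) = trans
    (cong (_+ windows₃ g (y ∷ z ∷ bs)) (e₂ q q′))
    (sym (trans (cong (windows₃ g (y ∷ z ∷ bs) +_) (*-zeroʳ w)) (+-identityʳ _)))
  windows₃-++ g w e₁ e₂ e₃ (p ∷ []) []            = sym (*-zeroʳ w)
  windows₃-++ g w e₁ e₂ e₃ {_} {y ∷ bs} (p ∷ []) (q ∷ qs) = trans
    (cong₂ _+_ (e₃ p q) (windows₃-++ g w e₁ e₂ e₃ [] (q ∷ qs)))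
    (rearrange w (windows₃ g (y ∷ bs)))
    where
    rearrange : ∀ w x → w + (0 + x + w * (0 * 1)) ≡ 0 + x + w * (1 * 1)
    rearrange = solve-∀
  windows₃-++ g w e₁ e₂ e₃ (p ∷ p′ ∷ []) qs = cong₂ _+_ (e₁ p p′) (windows₃-++ g w e₁ e₂ e₃ (p′ ∷ []) qs)
  windows₃-++ g w e₁ e₂ e₃ {x ∷ y ∷ z ∷ as} {bs} (p ∷ p′ ∷ p″ ∷ ps) qs = trans
    (cong (g x y z +_) (windows₃-++ g w e₁ e₂ e₃ (p′ ∷ p″ ∷ ps) qs))
    (rearrange (g x y z) (windows₃ g (y ∷ z ∷ as)) (windows₃ g bs) _)
    where
    rearrange : ∀ a b c d → a + (b + c + d) ≡ (a + b) + c + d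
    rearrange = solve-∀

  pairMin : ℕ → ℕ → ℕ
  pairMin x y = (x ⊓ y) ∸ 1

  tripleMin : ℕ → ℕ → ℕ → ℕ
  tripleMin x y z = (x ⊓ y ⊓ z) ∸ 1

  valley : ℕ → ℕ → ℕ → ℕ
  valley x y z = b2n (y <ᵇ x) * b2n (y <ᵇ z)

  positive-entries : ∀ n {π} → π ∈ Av213 n → All (1 ≤_) π
  positive-entries n π∈ = All.tabulate λ x∈ → proj₁ (entry-bounds n (proj₁ (∈-Av213⁻ n π∈)) x∈)

  pred-shift : ∀ s {x} → 1 ≤ x → (s + x) ∸ 1 ≡ (x ∸ 1) + s
  pred-shift s {suc x} _ = trans (cong (_∸ 1) (+-suc s x)) (+-comm s x)

  pairMin-shift : ∀ s {x y} → 1 ≤ x → 1 ≤ y → pairMin (s + x) (s + y) ≡ pairMin x y + s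
  pairMin-shift s {x} {y} p q = trans (cong (_∸ 1) (sym (+-distribˡ-⊓ s x y))) (pred-shift s (⊓-glb p q))

  tripleMin-shift : ∀ s {x y z} → 1 ≤ x → 1 ≤ y → 1 ≤ z → tripleMin (s + x) (s + y) (s + z) ≡ tripleMin x y z + s
  tripleMin-shift s {x} {y} {z} p q r = trans
    (cong (_∸ 1) (trans (cong (_⊓ (s + z)) (sym (+-distribˡ-⊓ s x y))) (sym (+-distribˡ-⊓ s (x ⊓ y) z))))
    (pred-shift s (⊓-glb (⊓-glb p q) r))

  valley-shift : ∀ s {x y z} → 1 ≤ x → 1 ≤ y → 1 ≤ z → valley (s + x) (s + y) (s + z) ≡ valley x y z + 0
  valley-shift s {x} {y} {z} _ _ _ = trans (cong₂ (λ u v → b2n u * b2n v) (shift-<ᵇ s) (shift-<ᵇ s)) (sym (+-identityʳ _))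
    where
    shift-<ᵇ : ∀ s {u v} → (s + u <ᵇ s + v) ≡ (u <ᵇ v)
    shift-<ᵇ zero    = refl
    shift-<ᵇ (suc s) = shift-<ᵇ s

  module _ (k m : ℕ) {L R : List ℕ} (L∈ : L ∈ Av213 k) (R∈ : R ∈ Av213 m) where

    private
      as bs : List ℕ
      as = map (suc (length R) +_) L
      bs = map suc R

      as>1 : All (1 <_) as
      as>1 = shifted-above-1 (length R) (positive-entries k L∈)

      bs>1 : All (1 <_) bs
      bs>1 = shifted-above-1 0 (positive-entries m R∈)

      |as| : length as ≡ k
      |as| = trans (length-map _ L) (∈-Av213-length k L∈)

      |bs| : length bs ≡ m
      |bs| = trans (length-map suc R) (∈-Av213-length m R∈)

    join-windows₂ : ∀ g → (∀ {x} → 1 < x → g x 1 ≡ 0) → (∀ {x} → 1 < x → g 1 x ≡ 0) →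
      (t : ℕ → ℕ) → (∀ s {x y} → 1 ≤ x → 1 ≤ y → g (s + x) (s + y) ≡ g x y + t s) →
      windows₂ g (join L R) ≡ windows₂ g L + windows₂ g R + (t (suc m) * (k ∸ 1) + t 1 * (m ∸ 1))
    join-windows₂ g e₁ e₂ t sh = begin
      windows₂ g (as ++ 1 ∷ bs)     ≡⟨ windows₂-++ g e₁ e₂ as>1 bs>1 ⟩
      windows₂ g as + windows₂ g bs
        ≡⟨ cong₂ _+_ (windows₂-shift g (suc (length R)) (t (suc (length R))) (sh (suc (length R))) (positive-entries k L∈))
                     (windows₂-shift g 1 (t 1) (sh 1) (positive-entries m R∈)) ⟩
      (windows₂ g L + t (suc (length R)) * (length L ∸ 1)) + (windows₂ g R + t 1 * (length R ∸ 1))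
        ≡⟨ cong₂ (λ u v → (windows₂ g L + t (suc v) * (u ∸ 1)) + (windows₂ g R + t 1 * (v ∸ 1)))
             (∈-Av213-length k L∈) (∈-Av213-length m R∈) ⟩
      (windows₂ g L + t (suc m) * (k ∸ 1)) + (windows₂ g R + t 1 * (m ∸ 1))
        ≡⟨ +-interchange (windows₂ g L) _ _ _ ⟩
      windows₂ g L + windows₂ g R + (t (suc m) * (k ∸ 1) + t 1 * (m ∸ 1)) ∎
      where
      open ≡-Reasoning

    join-windows₃ : ∀ g w → (∀ {x y} → 1 < x → 1 < y → g x y 1 ≡ 0) → (∀ {x y} → 1 < x → 1 < y → g 1 x y ≡ 0) →
      (∀ {x y} → 1 < x → 1 < y → g x 1 y ≡ w) →
      (t : ℕ → ℕ) → (∀ s {x y z} → 1 ≤ x → 1 ≤ y → 1 ≤ z → g (s + x) (s + y) (s + z) ≡ g x y z + t s) →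
      windows₃ g (join L R) ≡ windows₃ g L + windows₃ g R
        + (t (suc m) * (k ∸ 2) + t 1 * (m ∸ 2) + w * (positive k * positive m))
    join-windows₃ g w e₁ e₂ e₃ t sh = begin
      windows₃ g (as ++ 1 ∷ bs)     ≡⟨ windows₃-++ g w e₁ e₂ e₃ as>1 bs>1 ⟩
      windows₃ g as + windows₃ g bs + w * (positive (length as) * positive (length bs))
        ≡⟨ cong₂ _+_
             (cong₂ _+_ (windows₃-shift g (suc (length R)) (t (suc (length R))) (sh (suc (length R))) (positive-entries k L∈))
                        (windows₃-shift g 1 (t 1) (sh 1) (positive-entries m R∈)))
             (cong₂ (λ u v → w * (positive u * positive v)) |as| |bs|) ⟩
      (windows₃ g L + t (suc (length R)) * (length L ∸ 2)) + (windows₃ g R + t 1 * (length R ∸ 2)) + w * (positive k * positive m)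
        ≡⟨ cong₂ (λ u v → (windows₃ g L + t (suc v) * (u ∸ 2)) + (windows₃ g R + t 1 * (v ∸ 2)) + w * (positive k * positive m))
             (∈-Av213-length k L∈) (∈-Av213-length m R∈) ⟩
      (windows₃ g L + t (suc m) * (k ∸ 2)) + (windows₃ g R + t 1 * (m ∸ 2)) + w * (positive k * positive m)
        ≡⟨ interchange (windows₃ g L) (t (suc m) * (k ∸ 2)) (windows₃ g R) (t 1 * (m ∸ 2)) (w * (positive k * positive m)) ⟩
      windows₃ g L + windows₃ g R + (t (suc m) * (k ∸ 2) + t 1 * (m ∸ 2) + w * (positive k * positive m)) ∎
      where
      open ≡-Reasoning
      interchange : ∀ a b c d e → (a + b) + (c + d) + e ≡ (a + c) + (b + d + e)
      interchange = solve-∀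

    join-pairMin : windows₂ pairMin (join L R) ≡ windows₂ pairMin L + windows₂ pairMin R + (suc m * (k ∸ 1) + 1 * (m ∸ 1))
    join-pairMin = join-windows₂ pairMin (λ {x} _ → m≤n⇒m∸n≡0 (m⊓n≤n x 1)) (λ {x} _ → m≤n⇒m∸n≡0 (m⊓n≤m 1 x)) id pairMin-shift

    join-tripleMin : windows₃ tripleMin (join L R) ≡ windows₃ tripleMin L + windows₃ tripleMin R + (suc m * (k ∸ 2) + 1 * (m ∸ 2))
    join-tripleMin = trans
      (join-windows₃ tripleMin 0 (λ {x} {y} _ _ → m≤n⇒m∸n≡0 (m⊓n≤n (x ⊓ y) 1))
        (λ {x} {y} _ _ → m≤n⇒m∸n≡0 (≤-trans (m⊓n≤m (1 ⊓ x) y) (m⊓n≤m 1 x)))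
        (λ {x} {y} _ _ → m≤n⇒m∸n≡0 (≤-trans (m⊓n≤m (x ⊓ 1) y) (m⊓n≤n x 1))) id tripleMin-shift)
      (cong (windows₃ tripleMin L + windows₃ tripleMin R +_) (+-identityʳ _))

    join-valley : windows₃ valley (join L R) ≡ windows₃ valley L + windows₃ valley R + positive k * positive m
    join-valley = trans
      (join-windows₃ valley 1 (λ { {x} {suc (suc y)} _ _ → *-zeroʳ (b2n (suc (suc y) <ᵇ x)) ; {y = suc zero} _ (s≤s ()) }) (λ { {suc (suc x)} _ _ → refl ; {suc zero} (s≤s ()) _ })
        (λ { {suc (suc x)} {suc (suc y)} _ _ → refl ; {suc zero} (s≤s ()) _ ; {suc (suc _)} {suc zero} _ (s≤s ()) }) (λ _ → 0) valley-shift)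
      (cong (windows₃ valley L + windows₃ valley R +_) (*-identityˡ _))

  -- For positive entries with distinct neighbours, bordered by zeros, peaks and interior valleys
  -- alternate, so there is one peak more than valleys. Counting valleys keeps the borders out of
  -- the recursion.
  peaks : List ℕ → ℕ
  peaks []        = 0
  peaks π@(_ ∷ _) = suc (windows₃ valley π)

  peaks-nonempty : ∀ {π} → 1 ≤ length π → peaks π ≡ suc (windows₃ valley π)
  peaks-nonempty {_ ∷ _} _ = refl

  join-nonempty : ∀ L R → 1 ≤ length (join L R)
  join-nonempty []      R = s≤s z≤n
  join-nonempty (_ ∷ _) R = s≤s z≤n

  -- For two nonempty blocks the 1 is a new valley, which accounts for the second `suc` in
  -- `peaks L + peaks R`. For two empty blocks the 1 is itself a peak.
  join-peaks : ∀ k m {L R} → L ∈ Av213 k → R ∈ Av213 m → peaks (join L R) ≡ peaks L + peaks R + 𝟙 k * 𝟙 m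
  join-peaks k m {L} {R} L∈ R∈ = trans (peaks-nonempty (join-nonempty L R))
    (trans (cong suc (join-valley k m L∈ R∈))
      (subst₂ (λ k m → suc (windows₃ valley L + windows₃ valley R + positive k * positive m) ≡ peaks L + peaks R + 𝟙 k * 𝟙 m)
        (∈-Av213-length k L∈) (∈-Av213-length m R∈) (cases L R)))
    where
    rearrange : ∀ a b → suc (a + b + 1) ≡ suc a + suc b + 0
    rearrange = solve-∀
    cases : ∀ L R → suc (windows₃ valley L + windows₃ valley R + positive (length L) * positive (length R))
      ≡ peaks L + peaks R + 𝟙 (length L) * 𝟙 (length R)
    cases []      []      = refl
    cases []      (_ ∷ _) = refl
    cases L@(_ ∷ _) []        = cong suc (cong (_+ 0) refl)
    cases L@(_ ∷ _) R@(_ ∷ _) = rearrange (windows₃ valley L) (windows₃ valley R)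

  -- Bₙ enters as the total number of peaks over Avₙ₊₁(213), which satisfies b = 1 + 2xcb.
  central : Series
  central n = total peaks (suc n)

  total-peaks : total peaks ≈ X ⊛ central
  total-peaks zero    = refl
  total-peaks (suc n) = sym (X⊛-suc central n)

  catalan-𝟙 : ∀ k → catalan k * 𝟙 k ≡ 𝟙 k
  catalan-𝟙 zero    = refl
  catalan-𝟙 (suc k) = *-zeroʳ (catalan (suc k))

  central-eq : central ≈ 𝟙 ⊕ two (catalan ⊛ (X ⊛ central))
  central-eq n = begin
    total peaks (suc n)
      ≡⟨ total-additive peaks peaks (λ k m → 𝟙 k * 𝟙 m) n (λ k m _ → join-peaks k m) ⟩
    two (catalan ⊛ total peaks) n + antidiagonal (λ k m → catalan k * catalan m * (𝟙 k * 𝟙 m)) n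
      ≡⟨ cong₂ (λ u v → (u + u) + v) (⊛-cong {catalan} (λ _ → refl) total-peaks n)
           (trans (antidiagonal-cong (λ k m → trans (rearrange (catalan k) (catalan m) (𝟙 k) (𝟙 m)) (cong₂ _*_ (catalan-𝟙 k) (catalan-𝟙 m))) n)
                  (⊛-identityˡ 𝟙 n)) ⟩
    two (catalan ⊛ (X ⊛ central)) n + 𝟙 n
      ≡⟨ +-comm (two (catalan ⊛ (X ⊛ central)) n) (𝟙 n) ⟩
    𝟙 n + two (catalan ⊛ (X ⊛ central)) n ∎
    where
    open ≡-Reasoning
    rearrange : ∀ a b c d → a * b * (c * d) ≡ (a * c) * (b * d)
    rearrange = solve-∀

  open CatalanSeries catalan central catalan-eq central-eq

  total-suc-X : ∀ f w → total f 0 ≡ 0 → (∀ n → total f (suc n) ≡ two (catalan ⊛ total f) n + w n) →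
    total f ≈ X ⊛ (two (catalan ⊛ total f) ⊕ w)
  total-suc-X f w e₀ e zero    = e₀
  total-suc-X f w e₀ e (suc n) = trans (e n) (sym (X⊛-suc (two (catalan ⊛ total f) ⊕ w) n))

  -- The shift of `L` by m + 1 brings in the factor (m + 1)Cₘ, which is a coefficient of `central`
  -- by `c-b`.
  weights : ∀ (p : ℕ → ℕ) n →
    antidiagonal (λ k m → catalan k * catalan m * (suc m * p k + 1 * p m)) n
      ≡ ((λ k → p k * catalan k) ⊛ central ⊕ catalan ⊛ (λ m → p m * catalan m)) n
  weights p n = trans (antidiagonal-cong pointwise n)
    (antidiagonal-+ (λ k m → p k * catalan k * central m) (λ k m → catalan k * (p m * catalan m)) n)
    where
    rearrange : ∀ a b c d e → a * b * (c * d + 1 * e) ≡ d * a * (c * b) + a * (e * b)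
    rearrange = solve-∀
    pointwise : ∀ k m → catalan k * catalan m * (suc m * p k + 1 * p m) ≡ p k * catalan k * central m + catalan k * (p m * catalan m)
    pointwise k m = trans (rearrange (catalan k) (catalan m) (suc m) (p k) (p m))
      (cong (λ z → p k * catalan k * z + catalan k * (p m * catalan m)) (c-b m))

  total-pairMin : total (windows₂ pairMin) ≈ X ⊛ (two (catalan ⊛ total (windows₂ pairMin)) ⊕ (c-pred ⊛ central ⊕ catalan ⊛ c-pred))
  total-pairMin = total-suc-X (windows₂ pairMin) _ refl λ n → trans
    (total-additive (windows₂ pairMin) (windows₂ pairMin) (λ k m → suc m * (k ∸ 1) + 1 * (m ∸ 1)) n (λ k m _ → join-pairMin k m))
    (cong (two (catalan ⊛ total (windows₂ pairMin)) n +_) (weights (_∸ 1) n))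

  total-tripleMin : total (windows₃ tripleMin) ≈ X ⊛ (two (catalan ⊛ total (windows₃ tripleMin)) ⊕ (c-pred₂ ⊛ central ⊕ catalan ⊛ c-pred₂))
  total-tripleMin = total-suc-X (windows₃ tripleMin) _ refl λ n → trans
    (total-additive (windows₃ tripleMin) (windows₃ tripleMin) (λ k m → suc m * (k ∸ 2) + 1 * (m ∸ 2)) n (λ k m _ → join-tripleMin k m))
    (cong (two (catalan ⊛ total (windows₃ tripleMin)) n +_) (weights (_∸ 2) n))

  -- Besides the peaks, each permutation with 1 as its first or last entry has one further leaf; for
  -- size n + 2 there are Cₙ₊₁ of either kind.
  total-leaves : ∀ f n → (∀ k m → k + m ≡ suc n → ∀ {L R} → L ∈ Av213 k → R ∈ Av213 m →
      f (join L R) ≡ peaks L + peaks R + (𝟙 k + 𝟙 m)) →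
    total f (suc (suc n)) ≡ suc (suc n) * catalan (suc n) + 2 * catalan (suc n)
  total-leaves f n e = begin
    total f (suc (suc n))
      ≡⟨ total-additive f peaks (λ k m → 𝟙 k + 𝟙 m) (suc n) e ⟩
    two (catalan ⊛ total peaks) (suc n) + antidiagonal (λ k m → catalan k * catalan m * (𝟙 k + 𝟙 m)) (suc n)
      -- As `𝟙 (suc n)` is 0, `central-eq` read backwards turns the whole peak part into
      -- `central (suc n)`.
      ≡⟨ cong₂ _+_ (trans (cong (λ z → z + z) (⊛-cong {catalan} (λ _ → refl) total-peaks (suc n))) (sym (central-eq (suc n))))
           (trans (antidiagonal-cong pointwise (suc n)) (antidiagonal-+ (λ k m → 𝟙 k * catalan m) (λ k m → catalan k * 𝟙 m) (suc n))) ⟩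
    central (suc n) + ((𝟙 ⊛ catalan) (suc n) + (catalan ⊛ 𝟙) (suc n))
      ≡⟨ cong₂ (λ u v → u + (v + (catalan ⊛ 𝟙) (suc n))) (sym (c-b (suc n))) (⊛-identityˡ catalan (suc n)) ⟩
    suc (suc n) * catalan (suc n) + (catalan (suc n) + (catalan ⊛ 𝟙) (suc n))
      ≡⟨ cong (λ v → suc (suc n) * catalan (suc n) + (catalan (suc n) + v))
           (trans (⊛-comm catalan 𝟙 (suc n)) (trans (⊛-identityˡ catalan (suc n)) (sym (+-identityʳ _)))) ⟩
    suc (suc n) * catalan (suc n) + 2 * catalan (suc n) ∎
    where
    open ≡-Reasoning
    rearrange : ∀ a b c d → a * b * (c + d) ≡ (a * c) * b + a * (b * d)
    rearrange = solve-∀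
    pointwise : ∀ k m → catalan k * catalan m * (𝟙 k + 𝟙 m) ≡ 𝟙 k * catalan m + catalan k * 𝟙 m
    pointwise k m = trans (rearrange (catalan k) (catalan m) (𝟙 k) (𝟙 m))
      (cong₂ _+_ (cong (_* catalan m) (catalan-𝟙 k)) (cong (catalan k *_) (catalan-𝟙 m)))

-- Degrees in the grid graph, column by column.

module Degrees where

  open FormalSeries using (𝟙; +-interchange)
  open Permutations
  open Statistics
  open import Data.Bool using (true; false; not)
  open import Data.Bool.Properties using (T-≡)
  open import Data.Empty using (⊥-elim)
  open import Data.List using (List; []; _∷_; _++_; [_]; length; map; upTo; applyUpTo)
  open import Data.List.Membership.Propositional using (_∈_)
  open import Data.List.Properties using (length-map; map-applyUpTo; map-++; map-∘; map-cong; map-id)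
  open import Data.List.Relation.Binary.Permutation.Propositional using (_↭_; ↭-sym)
  open import Data.List.Relation.Binary.Permutation.Propositional.Properties using () renaming (map⁺ to ↭-map⁺)
  open import Data.List.Relation.Unary.All using (All; []; _∷_)
  open import Data.List.Relation.Unary.AllPairs using ([]; _∷_)
  open import Data.List.Relation.Unary.Unique.Propositional using (Unique)
  open import Data.Nat
  open import Data.Nat.Properties
  open import Data.Product using (_×_; _,_; proj₁; proj₂)
  open import Function using (_∘_; id)
  open import Function.Bundles using (Equivalence)
  open import Relation.Binary.Definitions using (tri<; tri≈; tri>)
  open import Relation.Binary.PropositionalEquality using (_≡_; _≢_; refl; sym; trans; cong; cong₂; subst; module ≡-Reasoning)
  open import Relation.Nullary using (¬_; Dec; yes; no)
  open import Data.Nat.ListAction using (sum)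
  open import Data.Nat.ListAction.Properties using (sum-++; sum-↭)
  open import Data.Nat.Tactic.RingSolver using (solve-∀)
  open import Data.Unit using (⊤; tt)

  -- a, h, b are the heights of a column and of its left and right neighbours (0 outside the diagram).
  degree : ℕ → ℕ → ℕ → ℕ → ℕ
  degree a h b j = b2n (2 ≤ᵇ j) + b2n (suc j ≤ᵇ h) + b2n (j ≤ᵇ a) + b2n (j ≤ᵇ b)

  column : ℕ → ℕ → ℕ → ℕ → ℕ
  column r a h b = sum (map (λ j → b2n (degree a h b j ≡ᵇ r)) (range1 h))

  head₀ : List ℕ → ℕ
  head₀ []      = 0
  head₀ (x ∷ _) = x

  columnSum : (ℕ → ℕ → ℕ → ℕ) → ℕ → List ℕ → ℕ
  columnSum g a []       = 0
  columnSum g a (x ∷ π) = g a x (head₀ π) + columnSum g x π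

  height-columns : ∀ g a π →
    sum (map (λ i → g (height (a ∷ π) (suc i)) (height π (suc i)) (height π (suc (suc i)))) (upTo (length π))) ≡ columnSum g a π
  height-columns g a []      = refl
  height-columns g a (x ∷ π) = cong₂ _+_ (cong (g a x) (head-height π)) (begin
    sum (map (λ i → g (height (a ∷ x ∷ π) (suc i)) (height (x ∷ π) (suc i)) (height (x ∷ π) (suc (suc i)))) (applyUpTo suc (length π)))
      ≡⟨ cong sum (trans (cong (map _) (sym (map-applyUpTo id suc (length π)))) (sym (map-∘ (upTo (length π))))) ⟩
    sum (map (λ i → g (height (x ∷ π) (suc i)) (height π (suc i)) (height π (suc (suc i)))) (upTo (length π)))
      ≡⟨ height-columns g x π ⟩
    columnSum g x π ∎)
    where
    open ≡-Reasoning
    head-height : ∀ π → height π 1 ≡ head₀ π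
    head-height []      = refl
    head-height (_ ∷ _) = refl

  countDeg-columns : ∀ r π → countDeg (length π) r π ≡ columnSum (column r) 0 π
  countDeg-columns r π = trans
    (cong sum (trans (sym (map-∘ (upTo (length π)))) (map-cong left-neighbour (upTo (length π)))))
    (height-columns (column r) 0 π)
    where
    left-neighbour : ∀ i → column r (height π i) (height π (suc i)) (height π (suc (suc i)))
      ≡ column r (height (0 ∷ π) (suc i)) (height π (suc i)) (height π (suc (suc i)))
    left-neighbour zero    = refl
    left-neighbour (suc i) = refl

  -- The last condition says that the column has a neighbour at all; it excludes degree 0 and holds
  -- once there are at least two columns.
  Column : ℕ → ℕ → ℕ → Set
  Column a h b = 1 ≤ h × a ≢ h × h ≢ b × 1 ≤ a + b

  Columns : ℕ → List ℕ → Set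
  Columns a []      = ⊤
  Columns a (x ∷ π) = Column a x (head₀ π) × Columns x π

  columns-right : ∀ {a π} → 1 ≤ a → All (1 ≤_) π → Unique (a ∷ π) → Columns a π
  columns-right 1≤a []       _ = tt
  columns-right {a} 1≤a (p ∷ []) ((a≢x ∷ _) ∷ _) = (p , a≢x , (λ { refl → n≮0 p }) , ≤-trans 1≤a (m≤m+n a 0)) , tt
  columns-right {a} {x ∷ y ∷ π} 1≤a (p ∷ q ∷ ps) ((a≢x ∷ _) ∷ u@((x≢y ∷ _) ∷ _)) =
    (p , a≢x , x≢y , ≤-trans 1≤a (m≤m+n a y)) , columns-right p (q ∷ ps) u

  columns : ∀ {π} → 2 ≤ length π → All (1 ≤_) π → Unique π → Columns 0 π
  columns {x ∷ []}    (s≤s ()) _ _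
  columns {x ∷ y ∷ π} _ (p ∷ q ∷ ps) u@((x≢y ∷ _) ∷ _) =
    (p , (λ { refl → n≮0 p }) , x≢y , q) , columns-right p (q ∷ ps) u

  columnSum-cong : ∀ {g g′} → (∀ {a h b} → Column a h b → g a h b ≡ g′ a h b) →
    ∀ {a} π → Columns a π → columnSum g a π ≡ columnSum g′ a π
  columnSum-cong e []      _        = refl
  columnSum-cong e (x ∷ π) (c , cs) = cong₂ _+_ (e c) (columnSum-cong e π cs)

  columnSum-+ : ∀ (g g′ : ℕ → ℕ → ℕ → ℕ) a π → columnSum (λ a h b → g a h b + g′ a h b) a π ≡ columnSum g a π + columnSum g′ a π
  columnSum-+ g g′ a []      = refl
  columnSum-+ g g′ a (x ∷ π) = trans (cong (g a x (head₀ π) + g′ a x (head₀ π) +_) (columnSum-+ g g′ x π))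
    (+-interchange (g a x (head₀ π)) _ _ _)

  columnSum-* : ∀ c (g : ℕ → ℕ → ℕ → ℕ) a π → columnSum (λ a h b → c * g a h b) a π ≡ c * columnSum g a π
  columnSum-* c g a []      = sym (*-zeroʳ c)
  columnSum-* c g a (x ∷ π) = trans (cong (c * g a x (head₀ π) +_) (columnSum-* c g x π)) (sym (*-distribˡ-+ c _ _))

  columnSum-height : ∀ (φ : ℕ → ℕ) a π → columnSum (λ _ h _ → φ h) a π ≡ sum (map φ π)
  columnSum-height φ a []      = refl
  columnSum-height φ a (x ∷ π) = cong (φ x +_) (columnSum-height φ x π)

  columnSum-left : ∀ φ a π → columnSum (λ a h _ → φ a h) a π ≡ windows₂ φ (a ∷ π)
  columnSum-left φ a []      = refl
  columnSum-left φ a (x ∷ π) = cong (φ a x +_) (columnSum-left φ x π)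

  columnSum-right : ∀ φ → (∀ h → φ h 0 ≡ 0) → ∀ a π → columnSum (λ _ h b → φ h b) a π ≡ windows₂ φ π
  columnSum-right φ e a []          = refl
  columnSum-right φ e a (x ∷ [])    = cong (_+ 0) (e x)
  columnSum-right φ e a (x ∷ y ∷ π) = cong (φ x y +_) (columnSum-right φ e x (y ∷ π))

  columnSum-windows₃ : ∀ t → (∀ a h → t a h 0 ≡ 0) → ∀ a π → columnSum t a π ≡ windows₃ t (a ∷ π)
  columnSum-windows₃ t e a []          = refl
  columnSum-windows₃ t e a (x ∷ [])    = cong (_+ 0) (e a x)
  columnSum-windows₃ t e a (x ∷ y ∷ π) = cong (t a x y +_) (columnSum-windows₃ t e x (y ∷ π))

  windows₃-0∷ : ∀ t → (∀ h b → t 0 h b ≡ 0) → ∀ π → windows₃ t (0 ∷ π) ≡ windows₃ t π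
  windows₃-0∷ t e []          = refl
  windows₃-0∷ t e (x ∷ [])    = refl
  windows₃-0∷ t e (x ∷ y ∷ π) = cong (_+ windows₃ t (x ∷ y ∷ π)) (e x y)

  ascent : ℕ → ℕ → ℕ
  ascent x y = b2n (x <ᵇ y)

  -- The step from the left border 0 into the first column is an ascent, while the step down to the
  -- right border is none; hence the difference of 1 between the two ascent sums.
  ascents-0∷ : ∀ {π} → 1 ≤ length π → All (1 ≤_) π → windows₂ ascent (0 ∷ π) ≡ suc (windows₂ ascent π)
  ascents-0∷ {suc x ∷ π} _ _ = refl
  ascents-0∷ {zero ∷ π}  _ (() ∷ _)

  -- Counting the vertices of each degree within one column.

  range1-last : ∀ h → range1 (suc h) ≡ range1 h ++ [ suc h ]
  range1-last h = trans (cong range1 (+-comm 1 h)) (trans (range1-+ h 1) (cong (λ x → range1 h ++ [ x ]) (+-comm h 1)))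

  sum-range1-suc : ∀ (f : ℕ → ℕ) h → sum (map f (range1 (suc h))) ≡ sum (map f (range1 h)) + f (suc h)
  sum-range1-suc f h = trans (cong (sum ∘ map f) (range1-last h))
    (trans (cong sum (map-++ f (range1 h) [ suc h ]))
      (trans (sum-++ (map f (range1 h)) _) (cong (sum (map f (range1 h)) +_) (+-identityʳ _))))

  ≤ᵇ-true : ∀ {m n} → m ≤ n → (m ≤ᵇ n) ≡ true
  ≤ᵇ-true m≤n = Equivalence.to T-≡ (≤⇒≤ᵇ m≤n)

  ≤ᵇ-false : ∀ {m n} → ¬ m ≤ n → (m ≤ᵇ n) ≡ false
  ≤ᵇ-false {m} {n} m≰n with m ≤ᵇ n in e
  ... | true  = ⊥-elim (m≰n (≤ᵇ⇒≤ m n (Equivalence.from T-≡ e)))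
  ... | false = refl

  count-≤ : ∀ a h → sum (map (λ j → b2n (j ≤ᵇ a)) (range1 h)) ≡ h ⊓ a
  count-≤ a zero    = refl
  count-≤ a (suc h) = trans (sum-range1-suc (λ j → b2n (j ≤ᵇ a)) h) (trans (cong (_+ b2n (suc h ≤ᵇ a)) (count-≤ a h)) (step (suc h ≤? a)))
    where
    step : Dec (suc h ≤ a) → h ⊓ a + b2n (suc h ≤ᵇ a) ≡ suc h ⊓ a
    step (yes h<a) = trans (cong₂ (λ u v → u + b2n v) (m≤n⇒m⊓n≡m (<⇒≤ h<a)) (≤ᵇ-true h<a)) (trans (+-comm h 1) (sym (m≤n⇒m⊓n≡m h<a)))
    step (no h≮a)  = trans (cong₂ (λ u v → u + b2n v) (m≥n⇒m⊓n≡n (≮⇒≥ h≮a)) (≤ᵇ-false h≮a))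
      (trans (+-identityʳ a) (sym (m≥n⇒m⊓n≡n (m≤n⇒m≤1+n (≮⇒≥ h≮a)))))

  count-2≤ : ∀ h → sum (map (λ j → b2n (2 ≤ᵇ j)) (range1 h)) ≡ h ∸ 1
  count-2≤ zero          = refl
  count-2≤ (suc zero)    = refl
  count-2≤ (suc (suc h)) = trans (sum-range1-suc (λ j → b2n (2 ≤ᵇ j)) (suc h)) (trans (cong (_+ 1) (count-2≤ (suc h))) (+-comm h 1))

  count-2≤-≤ : ∀ c h → sum (map (λ j → b2n (2 ≤ᵇ j) * b2n (j ≤ᵇ c)) (range1 h)) ≡ (h ⊓ c) ∸ 1
  count-2≤-≤ c zero          = refl
  count-2≤-≤ c (suc zero)    = sym (m≤n⇒m∸n≡0 (m⊓n≤m 1 c))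
  count-2≤-≤ c (suc (suc h)) = trans (sum-range1-suc (λ j → b2n (2 ≤ᵇ j) * b2n (j ≤ᵇ c)) (suc h))
    (trans (cong₂ _+_ (count-2≤-≤ c (suc h)) (*-identityˡ (b2n (suc (suc h) ≤ᵇ c)))) (step (suc (suc h) ≤? c)))
    where
    step : Dec (suc (suc h) ≤ c) → (suc h ⊓ c) ∸ 1 + b2n (suc (suc h) ≤ᵇ c) ≡ (suc (suc h) ⊓ c) ∸ 1
    step (yes p) = trans (cong₂ (λ u v → u ∸ 1 + b2n v) (m≤n⇒m⊓n≡m (<⇒≤ p)) (≤ᵇ-true p))
      (trans (+-comm h 1) (cong (_∸ 1) (sym (m≤n⇒m⊓n≡m p))))
    step (no ¬p) = trans (cong₂ (λ u v → u ∸ 1 + b2n v) (m≥n⇒m⊓n≡n (≮⇒≥ ¬p)) (≤ᵇ-false ¬p))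
      (trans (+-identityʳ (c ∸ 1)) (cong (_∸ 1) (sym (m≥n⇒m⊓n≡n (m≤n⇒m≤1+n (≮⇒≥ ¬p))))))

  b2n≤1 : ∀ p → b2n p ≤ 1
  b2n≤1 true  = s≤s z≤n
  b2n≤1 false = z≤n

  degree≤4 : ∀ a h b j → degree a h b j ≤ 4
  degree≤4 a h b j = +-mono-≤ (+-mono-≤ (+-mono-≤ (b2n≤1 (2 ≤ᵇ j)) (b2n≤1 (suc j ≤ᵇ h))) (b2n≤1 (j ≤ᵇ a))) (b2n≤1 (j ≤ᵇ b))

  degree≥1 : ∀ a h b {j} → 1 ≤ a + b → 1 ≤ j → j ≤ h → 1 ≤ degree a h b j
  degree≥1 a       h             b       {suc (suc j)} _ _ _         = s≤s z≤n
  degree≥1 a       (suc (suc h)) b       {suc zero}    _ _ _         = s≤s z≤n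
  degree≥1 (suc a) (suc zero)    b       {suc zero}    _ _ _         = s≤s z≤n
  degree≥1 zero    (suc zero)    (suc b) {suc zero}    _ _ _         = s≤s z≤n

  indicators : ∀ d → 1 ≤ d → d ≤ 4 → b2n (d ≡ᵇ 1) + b2n (d ≡ᵇ 2) + b2n (d ≡ᵇ 3) + b2n (d ≡ᵇ 4) ≡ 1
  indicators 1 _ _ = refl
  indicators 2 _ _ = refl
  indicators 3 _ _ = refl
  indicators 4 _ _ = refl
  indicators (suc (suc (suc (suc (suc _))))) _ (s≤s (s≤s (s≤s (s≤s ()))))

  weighted-indicators : ∀ d → d ≤ 4 → b2n (d ≡ᵇ 1) + 2 * b2n (d ≡ᵇ 2) + 3 * b2n (d ≡ᵇ 3) + 4 * b2n (d ≡ᵇ 4) ≡ d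
  weighted-indicators 0 _ = refl
  weighted-indicators 1 _ = refl
  weighted-indicators 2 _ = refl
  weighted-indicators 3 _ = refl
  weighted-indicators 4 _ = refl
  weighted-indicators (suc (suc (suc (suc (suc _))))) (s≤s (s≤s (s≤s (s≤s ()))))

  sum-map-+₄ : ∀ {a} {A : Set a} (f₁ f₂ f₃ f₄ : A → ℕ) xs → sum (map (λ j → f₁ j + f₂ j + f₃ j + f₄ j) xs) ≡
    sum (map f₁ xs) + sum (map f₂ xs) + sum (map f₃ xs) + sum (map f₄ xs)
  sum-map-+₄ f₁ f₂ f₃ f₄ xs = trans (sum-map-+ (λ j → f₁ j + f₂ j + f₃ j) f₄ xs)
    (cong (_+ sum (map f₄ xs)) (trans (sum-map-+ (λ j → f₁ j + f₂ j) f₃ xs)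
      (cong (_+ sum (map f₃ xs)) (sum-map-+ f₁ f₂ xs))))

  column-size : ∀ {a h b} → Column a h b → column 1 a h b + column 2 a h b + column 3 a h b + column 4 a h b ≡ h
  column-size {a} {h} {b} (_ , _ , _ , nz) = begin
    column 1 a h b + column 2 a h b + column 3 a h b + column 4 a h b
      ≡⟨ sym (sum-map-+₄ (λ j → b2n (degree a h b j ≡ᵇ 1)) (λ j → b2n (degree a h b j ≡ᵇ 2)) (λ j → b2n (degree a h b j ≡ᵇ 3)) (λ j → b2n (degree a h b j ≡ᵇ 4)) (range1 h)) ⟩
    sum (map (λ j → b2n (degree a h b j ≡ᵇ 1) + b2n (degree a h b j ≡ᵇ 2) + b2n (degree a h b j ≡ᵇ 3) + b2n (degree a h b j ≡ᵇ 4)) (range1 h))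
      ≡⟨ sum-map-cong (range1 h) (λ {j} j∈ → indicators (degree a h b j)
           (degree≥1 a h b nz (proj₁ (∈-range1⁻ h j∈)) (proj₂ (∈-range1⁻ h j∈))) (degree≤4 a h b j)) ⟩
    sum (map (λ _ → 1) (range1 h))
      ≡⟨ trans (sum-map-const 1 (range1 h)) (trans (*-identityʳ _) (length-range1 h)) ⟩
    h ∎
    where open ≡-Reasoning

  above-≤ᵇ : ∀ {j h} → 1 ≤ j → (suc j ≤ᵇ h) ≡ (j ≤ᵇ h ∸ 1)
  above-≤ᵇ {suc j} {zero}  _ = refl
  above-≤ᵇ {suc j} {suc h} _ = refl

  -- The h - 1 vertical edges count at both ends, which gives 2h - 2, with the 2 moved to the left.
  -- There are min(a, h) and min(h, b) horizontal edges to the two neighbours.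
  column-degrees : ∀ {a h b} → Column a h b →
    column 1 a h b + 2 * column 2 a h b + 3 * column 3 a h b + 4 * column 4 a h b + 2 ≡ 2 * h + (a ⊓ h + h ⊓ b)
  column-degrees {a} {h} {b} (1≤h , _) = begin
    column 1 a h b + 2 * column 2 a h b + 3 * column 3 a h b + 4 * column 4 a h b + 2
      ≡⟨ cong (_+ 2) (sym (trans
           (sum-map-+₄ (I 1) (λ j → 2 * I 2 j) (λ j → 3 * I 3 j) (λ j → 4 * I 4 j) (range1 h))
           (cong₂ _+_ (cong₂ _+_ (cong (column 1 a h b +_) (sum-map-* 2 (I 2) (range1 h))) (sum-map-* 3 (I 3) (range1 h))) (sum-map-* 4 (I 4) (range1 h))))) ⟩
    sum (map (λ j → I 1 j + 2 * I 2 j + 3 * I 3 j + 4 * I 4 j) (range1 h)) + 2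
      ≡⟨ cong (_+ 2) (sum-map-cong (range1 h) (λ {j} _ → weighted-indicators (degree a h b j) (degree≤4 a h b j))) ⟩
    sum (map (degree a h b) (range1 h)) + 2
      ≡⟨ cong (_+ 2) (sum-map-+₄ (λ j → b2n (2 ≤ᵇ j)) (λ j → b2n (suc j ≤ᵇ h)) (λ j → b2n (j ≤ᵇ a)) (λ j → b2n (j ≤ᵇ b)) (range1 h)) ⟩
    sum (map (λ j → b2n (2 ≤ᵇ j)) (range1 h)) + sum (map (λ j → b2n (suc j ≤ᵇ h)) (range1 h))
      + sum (map (λ j → b2n (j ≤ᵇ a)) (range1 h)) + sum (map (λ j → b2n (j ≤ᵇ b)) (range1 h)) + 2
      ≡⟨ cong (_+ 2) (cong₂ _+_ (cong₂ _+_ (cong₂ _+_ (count-2≤ h) up) (count-≤ a h)) (count-≤ b h)) ⟩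
    (h ∸ 1) + (h ∸ 1) + h ⊓ a + h ⊓ b + 2
      ≡⟨ cong (λ z → (h ∸ 1) + (h ∸ 1) + z + h ⊓ b + 2) (⊓-comm h a) ⟩
    (h ∸ 1) + (h ∸ 1) + a ⊓ h + h ⊓ b + 2
      ≡⟨ rearrange (h ∸ 1) (a ⊓ h) (h ⊓ b) ⟩
    2 * (1 + (h ∸ 1)) + (a ⊓ h + h ⊓ b)
      ≡⟨ cong (λ z → 2 * z + (a ⊓ h + h ⊓ b)) (m+[n∸m]≡n 1≤h) ⟩
    2 * h + (a ⊓ h + h ⊓ b) ∎
    where
    open ≡-Reasoning
    I : ℕ → ℕ → ℕ
    I r j = b2n (degree a h b j ≡ᵇ r)
    up : sum (map (λ j → b2n (suc j ≤ᵇ h)) (range1 h)) ≡ h ∸ 1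
    up = trans (sum-map-cong (range1 h) (λ j∈ → cong b2n (above-≤ᵇ {h = h} (proj₁ (∈-range1⁻ h j∈)))))
      (trans (count-≤ (h ∸ 1) h) (m≥n⇒m⊓n≡n (m∸n≤m h 1)))
    rearrange : ∀ x y z → x + x + y + z + 2 ≡ 2 * (1 + x) + (y + z)
    rearrange = solve-∀

  all-four : ∀ p q r s → b2n (b2n p + b2n q + b2n r + b2n s ≡ᵇ 4) ≡ b2n p * (b2n q * b2n r * b2n s)
  all-four true  true  true  true  = refl
  all-four true  true  true  false = refl
  all-four true  true  false true  = refl
  all-four true  true  false false = refl
  all-four true  false true  true  = refl
  all-four true  false true  false = refl
  all-four true  false false true  = refl
  all-four true  false false false = refl
  all-four false true  true  true  = refl
  all-four false true  true  false = refl
  all-four false true  false true  = refl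
  all-four false true  false false = refl
  all-four false false true  true  = refl
  all-four false false true  false = refl
  all-four false false false true  = refl
  all-four false false false false = refl

  b2n-⊓ : ∀ j x y → b2n (j ≤ᵇ x) * b2n (j ≤ᵇ y) ≡ b2n (j ≤ᵇ x ⊓ y)
  b2n-⊓ j x y with j ≤? x | j ≤? y
  ... | yes p | yes q rewrite ≤ᵇ-true p | ≤ᵇ-true q | ≤ᵇ-true (⊓-glb p q) = refl
  ... | yes p | no ¬q rewrite ≤ᵇ-true p | ≤ᵇ-false ¬q | ≤ᵇ-false {j} {x ⊓ y} (λ r → ¬q (≤-trans r (m⊓n≤n x y))) = refl
  ... | no ¬p | _ rewrite ≤ᵇ-false ¬p | ≤ᵇ-false {j} {x ⊓ y} (λ r → ¬p (≤-trans r (m⊓n≤m x y))) = refl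

  -- All four neighbours exist exactly for 2 ≤ j ≤ min(h - 1, a, b).
  column-4 : ∀ a h b → column 4 a h b ≡ ((h ∸ 1) ⊓ a ⊓ b) ∸ 1
  column-4 a h b = trans (sum-map-cong (range1 h) pointwise) (trans (count-2≤-≤ ((h ∸ 1) ⊓ a ⊓ b) h)
    (cong (_∸ 1) (m≥n⇒m⊓n≡n (≤-trans (m⊓n≤m ((h ∸ 1) ⊓ a) b) (≤-trans (m⊓n≤m (h ∸ 1) a) (m∸n≤m h 1))))))
    where
    pointwise : ∀ {j} → j ∈ range1 h → b2n (degree a h b j ≡ᵇ 4) ≡ b2n (2 ≤ᵇ j) * b2n (j ≤ᵇ (h ∸ 1) ⊓ a ⊓ b)
    pointwise {j} j∈ = trans (all-four (2 ≤ᵇ j) (suc j ≤ᵇ h) (j ≤ᵇ a) (j ≤ᵇ b)) (cong (b2n (2 ≤ᵇ j) *_)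
      (trans (cong (λ z → b2n z * b2n (j ≤ᵇ a) * b2n (j ≤ᵇ b)) (above-≤ᵇ {j} {h} (proj₁ (∈-range1⁻ h j∈))))
        (trans (cong (_* b2n (j ≤ᵇ b)) (b2n-⊓ j (h ∸ 1) a)) (b2n-⊓ j ((h ∸ 1) ⊓ a) b))))

  peak : ℕ → ℕ → ℕ → ℕ
  peak a h b = ascent a h * ascent b h

  -- Within a `Column` this detects the entry 1 at the left or right end: its single vertex has the
  -- other neighbour only.
  corner : ℕ → ℕ → ℕ → ℕ
  corner a h b = b2n (h ≡ᵇ 1) * (b2n (a ≡ᵇ 0) + b2n (b ≡ᵇ 0))

  ascent-≤ᵇ : ∀ a h → ascent a (suc h) ≡ b2n (not (suc h ≤ᵇ a))
  ascent-≤ᵇ zero    h       = refl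
  ascent-≤ᵇ (suc a) zero    = refl
  ascent-≤ᵇ (suc a) (suc h) = ascent-≤ᵇ a h

  -- For h ≥ 2 only the top vertex can have degree 1, namely when both neighbours are lower: inner
  -- vertices have two vertical neighbours, and the bottom one has the vertex above it and, by
  -- `1 ≤ a + b`, a horizontal neighbour. Height 1 is the case of `corner`.
  column-1 : ∀ {a h b} → Column a h b → column 1 a h b ≡ peak a h b + corner a h b
  column-1 {suc (suc _)} {1} {suc (suc _)} _ = refl
  column-1 {zero}        {1} {suc (suc _)} _ = refl
  column-1 {suc (suc _)} {1} {zero}        _ = refl
  column-1 {zero}        {1} {zero}        (_ , _ , _ , ())
  column-1 {suc zero}    {1} (_ , a≢h , _) = ⊥-elim (a≢h refl)
  column-1 {_}           {1} {suc zero}    (_ , _ , h≢b , _) = ⊥-elim (h≢b refl)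
  column-1 {a} {h@(suc h′@(suc _))} {b} (_ , _ , _ , nz) = begin
    column 1 a h b
      ≡⟨ sum-range1-suc (λ j → b2n (degree a h b j ≡ᵇ 1)) h′ ⟩
    sum (map (λ j → b2n (degree a h b j ≡ᵇ 1)) (range1 h′)) + b2n (degree a h b h ≡ᵇ 1)
      ≡⟨ cong₂ _+_ (trans (sum-map-cong (range1 h′) (λ j∈ → below a b nz (proj₁ (∈-range1⁻ h′ j∈)) (proj₂ (∈-range1⁻ h′ j∈))))
                     (trans (sum-map-const 0 (range1 h′)) (*-zeroʳ (length (range1 h′)))))
                   (trans (cong (λ z → b2n (1 + b2n z + b2n (h ≤ᵇ a) + b2n (h ≤ᵇ b) ≡ᵇ 1)) (≤ᵇ-false (<-irrefl {h} refl)))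
                     (top (h ≤ᵇ a) (h ≤ᵇ b))) ⟩
    b2n (not (h ≤ᵇ a)) * b2n (not (h ≤ᵇ b))
      ≡⟨ sym (cong₂ _*_ (ascent-≤ᵇ a h′) (ascent-≤ᵇ b h′)) ⟩
    peak a h b
      ≡⟨ sym (+-identityʳ _) ⟩
    peak a h b + corner a h b ∎
    where
    open ≡-Reasoning
    top : ∀ p q → b2n (1 + 0 + b2n p + b2n q ≡ᵇ 1) ≡ b2n (not p) * b2n (not q)
    top true  true  = refl
    top true  false = refl
    top false true  = refl
    top false false = refl
    below : ∀ a b {j} → 1 ≤ a + b → 1 ≤ j → j ≤ h′ → b2n (degree a h b j ≡ᵇ 1) ≡ 0
    below a b {j@(suc (suc _))} _ _ j≤ =
      cong (λ z → b2n (1 + b2n z + b2n (j ≤ᵇ a) + b2n (j ≤ᵇ b) ≡ᵇ 1)) (≤ᵇ-true (s≤s j≤))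
    below (suc a) b       {suc zero} _ _ _ = refl
    below zero    (suc b) {suc zero} _ _ _ = refl

  ascent-true : ∀ {x y} → x < y → ascent x y ≡ 1
  ascent-true {x} {suc y} (s≤s x≤y) = cong b2n (≤ᵇ-true (s≤s x≤y))

  ascent-false : ∀ {x y} → y ≤ x → ascent x y ≡ 0
  ascent-false {x} {zero}  _   = refl
  ascent-false {x} {suc y} y<x = cong b2n (≤ᵇ-false (<⇒≱ (s≤s y<x)))

  -- A peak has an ascent before it and none after it, a valley the reverse, and otherwise the two
  -- ascent indicators agree. Summed over the columns this telescopes to one peak more than valleys.
  peak-valley : ∀ {a h b} → Column a h b → peak a h b + ascent h b ≡ valley a h b + ascent a h
  peak-valley {a} {h} {b} (_ , a≢h , h≢b , _) with <-cmp a h | <-cmp b h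
  ... | tri≈ _ a≡h _ | _ = ⊥-elim (a≢h a≡h)
  ... | _ | tri≈ _ b≡h _ = ⊥-elim (h≢b (sym b≡h))
  ... | tri< a<h _ _ | tri< b<h _ _
    rewrite ascent-true a<h | ascent-true b<h | ascent-false (<⇒≤ a<h) | ascent-false (<⇒≤ b<h) = refl
  ... | tri< a<h _ _ | tri> _ _ h<b
    rewrite ascent-true a<h | ascent-true h<b | ascent-false (<⇒≤ a<h) | ascent-false (<⇒≤ h<b) = refl
  ... | tri> _ _ h<a | tri< b<h _ _
    rewrite ascent-true h<a | ascent-true b<h | ascent-false (<⇒≤ h<a) | ascent-false (<⇒≤ b<h) = refl
  ... | tri> _ _ h<a | tri> _ _ h<b
    rewrite ascent-true h<a | ascent-true h<b | ascent-false (<⇒≤ h<a) = refl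

  -- Summed over the columns, the two ascent terms differ by 1 and h = 1 occurs once, which gives
  -- #(deg 4) + #(deg 1) = Σ (min of three consecutive entries − 1) + 2.
  column-4+1 : ∀ {a h b} → Column a h b →
    column 4 a h b + column 1 a h b + ascent h b ≡ tripleMin a h b + ascent a h + b2n (h ≡ᵇ 1)
  column-4+1 {a} {h} {b} c = trans (cong₂ (λ u v → u + v + ascent h b) (column-4 a h b) (column-1 c)) (cases a h b c)
    where
    cases : ∀ a h b → Column a h b → ((h ∸ 1) ⊓ a ⊓ b) ∸ 1 + (peak a h b + corner a h b) + ascent h b
      ≡ tripleMin a h b + ascent a h + b2n (h ≡ᵇ 1)
    cases (suc (suc _)) 1 (suc (suc _)) _ = refl
    cases zero          1 (suc (suc _)) _ = refl
    cases (suc (suc _)) 1 zero          _ = refl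
    cases zero          1 zero          (_ , _ , _ , ())
    cases (suc zero)    1 _             (_ , a≢h , _) = ⊥-elim (a≢h refl)
    cases _             1 (suc zero)    (_ , _ , h≢b , _) = ⊥-elim (h≢b refl)
    cases a h@(suc (suc h″)) b (_ , a≢h , h≢b , _) with <-cmp a h | <-cmp b h
    ... | tri≈ _ a≡h _ | _ = ⊥-elim (a≢h a≡h)
    ... | _ | tri≈ _ b≡h _ = ⊥-elim (h≢b (sym b≡h))
    ... | tri< a<h _ _ | tri< b<h _ _
      rewrite ascent-true a<h | ascent-true b<h | ascent-false (<⇒≤ b<h)
            | m≥n⇒m⊓n≡n (s≤s⁻¹ a<h) | m≤n⇒m⊓n≡m (<⇒≤ a<h) = refl
    ... | tri< a<h _ _ | tri> _ _ h<b
      rewrite ascent-true a<h | ascent-true h<b | ascent-false (<⇒≤ h<b)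
            | m≥n⇒m⊓n≡n (s≤s⁻¹ a<h) | m≤n⇒m⊓n≡m (<⇒≤ a<h) = trans (+-assoc (a ⊓ b ∸ 1) 0 1) (sym (+-assoc (a ⊓ b ∸ 1) 1 0))
    ... | tri> _ _ h<a | tri< b<h _ _
      rewrite ascent-false (<⇒≤ h<a) | ascent-false (<⇒≤ b<h)
            | m≤n⇒m⊓n≡m {suc h″} {a} (<⇒≤ (<⇒≤ h<a)) | m≥n⇒m⊓n≡n {a} {suc (suc h″)} (<⇒≤ h<a)
            | m≥n⇒m⊓n≡n (s≤s⁻¹ b<h) | m≥n⇒m⊓n≡n (<⇒≤ b<h) = refl
    -- Here h is the least of the three heights, the one case in which `h ∸ 1` bounds the degree-4
    -- vertices; the vertex lost is made up by the ascent on the right.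
    ... | tri> _ _ h<a | tri> _ _ h<b
      rewrite ascent-false (<⇒≤ h<a) | ascent-true h<b
            | m≤n⇒m⊓n≡m {suc h″} {a} (<⇒≤ (<⇒≤ h<a)) | m≥n⇒m⊓n≡n {a} {suc (suc h″)} (<⇒≤ h<a)
            | m≤n⇒m⊓n≡m {suc h″} {b} (<⇒≤ (<⇒≤ h<b)) | m≤n⇒m⊓n≡m (<⇒≤ h<b) = rearrange h″
      where
      rearrange : ∀ x → x + 0 + 1 ≡ suc x + 0 + 0
      rearrange = solve-∀

  columnSum-peak : ∀ {π} → 1 ≤ length π → All (1 ≤_) π → Columns 0 π → columnSum peak 0 π ≡ peaks π
  columnSum-peak {π} ne ps cs = +-cancelʳ-≡ (windows₂ ascent π) _ _ (begin
    columnSum peak 0 π + windows₂ ascent π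
      ≡⟨ cong (columnSum peak 0 π +_) (sym (columnSum-right ascent (λ _ → refl) 0 π)) ⟩
    columnSum peak 0 π + columnSum (λ _ h b → ascent h b) 0 π
      ≡⟨ sym (columnSum-+ peak (λ _ h b → ascent h b) 0 π) ⟩
    columnSum (λ a h b → peak a h b + ascent h b) 0 π
      ≡⟨ columnSum-cong peak-valley π cs ⟩
    columnSum (λ a h b → valley a h b + ascent a h) 0 π
      ≡⟨ columnSum-+ valley (λ a h _ → ascent a h) 0 π ⟩
    columnSum valley 0 π + columnSum (λ a h _ → ascent a h) 0 π
      ≡⟨ cong₂ _+_ (trans (columnSum-windows₃ valley (λ a h → *-zeroʳ (b2n (h <ᵇ a))) 0 π) (windows₃-0∷ valley (λ _ _ → refl) π))
                   (trans (columnSum-left ascent 0 π) (ascents-0∷ ne ps)) ⟩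
    windows₃ valley π + suc (windows₂ ascent π)
      ≡⟨ +-suc _ _ ⟩
    suc (windows₃ valley π) + windows₂ ascent π
      ≡⟨ cong (_+ windows₂ ascent π) (sym (peaks-nonempty ne)) ⟩
    peaks π + windows₂ ascent π ∎)
    where open ≡-Reasoning

  corner-large : ∀ {a h b} → 1 < h → corner a h b ≡ 0
  corner-large {h = suc (suc _)} _ = refl
  corner-large {h = suc zero} (s≤s ())

  columnSum-corner-large : ∀ {a π} → All (1 <_) π → columnSum corner a π ≡ 0
  columnSum-corner-large []                    = refl
  columnSum-corner-large {a} {x ∷ π} (p ∷ ps) = cong₂ _+_ (corner-large {a} {x} {head₀ π} p) (columnSum-corner-large ps)

  columnSum-corner-1 : ∀ a {bs} → All (1 <_) bs → columnSum corner a (1 ∷ bs) ≡ b2n (a ≡ᵇ 0) + 𝟙 (length bs)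
  columnSum-corner-1 a {bs} qs = begin
    b2n (a ≡ᵇ 0) + b2n (head₀ bs ≡ᵇ 0) + 0 + columnSum corner 1 bs  ≡⟨ cong (b2n (a ≡ᵇ 0) + b2n (head₀ bs ≡ᵇ 0) + 0 +_) (columnSum-corner-large qs) ⟩
    b2n (a ≡ᵇ 0) + b2n (head₀ bs ≡ᵇ 0) + 0 + 0                      ≡⟨ trans (+-identityʳ _) (+-identityʳ _) ⟩
    b2n (a ≡ᵇ 0) + b2n (head₀ bs ≡ᵇ 0)                              ≡⟨ cong (b2n (a ≡ᵇ 0) +_) (right-end qs) ⟩
    b2n (a ≡ᵇ 0) + 𝟙 (length bs) ∎
    where
    open ≡-Reasoning
    right-end : ∀ {bs} → All (1 <_) bs → b2n (head₀ bs ≡ᵇ 0) ≡ 𝟙 (length bs)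
    right-end []                 = refl
    right-end {suc _ ∷ _} (_ ∷ _) = refl
    right-end {zero ∷ _} (() ∷ _)

  columnSum-corner-right : ∀ {a as bs} → 1 < a → All (1 <_) as → All (1 <_) bs → columnSum corner a (as ++ 1 ∷ bs) ≡ 𝟙 (length bs)
  columnSum-corner-right {suc a} _ [] qs = columnSum-corner-1 (suc a) qs
  columnSum-corner-right {a} {x ∷ as} {bs} _ (p ∷ ps) qs =
    cong₂ _+_ (corner-large {a} {x} {head₀ (as ++ 1 ∷ bs)} p) (columnSum-corner-right p ps qs)

  columnSum-corner : ∀ {as bs} → All (1 <_) as → All (1 <_) bs → columnSum corner 0 (as ++ 1 ∷ bs) ≡ 𝟙 (length as) + 𝟙 (length bs)
  columnSum-corner [] qs = columnSum-corner-1 0 qs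
  columnSum-corner {x ∷ as} {bs} (p ∷ ps) qs =
    cong₂ _+_ (corner-large {0} {x} {head₀ (as ++ 1 ∷ bs)} p) (columnSum-corner-right p ps qs)

  Av213-columns : ∀ n {π} → 2 ≤ n → π ∈ Av213 n → Columns 0 π
  Av213-columns n 2≤n π∈ = columns (subst (2 ≤_) (sym (∈-Av213-length n π∈)) 2≤n) (positive-entries n π∈)
    (Unique-resp-↭ (↭-sym (proj₁ (∈-Av213⁻ n π∈))) (range1-unique n))

  countDeg-Av213 : ∀ n r {π} → π ∈ Av213 n → countDeg n r π ≡ columnSum (column r) 0 π
  countDeg-Av213 n r {π} π∈ = trans (cong (λ k → countDeg k r π) (sym (∈-Av213-length n π∈))) (countDeg-columns r π)

  leaves-join : ∀ n k m → k + m ≡ suc n → ∀ {L R} → L ∈ Av213 k → R ∈ Av213 m →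
    countDeg (suc (suc n)) 1 (join L R) ≡ peaks L + peaks R + (𝟙 k + 𝟙 m)
  leaves-join n k m k+m {L} {R} L∈ R∈ = begin
    countDeg (suc (suc n)) 1 (join L R)
      ≡⟨ countDeg-Av213 (suc (suc n)) 1 π∈ ⟩
    columnSum (column 1) 0 (join L R)
      ≡⟨ columnSum-cong column-1 (join L R) cs ⟩
    columnSum (λ a h b → peak a h b + corner a h b) 0 (join L R)
      ≡⟨ columnSum-+ peak corner 0 (join L R) ⟩
    columnSum peak 0 (join L R) + columnSum corner 0 (join L R)
      ≡⟨ cong₂ _+_ (trans (columnSum-peak (join-nonempty L R) (positive-entries (suc (suc n)) π∈) cs) (join-peaks k m L∈ R∈))
           (columnSum-corner (shifted-above-1 (length R) (positive-entries k L∈)) (shifted-above-1 0 (positive-entries m R∈))) ⟩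
    peaks L + peaks R + 𝟙 k * 𝟙 m + (𝟙 (length (map (suc (length R) +_) L)) + 𝟙 (length (map suc R)))
      -- With at least two entries the blocks are not both empty, so the exceptional peak of
      -- `join-peaks` does not occur.
      ≡⟨ cong₂ _+_ (trans (cong (peaks L + peaks R +_) (not-both k m k+m)) (+-identityʳ _))
           (cong₂ (λ u v → 𝟙 u + 𝟙 v) (trans (length-map _ L) (∈-Av213-length k L∈)) (trans (length-map suc R) (∈-Av213-length m R∈))) ⟩
    peaks L + peaks R + (𝟙 k + 𝟙 m) ∎
    where
    open ≡-Reasoning
    π∈ : join L R ∈ Av213 (suc (suc n))
    π∈ = subst (λ j → join L R ∈ Av213 (suc j)) k+m (join-∈ k m L∈ R∈)
    cs : Columns 0 (join L R)
    cs = Av213-columns (suc (suc n)) (s≤s (s≤s z≤n)) π∈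
    not-both : ∀ k m → k + m ≡ suc n → 𝟙 k * 𝟙 m ≡ 0
    not-both zero    (suc m) _ = refl
    not-both (suc k) m       _ = refl
    not-both zero    zero    ()

  sum-range1 : ∀ n → 2 * sum (range1 n) ≡ n * suc n
  sum-range1 zero    = refl
  sum-range1 (suc n) = trans (cong (2 *_) (trans (cong sum (sym (map-id (range1 (suc n)))))
      (trans (sum-range1-suc id n) (cong (_+ suc n) (cong sum (map-id (range1 n)))))))
    (trans (*-distribˡ-+ 2 (sum (range1 n)) (suc n)) (trans (cong (_+ 2 * suc n) (sum-range1 n)) (rearrange n)))
    where
    rearrange : ∀ n → n * suc n + 2 * suc n ≡ suc n * suc (suc n)
    rearrange = solve-∀

  windows₂-⊓ : ∀ {π} → 1 ≤ length π → All (1 ≤_) π → windows₂ _⊓_ π + 1 ≡ windows₂ pairMin π + length π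
  windows₂-⊓ _ (_ ∷ []) = refl
  windows₂-⊓ {x ∷ y ∷ π} _ (p ∷ q ∷ ps) = begin
    x ⊓ y + windows₂ _⊓_ (y ∷ π) + 1                    ≡⟨ +-assoc (x ⊓ y) _ 1 ⟩
    x ⊓ y + (windows₂ _⊓_ (y ∷ π) + 1)
      ≡⟨ cong₂ _+_ (sym (m+[n∸m]≡n (⊓-glb p q))) (windows₂-⊓ (s≤s z≤n) (q ∷ ps)) ⟩
    1 + pairMin x y + (windows₂ pairMin (y ∷ π) + length (y ∷ π)) ≡⟨ rearrange (pairMin x y) _ (length (y ∷ π)) ⟩
    pairMin x y + windows₂ pairMin (y ∷ π) + suc (length (y ∷ π)) ∎
    where
    open ≡-Reasoning
    rearrange : ∀ a b l → 1 + a + (b + l) ≡ a + b + suc l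
    rearrange = solve-∀

  module _ (n : ℕ) (2≤n : 2 ≤ n) {π : List ℕ} (π∈ : π ∈ Av213 n) where

    private
      cs : Columns 0 π
      cs = Av213-columns n 2≤n π∈

      |π| : length π ≡ n
      |π| = ∈-Av213-length n π∈

      nonempty : 1 ≤ length π
      nonempty = ≤-trans (s≤s z≤n) (subst (2 ≤_) (sym |π|) 2≤n)

      q : ℕ → ℕ
      q r = countDeg n r π

      q-columns : ∀ r → q r ≡ columnSum (column r) 0 π
      q-columns r = countDeg-Av213 n r π∈

      perm : π ↭ range1 n
      perm = proj₁ (∈-Av213⁻ n π∈)

      columnSum-+₄ : ∀ g₁ g₂ g₃ g₄ → columnSum (λ a h b → g₁ a h b + g₂ a h b + g₃ a h b + g₄ a h b) 0 π
        ≡ columnSum g₁ 0 π + columnSum g₂ 0 π + columnSum g₃ 0 π + columnSum g₄ 0 π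
      columnSum-+₄ g₁ g₂ g₃ g₄ = trans (columnSum-+ (λ a h b → g₁ a h b + g₂ a h b + g₃ a h b) g₄ 0 π)
        (cong (_+ columnSum g₄ 0 π) (trans (columnSum-+ (λ a h b → g₁ a h b + g₂ a h b) g₃ 0 π)
          (cong (_+ columnSum g₃ 0 π) (columnSum-+ g₁ g₂ 0 π))))

      entries-sum : 2 * sum π ≡ n * suc n
      entries-sum = trans (cong (2 *_) (sum-↭ perm)) (sum-range1 n)

      ones : sum (map (λ h → b2n (h ≡ᵇ 1)) π) ≡ 1
      ones = trans (sum-↭ (↭-map⁺ (λ h → b2n (h ≡ᵇ 1)) perm)) (range1-ones 2≤n)
        where
        range1-ones : ∀ {n} → 2 ≤ n → sum (map (λ h → b2n (h ≡ᵇ 1)) (range1 n)) ≡ 1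
        range1-ones {suc n} _ = trans (cong (sum ∘ map (λ h → b2n (h ≡ᵇ 1))) (range1-suc n)) (cong suc
          (trans (cong sum (sym (map-∘ (range1 n))))
            (trans (sum-map-cong (range1 n) (λ { {suc _} _ → refl ; {zero} x∈ → ⊥-elim (n≮0 (proj₁ (∈-range1⁻ n x∈))) }))
              (trans (sum-map-const 0 (range1 n)) (*-zeroʳ (length (range1 n)))))))

    vertex-count : 2 * (q 1 + q 2 + q 3 + q 4) ≡ n * suc n
    vertex-count = trans (cong (2 *_) (begin
      q 1 + q 2 + q 3 + q 4
        ≡⟨ cong₂ _+_ (cong₂ _+_ (cong₂ _+_ (q-columns 1) (q-columns 2)) (q-columns 3)) (q-columns 4) ⟩
      columnSum (column 1) 0 π + columnSum (column 2) 0 π + columnSum (column 3) 0 π + columnSum (column 4) 0 π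
        ≡⟨ sym (columnSum-+₄ (column 1) (column 2) (column 3) (column 4)) ⟩
      columnSum (λ a h b → column 1 a h b + column 2 a h b + column 3 a h b + column 4 a h b) 0 π
        ≡⟨ columnSum-cong column-size π cs ⟩
      columnSum (λ _ h _ → h) 0 π
        ≡⟨ trans (columnSum-height id 0 π) (cong sum (map-id π)) ⟩
      sum π ∎)) entries-sum
      where open ≡-Reasoning

    -- The handshake count: vertical edges give 2 Σ πᵢ - 2n, and each horizontal edge is seen from
    -- both of its columns, which gives 2 Σ min(πᵢ, πᵢ₊₁).
    degree-sum : q 1 + 2 * q 2 + 3 * q 3 + 4 * q 4 ≡ (n ∸ 1) * (n + 2) + 2 * windows₂ pairMin π
    -- The added amount is 2 for each of the n columns, as in `column-degrees`, and 2 more to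
    -- complete twice `windows₂ _⊓_ π + 1`.
    degree-sum = +-cancelʳ-≡ (n * 2 + 2) _ _ (begin
      q 1 + 2 * q 2 + 3 * q 3 + 4 * q 4 + (n * 2 + 2)
        ≡⟨ sym (+-assoc (q 1 + 2 * q 2 + 3 * q 3 + 4 * q 4) (n * 2) 2) ⟩
      q 1 + 2 * q 2 + 3 * q 3 + 4 * q 4 + n * 2 + 2
        ≡⟨ cong (_+ 2) (cong₂ _+_ (cong₂ _+_ (cong₂ _+_ (cong₂ _+_ (q-columns 1) (scaled 2)) (scaled 3)) (scaled 4)) twos) ⟩
      columnSum (column 1) 0 π + columnSum (λ a h b → 2 * column 2 a h b) 0 π + columnSum (λ a h b → 3 * column 3 a h b) 0 π
        + columnSum (λ a h b → 4 * column 4 a h b) 0 π + columnSum (λ _ _ _ → 2) 0 π + 2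
        ≡⟨ cong (λ z → z + columnSum (λ _ _ _ → 2) 0 π + 2)
             (sym (columnSum-+₄ (column 1) (λ a h b → 2 * column 2 a h b) (λ a h b → 3 * column 3 a h b) (λ a h b → 4 * column 4 a h b))) ⟩
      columnSum (λ a h b → column 1 a h b + 2 * column 2 a h b + 3 * column 3 a h b + 4 * column 4 a h b) 0 π + columnSum (λ _ _ _ → 2) 0 π + 2
        ≡⟨ cong (_+ 2) (trans (sym (columnSum-+ (λ a h b → column 1 a h b + 2 * column 2 a h b + 3 * column 3 a h b + 4 * column 4 a h b) (λ _ _ _ → 2) 0 π))
             (columnSum-cong column-degrees π cs)) ⟩
      columnSum (λ a h b → 2 * h + (a ⊓ h + h ⊓ b)) 0 π + 2
        ≡⟨ cong (_+ 2) (trans (columnSum-+ (λ _ h _ → 2 * h) (λ a h b → a ⊓ h + h ⊓ b) 0 π)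
             (cong₂ _+_ (trans (columnSum-* 2 (λ _ h _ → h) 0 π) (cong (2 *_) (trans (columnSum-height id 0 π) (cong sum (map-id π)))))
               (trans (columnSum-+ (λ a h _ → a ⊓ h) (λ _ h b → h ⊓ b) 0 π)
                 (cong₂ _+_ (trans (columnSum-left _⊓_ 0 π) (windows₂-0∷ π)) (columnSum-right _⊓_ ⊓-zeroʳ 0 π))))) ⟩
      2 * sum π + (windows₂ _⊓_ π + windows₂ _⊓_ π) + 2
        ≡⟨ rearrange₁ (2 * sum π) (windows₂ _⊓_ π) ⟩
      2 * sum π + 2 * (windows₂ _⊓_ π + 1)
        ≡⟨ cong₂ (λ u v → u + 2 * v) entries-sum (trans (windows₂-⊓ nonempty (positive-entries n π∈)) (cong (windows₂ pairMin π +_) |π|)) ⟩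
      n * suc n + 2 * (windows₂ pairMin π + n)
        ≡⟨ rearrange₂ 2≤n (windows₂ pairMin π) ⟩
      (n ∸ 1) * (n + 2) + 2 * windows₂ pairMin π + (n * 2 + 2) ∎)
      where
      open ≡-Reasoning
      scaled : ∀ r → r * q r ≡ columnSum (λ a h b → r * column r a h b) 0 π
      scaled r = trans (cong (r *_) (q-columns r)) (sym (columnSum-* r (column r) 0 π))
      twos : n * 2 ≡ columnSum (λ _ _ _ → 2) 0 π
      twos = sym (trans (columnSum-height (λ _ → 2) 0 π) (trans (sum-map-const 2 π) (cong (_* 2) |π|)))
      windows₂-0∷ : ∀ π → windows₂ _⊓_ (0 ∷ π) ≡ windows₂ _⊓_ π
      windows₂-0∷ []      = refl
      windows₂-0∷ (_ ∷ _) = refl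
      rearrange₁ : ∀ s w → s + (w + w) + 2 ≡ s + 2 * (w + 1)
      rearrange₁ = solve-∀
      rearrange₂ : ∀ {n} → 2 ≤ n → ∀ d → n * suc n + 2 * (d + n) ≡ (n ∸ 1) * (n + 2) + 2 * d + (n * 2 + 2)
      rearrange₂ {suc n} _ d = identity n d
        where
        identity : ∀ n d → suc n * suc (suc n) + 2 * (d + suc n) ≡ n * (suc n + 2) + 2 * d + (suc n * 2 + 2)
        identity = solve-∀

    full-degree : q 4 + q 1 ≡ windows₃ tripleMin π + 2
    full-degree = +-cancelʳ-≡ (windows₂ ascent π) _ _ (begin
      q 4 + q 1 + windows₂ ascent π
        ≡⟨ cong₂ _+_ (cong₂ _+_ (q-columns 4) (q-columns 1)) (sym (columnSum-right ascent (λ _ → refl) 0 π)) ⟩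
      columnSum (column 4) 0 π + columnSum (column 1) 0 π + columnSum (λ _ h b → ascent h b) 0 π
        ≡⟨ sym (columnSum-+₃ (column 4) (column 1) (λ _ h b → ascent h b)) ⟩
      columnSum (λ a h b → column 4 a h b + column 1 a h b + ascent h b) 0 π
        ≡⟨ columnSum-cong column-4+1 π cs ⟩
      columnSum (λ a h b → tripleMin a h b + ascent a h + b2n (h ≡ᵇ 1)) 0 π
        ≡⟨ columnSum-+₃ tripleMin (λ a h _ → ascent a h) (λ _ h _ → b2n (h ≡ᵇ 1)) ⟩
      columnSum tripleMin 0 π + columnSum (λ a h _ → ascent a h) 0 π + columnSum (λ _ h _ → b2n (h ≡ᵇ 1)) 0 π
        ≡⟨ cong₂ _+_ (cong₂ _+_
             (trans (columnSum-windows₃ tripleMin (λ a h → cong (_∸ 1) (⊓-zeroʳ (a ⊓ h))) 0 π) (windows₃-0∷ tripleMin (λ _ _ → refl) π))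
             (trans (columnSum-left ascent 0 π) (ascents-0∷ nonempty (positive-entries n π∈))))
             (trans (columnSum-height (λ h → b2n (h ≡ᵇ 1)) 0 π) ones) ⟩
      windows₃ tripleMin π + suc (windows₂ ascent π) + 1
        ≡⟨ rearrange (windows₃ tripleMin π) (windows₂ ascent π) ⟩
      windows₃ tripleMin π + 2 + windows₂ ascent π ∎)
      where
      open ≡-Reasoning
      columnSum-+₃ : ∀ g₁ g₂ g₃ → columnSum (λ a h b → g₁ a h b + g₂ a h b + g₃ a h b) 0 π
        ≡ columnSum g₁ 0 π + columnSum g₂ 0 π + columnSum g₃ 0 π
      columnSum-+₃ g₁ g₂ g₃ = trans (columnSum-+ (λ a h b → g₁ a h b + g₂ a h b) g₃ 0 π)
        (cong (_+ columnSum g₃ 0 π) (columnSum-+ g₁ g₂ 0 π))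
      rearrange : ∀ t a → t + suc a + 1 ≡ t + 2 + a
      rearrange = solve-∀

-- Summing the relations over all 213-avoiding permutations.

module Totals where

  open Permutations
  open Statistics
  open Degrees
  open import Data.Nat
  open import Data.Nat.Properties
  open import Data.Nat.Tactic.RingSolver using (solve-∀)
  open import Relation.Binary.PropositionalEquality
  open import Data.Nat.Combinatorics using (_C_)

  Q-leaves : ∀ m → Q 1 (2 + m) ≡ (2 + m) * catalan (1 + m) + 2 * catalan (1 + m)
  Q-leaves m = total-leaves (countDeg (2 + m) 1) m (leaves-join m)

  total-+ : ∀ f g n → total (λ π → f π + g π) n ≡ total f n + total g n
  total-+ f g n = sum-map-+ f g (Av213 n)

  total-* : ∀ c f n → total (λ π → c * f π) n ≡ c * total f n
  total-* c f n = sum-map-* c f (Av213 n)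

  total-const : ∀ c n → total (λ _ → c) n ≡ catalan n * c
  total-const c n = sum-map-const c (Av213 n)

  Q-vertices : ∀ n → 2 ≤ n → 2 * (Q 1 n + Q 2 n + Q 3 n + Q 4 n) ≡ n * ((n + 1) * catalan n)
  Q-vertices n 2≤n = begin
    2 * (Q 1 n + Q 2 n + Q 3 n + Q 4 n)
      ≡⟨ cong (2 *_) (sym (sum-map-+₄ (q 1) (q 2) (q 3) (q 4) (Av213 n))) ⟩
    2 * total (λ π → q 1 π + q 2 π + q 3 π + q 4 π) n
      ≡⟨ sym (total-* 2 (λ π → q 1 π + q 2 π + q 3 π + q 4 π) n) ⟩
    total (λ π → 2 * (q 1 π + q 2 π + q 3 π + q 4 π)) n
      ≡⟨ trans (sum-map-cong (Av213 n) (vertex-count n 2≤n)) (total-const (n * suc n) n) ⟩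
    catalan n * (n * suc n)
      ≡⟨ rearrange n (catalan n) ⟩
    n * ((n + 1) * catalan n) ∎
    where
    open ≡-Reasoning
    q = countDeg n
    rearrange : ∀ n c → c * (n * suc n) ≡ n * ((n + 1) * c)
    rearrange = solve-∀

  Q-degrees : ∀ n → 2 ≤ n → Q 1 n + 2 * Q 2 n + 3 * Q 3 n + 4 * Q 4 n
    ≡ (n ∸ 1) * (n + 2) * catalan n + 2 * total (windows₂ pairMin) n
  Q-degrees n 2≤n = begin
    Q 1 n + 2 * Q 2 n + 3 * Q 3 n + 4 * Q 4 n
      ≡⟨ cong₂ _+_ (cong₂ _+_ (cong (Q 1 n +_) (sym (total-* 2 (q 2) n))) (sym (total-* 3 (q 3) n))) (sym (total-* 4 (q 4) n)) ⟩
    total (q 1) n + total (λ π → 2 * q 2 π) n + total (λ π → 3 * q 3 π) n + total (λ π → 4 * q 4 π) n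
      ≡⟨ sym (sum-map-+₄ (q 1) (λ π → 2 * q 2 π) (λ π → 3 * q 3 π) (λ π → 4 * q 4 π) (Av213 n)) ⟩
    total (λ π → q 1 π + 2 * q 2 π + 3 * q 3 π + 4 * q 4 π) n
      ≡⟨ sum-map-cong (Av213 n) (degree-sum n 2≤n) ⟩
    total (λ π → (n ∸ 1) * (n + 2) + 2 * windows₂ pairMin π) n
      ≡⟨ total-+ (λ _ → (n ∸ 1) * (n + 2)) (λ π → 2 * windows₂ pairMin π) n ⟩
    total (λ _ → (n ∸ 1) * (n + 2)) n + total (λ π → 2 * windows₂ pairMin π) n
      ≡⟨ cong₂ _+_ (trans (total-const ((n ∸ 1) * (n + 2)) n) (*-comm (catalan n) _)) (total-* 2 (windows₂ pairMin) n) ⟩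
    (n ∸ 1) * (n + 2) * catalan n + 2 * total (windows₂ pairMin) n ∎
    where
    open ≡-Reasoning
    q = countDeg n

  Q-full : ∀ n → 2 ≤ n → Q 4 n + Q 1 n ≡ total (windows₃ tripleMin) n + 2 * catalan n
  Q-full n 2≤n = begin
    Q 4 n + Q 1 n
      ≡⟨ sym (total-+ (countDeg n 4) (countDeg n 1) n) ⟩
    total (λ π → countDeg n 4 π + countDeg n 1 π) n
      ≡⟨ sum-map-cong (Av213 n) (full-degree n 2≤n) ⟩
    total (λ π → windows₃ tripleMin π + 2) n
      ≡⟨ total-+ (windows₃ tripleMin) (λ _ → 2) n ⟩
    total (windows₃ tripleMin) n + total (λ _ → 2) n
      ≡⟨ cong (total (windows₃ tripleMin) n +_) (trans (total-const 2 n) (*-comm (catalan n) 2)) ⟩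
    total (windows₃ tripleMin) n + 2 * catalan n ∎
    where open ≡-Reasoning

  open CatalanGeneratingFunction.CatalanSeries catalan central catalan-eq central-eq

  catalan-central-binomial : ∀ n → (n + 1) * catalan n ≡ (2 * n) C n
  catalan-central-binomial n = trans (cong (_* catalan n) (+-comm n 1))
    (trans (c-b n) (CentralBinomial.central-binomial-unique central b-zero b-suc n))

  catalan-suc : ∀ n → (n + 2) * catalan (suc n) ≡ (4 * n + 2) * catalan n
  catalan-suc = c-suc

  pairMin-total : ∀ m → let n = 2 + m in
    2 * total (windows₂ pairMin) n + 8 * 4 ^ m + 2 * ((n + 1) * catalan n) ≡ n * ((n + 1) * catalan n) + 4 * catalan n
  pairMin-total m = subst
    (λ k → 2 * total (windows₂ pairMin) (2 + m) + 8 * 4 ^ m + 2 * (k * catalan (2 + m)) ≡ (2 + m) * (k * catalan (2 + m)) + 4 * catalan (2 + m))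
    (+-comm 1 (2 + m)) (pairs-coefficient (total (windows₂ pairMin)) total-pairMin m)

  tripleMin-total : ∀ m → let n = 2 + m in
    2 * total (windows₃ tripleMin) n + 14 * 4 ^ m + 2 * ((n + 1) * catalan n)
      ≡ n * ((n + 1) * catalan n) + n * catalan (1 + m) + 6 * catalan n
  tripleMin-total m = subst
    (λ k → 2 * total (windows₃ tripleMin) (2 + m) + 14 * 4 ^ m + 2 * (k * catalan (2 + m))
      ≡ (2 + m) * (k * catalan (2 + m)) + (2 + m) * catalan (1 + m) + 6 * catalan (2 + m))
    (+-comm 1 (2 + m)) (triples-coefficient (total (windows₃ tripleMin)) total-tripleMin m)

-- Passage to the integers and the four formulas.

open import Data.Nat using (ℕ; _≤_; _∸_)
open import Data.Nat.Combinatorics using (_C_)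
open import Data.Integer using (ℤ; +_; _+_; _-_; _*_; _^_)
open import Data.Product using (_×_)
open import Relation.Binary.PropositionalEquality using (_≡_)

open import Data.Integer.Properties using (pos-*)
open import Data.Integer.Tactic.RingSolver using (solve-∀)
open import Data.Nat using (suc; s≤s)
open import Data.Product using (_,_)
open import Relation.Binary.PropositionalEquality using (refl; sym; trans; cong; cong₂; subst; subst₂)
open Statistics using (catalan; total; windows₂; windows₃; pairMin; tripleMin)

pos-^ : ∀ b m → + (b Data.Nat.^ m) ≡ (+ b) ^ m
pos-^ b 0       = refl
pos-^ b (suc m) = trans (pos-* b (b Data.Nat.^ m)) (cong (+ b *_) (pos-^ b m))

pos-*₂ : ∀ a b c → + (a Data.Nat.* (b Data.Nat.* c)) ≡ + a * (+ b * + c)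
pos-*₂ a b c = trans (pos-* a (b Data.Nat.* c)) (cong (+ a *_) (pos-* b c))

theorem8p1 : (n : ℕ) → 2 ≤ n →
  let N = + n
      B = + ((2 Data.Nat.* n) C n)
      F = (+ 4) ^ n
  in (+ 2 * (+ 2 * N - + 1) * + Q 1 n ≡ (N + + 2) * B)
   × (+ 16 * (N + + 1) * (+ 2 * N - + 1) * + Q 2 n
        ≡ (+ 12 * N * N + + 44 * N - + 112) * B + (+ 2 * N * N + N - + 1) * F)
   × (+ 8 * (N + + 1) * (+ 2 * N - + 1) * + Q 3 n
        ≡ (+ 8 * N * N - + 96 * N + + 88) * B + (+ 6 * N * N + + 3 * N - + 3) * F)
   × (+ 4 * (N + + 1) * (+ 2 * N - + 1) * + Q 4 n
        ≡ (+ 4 * N * N * N - + 7 * N * N + + 29 * N - + 20) * B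
          - + 7 * ((+ 4) ^ (n ∸ 2)) * (+ 4 * (N + + 1) * (+ 2 * N - + 1)))
-- Writing n = m + 2 makes Cₙ₋₁ and 4ⁿ⁻² available without truncated subtraction.
theorem8p1 (suc (suc m)) 2≤n =
    subst (λ B → + 2 * (+ 2 * N - + 1) * + Q 1 n ≡ (N + + 2) * B) B-eq solve₁
  , subst₂ (λ B F → + 16 * (N + + 1) * (+ 2 * N - + 1) * + Q 2 n
      ≡ (+ 12 * N * N + + 44 * N - + 112) * B + (+ 2 * N * N + N - + 1) * F) B-eq F-eq solve₂
  , subst₂ (λ B F → + 8 * (N + + 1) * (+ 2 * N - + 1) * + Q 3 n
      ≡ (+ 8 * N * N - + 96 * N + + 88) * B + (+ 6 * N * N + + 3 * N - + 3) * F) B-eq F-eq solve₃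
  , subst₂ (λ B E → + 4 * (N + + 1) * (+ 2 * N - + 1) * + Q 4 n
      ≡ (+ 4 * N * N * N - + 7 * N * N + + 29 * N - + 20) * B
        - + 7 * E * (+ 4 * (N + + 1) * (+ 2 * N - + 1))) B-eq (pos-^ 4 m) solve₄
  where
  n : ℕ
  n = suc (suc m)
  N y z E T D : ℤ
  N = + n
  y = + catalan n
  z = + catalan (suc m)
  E = + (4 Data.Nat.^ m)
  T = + total (windows₃ tripleMin) n
  D = + total (windows₂ pairMin) n

  ratio : (N + + 1) * y ≡ + 2 * (+ 2 * N - + 1) * z
  ratio = trans (left (+ m) y) (trans (sym (pos-* (suc m Data.Nat.+ 2) (catalan n)))
    (trans (cong +_ (Totals.catalan-suc (suc m)))
      (trans (pos-* (4 Data.Nat.* suc m Data.Nat.+ 2) (catalan (suc m)))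
        (trans (cong (λ k → (k + + 2) * z) (pos-* 4 (suc m))) (right (+ m) z)))))
    where
    left : ∀ M y → (+ 2 + M + + 1) * y ≡ (+ 1 + M + + 2) * y
    left = solve-∀
    right : ∀ M z → (+ 4 * (+ 1 + M) + + 2) * z ≡ + 2 * (+ 2 * (+ 2 + M) - + 1) * z
    right = solve-∀

  leaves : + Q 1 n ≡ N * z + + 2 * z
  leaves = trans (cong +_ (Totals.Q-leaves m)) (cong₂ _+_ (pos-* n (catalan (suc m))) (pos-* 2 (catalan (suc m))))

  triples : + 2 * T + + 14 * E + + 2 * ((N + + 1) * y) ≡ N * ((N + + 1) * y) + N * z + + 6 * y
  triples = trans
    (sym (cong₂ _+_ (cong₂ _+_ (pos-* 2 (total (windows₃ tripleMin) n)) (pos-* 14 (4 Data.Nat.^ m))) (pos-*₂ 2 (n Data.Nat.+ 1) (catalan n))))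
    (trans (cong +_ (Totals.tripleMin-total m))
      (cong₂ _+_ (cong₂ _+_ (pos-*₂ n (n Data.Nat.+ 1) (catalan n)) (pos-* n (catalan (suc m)))) (pos-* 6 (catalan n))))

  pairs : + 2 * D + + 8 * E + + 2 * ((N + + 1) * y) ≡ N * ((N + + 1) * y) + + 4 * y
  pairs = trans
    (sym (cong₂ _+_ (cong₂ _+_ (pos-* 2 (total (windows₂ pairMin) n)) (pos-* 8 (4 Data.Nat.^ m))) (pos-*₂ 2 (n Data.Nat.+ 1) (catalan n))))
    (trans (cong +_ (Totals.pairMin-total m)) (cong₂ _+_ (pos-*₂ n (n Data.Nat.+ 1) (catalan n)) (pos-* 4 (catalan n))))

  full : + Q 4 n + + Q 1 n ≡ T + + 2 * y
  full = trans (cong +_ (Totals.Q-full n 2≤n)) (cong (λ k → T + k) (pos-* 2 (catalan n)))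

  vertices : + 2 * (+ Q 1 n + + Q 2 n + + Q 3 n + + Q 4 n) ≡ N * ((N + + 1) * y)
  vertices = trans (sym (pos-* 2 (Q 1 n Data.Nat.+ Q 2 n Data.Nat.+ Q 3 n Data.Nat.+ Q 4 n)))
    (trans (cong +_ (Totals.Q-vertices n 2≤n)) (pos-*₂ n (n Data.Nat.+ 1) (catalan n)))

  degrees : + Q 1 n + + 2 * + Q 2 n + + 3 * + Q 3 n + + 4 * + Q 4 n ≡ (N - + 1) * (N + + 2) * y + + 2 * D
  degrees = trans
    (sym (cong₂ _+_ (cong₂ _+_ (cong (λ k → + Q 1 n + k) (pos-* 2 (Q 2 n))) (pos-* 3 (Q 3 n))) (pos-* 4 (Q 4 n))))
    (trans (cong +_ (Totals.Q-degrees n 2≤n))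
      (cong₂ _+_ (trans (pos-* (suc m Data.Nat.* (n Data.Nat.+ 2)) (catalan n)) (cong (_* y) (pos-* (suc m) (n Data.Nat.+ 2))))
                 (pos-* 2 (total (windows₂ pairMin) n))))

  open LinearSystem.Solve N y z E (+ Q 1 n) (+ Q 2 n) (+ Q 3 n) (+ Q 4 n) T D ratio leaves triples pairs full vertices degrees

  B-eq : (N + + 1) * y ≡ + ((2 Data.Nat.* n) C n)
  B-eq = trans (sym (pos-* (n Data.Nat.+ 1) (catalan n))) (cong +_ (Totals.catalan-central-binomial n))

  F-eq : + 16 * E ≡ (+ 4) ^ n
  F-eq = trans (cong (+ 16 *_) (pos-^ 4 m)) (rearrange ((+ 4) ^ m))
    where
    rearrange : ∀ E → + 16 * E ≡ + 4 * (+ 4 * E)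
    rearrange = solve-∀
theorem8p1 1 (s≤s ())
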